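{- Let $a, b \in \mathbb{N}$ with $1 \leq a < b$ and $\gcd(a,b) = 1$, let $\theta = a/b$, and set $$C_{\theta} = \frac{1}{b-a} \sum_{i=1}^{\lfloor b/a \rfloor} \frac{1}{i}.$$ (1) Let $w = w(n)$ be a positive real-valued function with $w(n) = o(n^{1/3})$ as $n \to \infty$. If, for each $n$, $\mathcal{F}_n$ is a $w(n)$-bounded $\theta$-intersecting family over $[n]$, then $|\mathcal{F}_n| \leq (C_{\theta} + o(1)) n$ as $n \to \infty$. (2) The constant $C_\theta$ is best possible for $\theta \in \{1/3\} \cup [1/2, 1)$: for each such rational $\theta = a/b$, there exist a positive function $w(n) = o(n^{1/3})$ and, for each $n$, a $w(n)$-bounded $\theta$-intersecting family $\mathcal{F}_n$ over $[n]$ with $|\mathcal{F}_n| \geq (C_{\theta} - o(1)) n$ as $n \to \infty$. (3) Let $w(n)=o(n^{1/3})$ and $(\mathcal{F}_n)$ be as in (1), and suppose that (asymptotic) equality holds, i.e. $|\mathcal{F}_n| = (C_{\theta} + o(1)) n$ as $n\to\infty$. Then for each $n$ there is a bouquet $\mathcal{F}_n^{*} \subseteq \mathcal{F}_n$ such that $|\mathcal{F}_n \setminus \mathcal{F}_n^{*}| = o(n)$, and all but $o(n)$ elements $x \in [n]$ have the property that for every integer $i$ with $1 \leq i \leq \lfloor b/a \rfloor$, $x$ is contained in some set of $\mathcal{F}_n^{*}$ of size $ib$.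
   Context: Write $[n] = \{1,\dots,n\}$. A family over $[n]$ is a set of (distinct) subsets of $[n]$. For $\theta \in (0,1)\cap\mathbb{Q}$, a (fractional) $\theta$-intersecting family over $[n]$ is a collection $\mathcal{F}$ of nonempty subsets of $[n]$ such that for all $A, B \in \mathcal{F}$ with $A \neq B$ we have $|A \cap B| \in \{\theta |A|, \theta |B|\}$. For a positive real $w$, a family of sets is $w$-bounded if every set in the family has size at most $w$. A sunflower is a set family $\mathcal{F}$ in which all pairwise intersections are the same: for all distinct $F, F' \in \mathcal{F}$, $F \cap F' = \bigcap_{F'' \in \mathcal{F}} F''$. The set $C = \bigcap_{F'' \in \mathcal{F}} F''$ is its core, and the pairwise disjoint sets $F \setminus C$, $F \in \mathcal{F}$, are its petals. For a family $\mathcal{F}$ and an integer $k$, $\mathcal{F}(k)$ denotes the collection of all sets in $\mathcal{F}$ of size $k$. Let $\mathcal{F}$ be a family over $[n]$ and let $k_1 < \dots < k_t$ be the sizes of the sets in $\mathcal{F}$. Then $\mathcal{F}$ is a bouquet if: (i) each $\mathcal{F}(k_j)$ is a sunflower with at least two petals (i.e. with at least two members); (ii) $C_{k_1} \subsetneq C_{k_2} \subsetneq \dots \subsetneq C_{k_t}$, where $C_{k_j}$ denotes the core of $\mathcal{F}(k_j)$; (iii) for every $F \in \mathcal{F}$ we have $F \cap C_{k_t} = C_{|F|}$. -}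

module Defs where

open import Data.Nat.Base as ℕ using (ℕ; zero; suc)
import Data.Nat.Properties as ℕ
open import Data.Integer.Base using (+_)
open import Data.Rational.Base
open import Data.Rational.Properties
open import Algebra.Properties.Group +-0-group using () renaming (⁻¹-involutive to neg-involutive)
open import Data.Bool.Properties using () renaming (_≟_ to _≟ᵇ_)
open import Data.Fin.Subset using (Subset; Nonempty; _∩_; ⋂; _⊂_) renaming (∣_∣ to size)
open import Data.List.Base using (List; length; filter)
open import Data.List.Membership.Propositional using (_∈_)
import Data.List.Membership.DecPropositional as DecMembership
import Data.List.Relation.Binary.Subset.Propositional as List
open import Data.List.Relation.Unary.Unique.Propositional using (Unique)
open import Data.List.Relation.Unary.Unique.Propositional.Properties using (filter⁺)
open import Data.Vec.Properties using (≡-dec)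
open import Data.Product.Base using (∃-syntax; _×_; _,_)
open import Data.Sum.Base using (_⊎_; inj₁; inj₂)
open import Data.Empty using (⊥)
open import Relation.Nullary using (yes; no; ¬?)
open import Relation.Unary using (Decidable)
open import Relation.Binary.Definitions using (DecidableEquality)
open import Relation.Binary.PropositionalEquality using (_≡_; _≢_; sym; trans; cong; subst; subst₂)

fromℕ : ℕ → ℚ
fromℕ n = + n / 1

-- Two-sided Dedekind cuts.
record ℝ : Set₁ where
  field
    L U         : ℚ → Set
    L-inhabited : ∃[ q ] L q
    U-inhabited : ∃[ q ] U q
    L-closed    : ∀ {q r} → q < r → L r → L q
    U-closed    : ∀ {q r} → q < r → U q → U r
    L-open      : ∀ {q} → L q → ∃[ r ] q < r × L r
    U-open      : ∀ {r} → U r → ∃[ q ] q < r × U q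
    disjoint    : ∀ {q} → L q → U q → ⊥
    located     : ∀ {q r} → q < r → L q ⊎ U r

infix 4 _<ᵣ_ _≤ᵣ_

_<ᵣ_ : ℝ → ℝ → Set
x <ᵣ y = ∃[ q ] ℝ.U x q × ℝ.L y q

_≤ᵣ_ : ℝ → ℝ → Set
x ≤ᵣ y = ∀ {q} → ℝ.L x q → ℝ.L y q

q<q+1 : ∀ q → q < q + 1ℚ
q<q+1 q = subst (_< q + 1ℚ) (+-identityʳ q) (+-monoʳ-< q (positive⁻¹ 1ℚ))

q-1<q : ∀ q → q - 1ℚ < q
q-1<q q = subst (q - 1ℚ <_) (+-identityʳ q) (+-monoʳ-< q (negative⁻¹ (- 1ℚ)))

fromℚ : ℚ → ℝ
fromℚ p = record
  { L           = _< p
  ; U           = p <_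
  ; L-inhabited = p - 1ℚ , q-1<q p
  ; U-inhabited = p + 1ℚ , q<q+1 p
  ; L-closed    = <-trans
  ; U-closed    = λ q<r p<q → <-trans p<q q<r
  ; L-open      = λ q<p → let r , q<r , r<p = <-dense q<p in r , q<r , r<p
  ; U-open      = λ p<r → let q , p<q , q<r = <-dense p<r in q , q<r , p<q
  ; disjoint    = λ q<p p<q → <-asym q<p p<q
  ; located     = loc
  }
  where
  loc : ∀ {q r} → q < r → q < p ⊎ p < r
  loc {q} q<r with q <? p
  ... | yes q<p = inj₁ q<p
  ... | no  q≮p = inj₂ (≤-<-trans (≮⇒≥ q≮p) q<r)

cube : ℚ → ℚ
cube q = q * q * q

private
  0≤⇒cube-mono-< : ∀ {x y} → 0ℚ ≤ x → x < y → cube x < cube y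
  0≤⇒cube-mono-< {x} {y} 0≤x x<y = ≤-<-trans (*-monoʳ-≤-nonNeg x xx≤yy) (*-monoʳ-<-pos (y * y) x<y)
    where
    instance
      x≥0 : NonNegative x
      x≥0 = nonNegative 0≤x
      y>0 : Positive y
      y>0 = positive (≤-<-trans 0≤x x<y)
      y≥0 : NonNegative y
      y≥0 = pos⇒nonNeg y
      yy>0 : Positive (y * y)
      yy>0 = pos*pos⇒pos y y
    xx≤yy : x * x ≤ y * y
    xx≤yy = ≤-trans (*-monoʳ-≤-nonNeg x (<⇒≤ x<y)) (*-monoˡ-≤-nonNeg y (<⇒≤ x<y))

  cube-neg : ∀ x → cube (- x) ≡ - cube x
  cube-neg x = trans (cong (_* - x) (trans (sym (neg-distribˡ-* x (- x)))
                 (trans (cong -_ (sym (neg-distribʳ-* x x))) (neg-involutive (x * x)))))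
               (sym (neg-distribʳ-* (x * x) x))

  neg-cancel-< : ∀ {x y} → - x < - y → y < x
  neg-cancel-< {x} {y} lt = subst₂ _<_ (neg-involutive y) (neg-involutive x) (neg-antimono-< lt)

  cube-mono-≤0 : ∀ {x y} → y ≤ 0ℚ → x < y → cube x < cube y
  cube-mono-≤0 {x} {y} y≤0 x<y = neg-cancel-< (subst₂ _<_ (cube-neg y) (cube-neg x)
    (0≤⇒cube-mono-< (neg-antimono-≤ y≤0) (neg-antimono-< x<y)))

  cube-mono-< : ∀ {x y} → x < y → cube x < cube y
  cube-mono-< {x} {y} x<y with 0ℚ ≤? x | y ≤? 0ℚ
  ... | yes 0≤x | _       = 0≤⇒cube-mono-< 0≤x x<y
  ... | no  _   | yes y≤0 = cube-mono-≤0 y≤0 x<y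
  ... | no  0≰x | no  y≰0 = <-trans (cube-mono-≤0 ≤-refl (≰⇒> 0≰x)) (0≤⇒cube-mono-< ≤-refl (≰⇒> y≰0))

  fromℕ-nonNeg : ∀ n → 0ℚ ≤ fromℕ n
  fromℕ-nonNeg n = nonNegative⁻¹ (fromℕ n) {{normalize-nonNeg n 1}}

  n<cube[n+1] : ∀ n → fromℕ n < cube (fromℕ n + 1ℚ)
  n<cube[n+1] n = <-≤-trans (q<q+1 (fromℕ n))
    (subst (_≤ cube y) (*-identityˡ y) (*-monoʳ-≤-nonNeg y 1≤yy))
    where
    y = fromℕ n + 1ℚ
    1≤y : 1ℚ ≤ y
    1≤y = subst (_≤ y) (+-identityˡ 1ℚ) (+-monoˡ-≤ 1ℚ (fromℕ-nonNeg n))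
    instance
      y≥0 : NonNegative y
      y≥0 = nonNegative (≤-trans (nonNegative⁻¹ 1ℚ) 1≤y)
    1≤yy : 1ℚ ≤ y * y
    1≤yy = ≤-trans 1≤y (subst (_≤ y * y) (*-identityˡ y) (*-monoʳ-≤-nonNeg y 1≤y))

-- The real cube root of n. Quantifying over r, instead of taking
-- L q = cube q < n, makes the cut open without a continuity argument.
∛_ : ℕ → ℝ
∛ n = record
  { L           = λ q → ∃[ r ] q < r × cube r < fromℕ n
  ; U           = λ q → ∃[ r ] r < q × fromℕ n < cube r
  ; L-inhabited = - 1ℚ - 1ℚ , - 1ℚ , q-1<q (- 1ℚ) , <-≤-trans (negative⁻¹ (- 1ℚ)) (fromℕ-nonNeg n)
  ; U-inhabited = fromℕ n + 1ℚ + 1ℚ , fromℕ n + 1ℚ , q<q+1 _ , n<cube[n+1] n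
  ; L-closed    = λ { q<r (s , r<s , h) → s , <-trans q<r r<s , h }
  ; U-closed    = λ { q<r (s , s<q , h) → s , <-trans s<q q<r , h }
  ; L-open      = λ { (s , q<s , h) → let m , q<m , m<s = <-dense q<s in m , q<m , s , m<s , h }
  ; U-open      = λ { (s , s<r , h) → let m , s<m , m<r = <-dense s<r in m , m<r , s , s<m , h }
  ; disjoint    = λ { (r , q<r , h) (s , s<q , k) →
                      <-asym (<-trans h k) (cube-mono-< (<-trans s<q q<r)) }
  ; located     = loc
  }
  where
  loc : ∀ {q r} → q < r →
        (∃[ s ] q < s × cube s < fromℕ n) ⊎ (∃[ s ] s < r × fromℕ n < cube s)
  loc q<r with <-dense q<r
  ... | m , q<m , m<r with <-dense m<r | cube m <? fromℕ n
  ...   | _              | yes h = inj₁ (m , q<m , h)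
  ...   | k , m<k , k<r  | no  h = inj₂ (k , k<r , ≤-<-trans (≮⇒≥ h) (cube-mono-< m<k))

infixr 7 _•_

_•_ : (ε : ℚ) .{{_ : Positive ε}} → ℝ → ℝ
_•_ ε x = record
  { L           = λ q → L (ε⁻¹ * q)
  ; U           = λ q → U (ε⁻¹ * q)
  ; L-inhabited = let q , h = L-inhabited in ε * q , subst L (sym (cancel q)) h
  ; U-inhabited = let q , h = U-inhabited in ε * q , subst U (sym (cancel q)) h
  ; L-closed    = λ q<r → L-closed (scale q<r)
  ; U-closed    = λ q<r → U-closed (scale q<r)
  ; L-open      = λ {q} h → let r , q<r , k = L-open h in
                    ε * r , subst (_< ε * r) (cancel′ q) (*-monoʳ-<-pos ε q<r) , subst L (sym (cancel r)) k
  ; U-open      = λ {r} h → let q , q<r , k = U-open h in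
                    ε * q , subst (ε * q <_) (cancel′ r) (*-monoʳ-<-pos ε q<r) , subst U (sym (cancel q)) k
  ; disjoint    = disjoint
  ; located     = λ q<r → located (scale q<r)
  }
  where
  open ℝ x
  instance
    ε≢0 : NonZero ε
    ε≢0 = pos⇒nonZero ε
  ε⁻¹ : ℚ
  ε⁻¹ = 1/ ε
  instance
    ε⁻¹>0 : Positive ε⁻¹
    ε⁻¹>0 = 1/pos⇒pos ε
  scale : ∀ {q r} → q < r → ε⁻¹ * q < ε⁻¹ * r
  scale = *-monoʳ-<-pos ε⁻¹
  cancel : ∀ q → ε⁻¹ * (ε * q) ≡ q
  cancel q = trans (sym (*-assoc ε⁻¹ ε q)) (trans (cong (_* q) (*-inverseˡ ε)) (*-identityˡ q))
  cancel′ : ∀ q → ε * (ε⁻¹ * q) ≡ q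
  cancel′ q = trans (sym (*-assoc ε ε⁻¹ q)) (trans (cong (_* q) (*-inverseʳ ε)) (*-identityˡ q))

-- w(n) = o(n^{1/3}); no absolute value, as w is only ever positive.
IsO[∛n] : (ℕ → ℝ) → Set
IsO[∛n] w = ∀ (ε : ℚ) .{{_ : Positive ε}} → ∃[ N ] (∀ n → N ℕ.≤ n → w n ≤ᵣ ε • ∛ n)

IsO[n] : (ℕ → ℕ) → Set
IsO[n] f = ∀ (ε : ℚ) .{{_ : Positive ε}} → ∃[ N ] (∀ n → N ℕ.≤ n → fromℕ (f n) ≤ ε * fromℕ n)

IsO[1] : (ℕ → ℚ) → Set
IsO[1] δ = ∀ (ε : ℚ) .{{_ : Positive ε}} → ∃[ N ] (∀ n → N ℕ.≤ n → ∣ δ n ∣ ≤ ε)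

record Family (n : ℕ) : Set where
  constructor family
  field
    members : List (Subset n)
    unique  : Unique members

open Family public

infix 4 _∈ᶠ_ _⊆ᶠ_

_∈ᶠ_ : ∀ {n} → Subset n → Family n → Set
A ∈ᶠ F = A ∈ members F

_⊆ᶠ_ : ∀ {n} → Family n → Family n → Set
F ⊆ᶠ G = members F List.⊆ members G

card : ∀ {n} → Family n → ℕ
card F = length (members F)

filterᶠ : ∀ {n} {P : Subset n → Set} → Decidable P → Family n → Family n
filterᶠ P? (family xs u) = family (filter P? xs) (filter⁺ P? u)

_≟ˢ_ : ∀ {n} → DecidableEquality (Subset n)
_≟ˢ_ = ≡-dec _≟ᵇ_

_∖_ : ∀ {n} → Family n → Family n → Family n
F ∖ G = filterᶠ (λ A → ¬? (A ∈? members G)) F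
  where open DecMembership _≟ˢ_ using (_∈?_)

_⟨_⟩ : ∀ {n} → Family n → ℕ → Family n
F ⟨ k ⟩ = filterᶠ (λ A → size A ℕ.≟ k) F

record IsIntersecting (θ : ℚ) {n : ℕ} (F : Family n) : Set where
  field
    nonempty     : ∀ {A} → A ∈ᶠ F → Nonempty A
    intersecting : ∀ {A B} → A ∈ᶠ F → B ∈ᶠ F → A ≢ B →
                   fromℕ (size (A ∩ B)) ≡ θ * fromℕ (size A) ⊎
                   fromℕ (size (A ∩ B)) ≡ θ * fromℕ (size B)

IsBounded : ℝ → ∀ {n} → Family n → Set
IsBounded w F = ∀ {A} → A ∈ᶠ F → fromℚ (fromℕ (size A)) ≤ᵣ w

core : ∀ {n} → Family n → Subset n
core F = ⋂ (members F)

IsSunflower : ∀ {n} → Family n → Set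
IsSunflower F = ∀ {A B} → A ∈ᶠ F → B ∈ᶠ F → A ≢ B → A ∩ B ≡ core F

IsSizeOf : ∀ {n} → ℕ → Family n → Set
IsSizeOf k F = ∃[ A ] A ∈ᶠ F × size A ≡ k

-- The empty family (t = 0) is a bouquet.
record IsBouquet {n : ℕ} (F : Family n) : Set where
  field
    sunflower : ∀ {k} → IsSizeOf k F → IsSunflower (F ⟨ k ⟩) × 2 ℕ.≤ card (F ⟨ k ⟩)
    chain     : ∀ {k l} → IsSizeOf k F → IsSizeOf l F → k ℕ.< l → core (F ⟨ k ⟩) ⊂ core (F ⟨ l ⟩)
    -- k is the largest size k_t
    trace     : ∀ {k} → IsSizeOf k F → (∀ {l} → IsSizeOf l F → l ℕ.≤ k) →
                ∀ {A} → A ∈ᶠ F → A ∩ core (F ⟨ k ⟩) ≡ core (F ⟨ size A ⟩)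

harmonic : ℕ → ℚ
harmonic zero    = 0ℚ
harmonic (suc m) = harmonic m + + 1 / suc m

module _ (a b : ℕ) (1≤a : 1 ℕ.≤ a) (a<b : a ℕ.< b) where

  private instance
    a≢0 : ℕ.NonZero a
    a≢0 = ℕ.>-nonZero 1≤a
    b≢0 : ℕ.NonZero b
    b≢0 = ℕ.>-nonZero (ℕ.<-trans 1≤a a<b)
    b-a≢0 : ℕ.NonZero (b ℕ.∸ a)
    b-a≢0 = ℕ.>-nonZero (ℕ.m<n⇒0<n∸m a<b)

  ratio : ℚ
  ratio = + a / b

  ⌊b/a⌋ : ℕ
  ⌊b/a⌋ = b ℕ./ a

  C : ℚ
  C = (+ 1 / (b ℕ.∸ a)) * harmonic ⌊b/a⌋

module Submission where

-- Part (1). If more than 2 k² sets of equal size k meet pairwise in l points, they form a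
-- sunflower (a weak form of Deza's theorem), so with W the largest size of a member, all but
-- O(W³) = o(n) members lie in layers F(k) that are sunflowers with more than W petals. A set
-- of size at most W misses some petal of such a layer; hence the cores of these layers form a
-- chain, and every layer but the top one has at most one member whose trace on the top core
-- M is not the core of its own layer. Removing these exceptional members leaves the bouquet F*.
--
-- A member of F* of size i b has (b − a) i points outside of M; give each of them weight 1/i.
-- The members of F* through a fixed x ∉ M have distinct sizes i b, and any two of these indices satisfy
-- a j ≤ b i. If r is the least of them, they lie in [r, (q + 1) r) with q = ⌊b/a⌋; summing over
-- blocks of length r bounds the weight at x by 1 + 1/2 + ⋯ + 1/q. Summed over x this is (1).
--
-- Part (3). The weight at x falls short of that bound by at least 1/(6 q) unless the indices at
-- x are exactly 1, …, q, so if equality holds asymptotically this happens for all but o(n) points.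
--
-- Part (2). Nested cores are completed by disjoint copies of a finite block of petals.

-- The exponent 1/3 comes from the discarded layers: there are at most W sizes, and each may hide up
-- to 2 W² sets without being forced into a sunflower.
--
-- The weak Deza theorem is a second moment argument. The Gram matrix of the members is (k - l) I +
-- l J, which forces d e ≤ k (d + e) for the numbers d and e of members through and missing a point,
-- so each point has d ≤ 2 k or e ≤ 2 k. Averaging then gives two members whose intersection S lies
-- in more than k members; any further member misses one of their petals and hence contains S.
--
-- Coprimality of a and b turns the intersection condition inside a layer into size i b and core
-- size i a. Two members of F* of sizes i b < j b through a point x outside M share x besides a core
-- of size i a, so they meet in j a points; as this is at most i b, the ratio bound follows.
--
-- A point attains the bound only with one member of each index 1, ..., q. The blocks for sharpness
-- therefore partition their points into petals once for every index, while petals of different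
-- indices must meet in exactly the permitted numbers of points; θ = 1/3 is where this takes a real
-- arrangement.

module Sums where

  open import Level using (0ℓ)
  open import Algebra.Bundles using (CommutativeSemigroup)
  open import Algebra.Core using (Op₂)
  import Algebra.Properties.CommutativeSemigroup as CommutativeSemigroupProperties
  open import Algebra.Structures using (IsCommutativeSemiring)
  open import Data.List.Base using (List; []; _∷_; _++_; map)
  open import Data.List.Membership.Propositional using (_∈_)
  open import Data.List.Membership.Propositional.Properties using (∈-∃++; ∈-++⁺ˡ; ∈-++⁺ʳ; ∈-++⁻)
  open import Data.List.Relation.Unary.Any using (here; there)
  open import Data.List.Relation.Unary.All as All using ()
  open import Data.List.Relation.Unary.AllPairs using ([]; _∷_)
  open import Data.List.Relation.Unary.Unique.Propositional using (Unique)
  open import Data.List.Relation.Binary.Subset.Propositional using (_⊆_)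
  open import Data.Product.Base using (_,_)
  open import Data.Sum.Base using (inj₁; inj₂)
  open import Function.Base using (_∘_)
  open import Relation.Binary.Core using (Rel)
  open import Relation.Binary.Structures using (IsPreorder)
  open import Relation.Nullary using (contradiction)
  open import Relation.Binary.PropositionalEquality

  -- Abstract in the ordered semiring, because incidences are counted in ℕ and weights are summed in
  -- ℚ.
  module Sum {K : Set} (_+_ _*_ : Op₂ K) (0# 1# : K)
    (isCommutativeSemiring : IsCommutativeSemiring _≡_ _+_ _*_ 0# 1#)
    (_≤_ : Rel K 0ℓ) (isPreorder : IsPreorder _≡_ _≤_)
    (+-mono-≤ : ∀ {w x y z} → w ≤ x → y ≤ z → (w + y) ≤ (x + z))
    where

    open IsCommutativeSemiring isCommutativeSemiring
      using (+-assoc; +-comm; +-identityˡ; +-isCommutativeSemigroup; distribˡ; *-comm; zeroʳ)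
    open IsPreorder isPreorder using () renaming (refl to ≤-refl; trans to ≤-trans; reflexive to ≤-reflexive)

    private
      +-commutativeSemigroup : CommutativeSemigroup 0ℓ 0ℓ
      +-commutativeSemigroup = record { isCommutativeSemigroup = +-isCommutativeSemigroup }

    open CommutativeSemigroupProperties +-commutativeSemigroup using (interchange)

    private variable
      A B : Set

    ∑ : List A → (A → K) → K
    ∑ []       f = 0#
    ∑ (x ∷ xs) f = f x + ∑ xs f

    ∑-cong : ∀ (xs : List A) {f g} → (∀ {x} → x ∈ xs → f x ≡ g x) → ∑ xs f ≡ ∑ xs g
    ∑-cong []       h = refl
    ∑-cong (x ∷ xs) h = cong₂ _+_ (h (here refl)) (∑-cong xs (h ∘ there))

    ∑-mono : ∀ (xs : List A) {f g} → (∀ {x} → x ∈ xs → f x ≤ g x) → ∑ xs f ≤ ∑ xs g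
    ∑-mono []       h = ≤-refl
    ∑-mono (x ∷ xs) h = +-mono-≤ (h (here refl)) (∑-mono xs (h ∘ there))

    ∑-mono-gap : ∀ (xs : List A) {f g c z} → (∀ {x} → x ∈ xs → f x ≤ g x) →
                 z ∈ xs → (f z + c) ≤ g z → (∑ xs f + c) ≤ ∑ xs g
    ∑-mono-gap (x ∷ xs) {f} {g} {c} h (here refl) fz+c≤gz =
      ≤-trans (≤-reflexive (trans (+-assoc (f x) (∑ xs f) c)
                           (trans (cong (f x +_) (+-comm (∑ xs f) c)) (sym (+-assoc (f x) c (∑ xs f))))))
              (+-mono-≤ fz+c≤gz (∑-mono xs (h ∘ there)))
    ∑-mono-gap (x ∷ xs) {f} {g} {c} h (there z∈) fz+c≤gz =
      ≤-trans (≤-reflexive (+-assoc (f x) (∑ xs f) c))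
              (+-mono-≤ (h (here refl)) (∑-mono-gap xs (h ∘ there) z∈ fz+c≤gz))

    ∑-zero : ∀ (xs : List A) → ∑ xs (λ _ → 0#) ≡ 0#
    ∑-zero []       = refl
    ∑-zero (x ∷ xs) = trans (+-identityˡ _) (∑-zero xs)

    ∑-+ : ∀ (xs : List A) f g → ∑ xs (λ x → f x + g x) ≡ ∑ xs f + ∑ xs g
    ∑-+ []       f g = sym (+-identityˡ 0#)
    ∑-+ (x ∷ xs) f g = trans (cong ((f x + g x) +_) (∑-+ xs f g)) (interchange (f x) (g x) _ _)

    ∑-*ˡ : ∀ (xs : List A) c f → ∑ xs (λ x → c * f x) ≡ c * ∑ xs f
    ∑-*ˡ []       c f = sym (zeroʳ c)
    ∑-*ˡ (x ∷ xs) c f = trans (cong ((c * f x) +_) (∑-*ˡ xs c f)) (sym (distribˡ c (f x) _))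

    ∑-*ʳ : ∀ (xs : List A) c f → ∑ xs (λ x → f x * c) ≡ ∑ xs f * c
    ∑-*ʳ xs c f = trans (∑-cong xs (λ {x} _ → *-comm (f x) c)) (trans (∑-*ˡ xs c f) (*-comm c _))

    ∑-swap : ∀ (xs : List A) (ys : List B) (f : A → B → K) → ∑ xs (λ x → ∑ ys (f x)) ≡ ∑ ys (λ y → ∑ xs (λ x → f x y))
    ∑-swap []       ys f = sym (∑-zero ys)
    ∑-swap (x ∷ xs) ys f = trans (cong (∑ ys (f x) +_) (∑-swap xs ys f)) (sym (∑-+ ys (f x) _))

    ∑-map : ∀ (xs : List A) (h : A → B) f → ∑ (map h xs) f ≡ ∑ xs (f ∘ h)
    ∑-map []       h f = refl
    ∑-map (x ∷ xs) h f = cong (f (h x) +_) (∑-map xs h f)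

    ∑-++ : ∀ (xs ys : List A) f → ∑ (xs ++ ys) f ≡ ∑ xs f + ∑ ys f
    ∑-++ []       ys f = sym (+-identityˡ _)
    ∑-++ (x ∷ xs) ys f = trans (cong (f x +_) (∑-++ xs ys f)) (sym (+-assoc (f x) _ _))

    ∑-nonneg : ∀ (xs : List A) {f} → (∀ {x} → x ∈ xs → 0# ≤ f x) → 0# ≤ ∑ xs f
    ∑-nonneg xs h = ≤-trans (≤-reflexive (sym (∑-zero xs))) (∑-mono xs h)

    -- Each entry of `xs` is cut out of `ys` once; distinctness keeps the remaining entries inside
    -- what is left, and nonnegativity disposes of the surplus.
    ∑-unique-⊆ : ∀ {xs ys : List A} {f} → (∀ {x} → x ∈ ys → 0# ≤ f x) → Unique xs → xs ⊆ ys → ∑ xs f ≤ ∑ ys f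
    ∑-unique-⊆ {xs = []} {ys} f≥0 _ _ = ∑-nonneg ys f≥0
    ∑-unique-⊆ {xs = x ∷ xs} {f = f} f≥0 (x∉xs ∷ u) sub with ∈-∃++ (sub (here refl))
    ... | as , bs , refl = ≤-trans
      (+-mono-≤ (≤-refl {f x}) (∑-unique-⊆ {ys = as ++ bs} (f≥0 ∘ widen) u narrow))
      (≤-reflexive (begin
        f x + ∑ (as ++ bs) f        ≡⟨ cong (f x +_) (∑-++ as bs f) ⟩
        f x + (∑ as f + ∑ bs f)     ≡⟨ sym (+-assoc (f x) _ _) ⟩
        (f x + ∑ as f) + ∑ bs f     ≡⟨ cong (_+ ∑ bs f) (+-comm (f x) _) ⟩
        (∑ as f + f x) + ∑ bs f     ≡⟨ +-assoc _ (f x) _ ⟩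
        ∑ as f + (f x + ∑ bs f)     ≡⟨ sym (∑-++ as (x ∷ bs) f) ⟩
        ∑ (as ++ x ∷ bs) f          ∎))
      where
      open ≡-Reasoning
      widen : ∀ {y} → y ∈ as ++ bs → y ∈ as ++ x ∷ bs
      widen y∈ with ∈-++⁻ as y∈
      ... | inj₁ y∈as = ∈-++⁺ˡ y∈as
      ... | inj₂ y∈bs = ∈-++⁺ʳ as (there y∈bs)
      narrow : xs ⊆ as ++ bs
      narrow {y} y∈xs with ∈-++⁻ as (sub (there y∈xs))
      ... | inj₁ y∈as           = ∈-++⁺ˡ y∈as
      ... | inj₂ (there y∈bs)   = ∈-++⁺ʳ as y∈bs
      ... | inj₂ (here refl)    = contradiction refl (All.lookup x∉xs y∈xs)

-- Counting incidences between points and subsets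

module Subsets where

  open Sums
  open import Data.Bool.Base using (Bool; true; false; if_then_else_; _∧_)
  open import Data.Fin.Base using (Fin; suc)
  open import Data.Fin.Subset renaming (∣_∣ to size)
  open import Data.Fin.Subset.Properties
  open import Data.List.Base using (List; []; _∷_; length; filter; allFin; tabulate)
  open import Data.List.Properties using (map-tabulate)
  import Data.List.Membership.Propositional as List
  import Data.List.Relation.Binary.Subset.Propositional as List
  open import Data.List.Relation.Unary.Any using (here; there; any?)
  open import Data.List.Relation.Unary.All as All using ([]; _∷_)
  open import Data.List.Relation.Unary.AllPairs using ([]; _∷_)
  open import Data.List.Relation.Unary.Unique.Propositional using (Unique)
  open import Data.Nat.Base
  open import Data.Nat.Properties
  open import Data.Product.Base using (∃-syntax; _×_; _,_)
  open import Data.Vec.Base using (lookup; []; _∷_)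
  open import Data.Vec.Properties using (lookup-zipWith; []=⇒lookup; lookup⇒[]=)
  open import Function.Base using (_∘_; id)
  open import Relation.Nullary using (yes; no; contradiction; ¬?)
  open import Relation.Nullary.Decidable using (decidable-stable)
  open import Relation.Unary using (Decidable)
  open import Relation.Binary.PropositionalEquality

  module ∑ℕ = Sum _+_ _*_ 0 1 +-*-isCommutativeSemiring _≤_ ≤-isPreorder +-mono-≤
  open ∑ℕ public

  length≡∑ : ∀ {A : Set} (xs : List A) → length xs ≡ ∑ xs (λ _ → 1)
  length≡∑ []       = refl
  length≡∑ (x ∷ xs) = cong suc (length≡∑ xs)

  length-unique-⊆ : ∀ {A : Set} {xs ys : List A} → Unique xs → xs List.⊆ ys → length xs ≤ length ys
  length-unique-⊆ {xs = xs} {ys} u sub =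
    subst₂ _≤_ (sym (length≡∑ xs)) (sym (length≡∑ ys)) (∑-unique-⊆ (λ _ → z≤n) u sub)

  length-filter+ : ∀ {A : Set} {P : A → Set} (P? : Decidable P) xs →
                   length (filter P? xs) + length (filter (¬? ∘ P?) xs) ≡ length xs
  length-filter+ P? []       = refl
  length-filter+ P? (x ∷ xs) with P? x
  ... | yes _ = cong suc (length-filter+ P? xs)
  ... | no  _ = trans (+-suc _ _) (cong suc (length-filter+ P? xs))

  ∑-const : ∀ {A : Set} (xs : List A) c → ∑ xs (λ _ → c) ≡ length xs * c
  ∑-const []       c = refl
  ∑-const (x ∷ xs) c = cong (c +_) (∑-const xs c)

  -- The mean of `f` bounds its least value; clearing the division keeps the estimate in ℕ.
  -- Nonemptiness supplies the one strict term of the contradiction.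
  pigeonhole : ∀ {A : Set} (xs : List A) (f : A → ℕ) {c} → 0 < length xs → ∑ xs f ≤ c →
               ∃[ x ] x List.∈ xs × length xs * f x ≤ c
  pigeonhole xs f {c} 0<l h with any? (λ x → length xs * f x ≤? c) xs
  ... | yes p = List.find p
  ... | no ¬p = contradiction (*-monoʳ-≤ (length xs) h) (<⇒≱ (begin-strict
    length xs * c                    ≡⟨ sym (∑-const xs c) ⟩
    ∑ xs (λ _ → c)                   <⟨ n<1+n _ ⟩
    suc (∑ xs (λ _ → c))             ≤⟨ strictly xs {length xs} 0<l (λ {x} x∈ → ≰⇒> (λ q → ¬p (List.lose x∈ q))) ⟩
    ∑ xs (λ x → length xs * f x)     ≡⟨ ∑-*ˡ xs (length xs) f ⟩
    length xs * ∑ xs f               ∎))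
    where
    open ≤-Reasoning
    strictly : ∀ ys {l} → 0 < length ys → (∀ {x} → x List.∈ ys → c < l * f x) →
             suc (∑ ys (λ _ → c)) ≤ ∑ ys (λ x → l * f x)
    strictly (y ∷ ys) _ h = +-mono-≤ (h (here refl)) (∑-mono ys (λ x∈ → <⇒≤ (h (there x∈))))

  bit : Bool → ℕ
  bit b = if b then 1 else 0

  private variable
    n : ℕ

  χ : Subset n → Fin n → ℕ
  χ A x = bit (lookup A x)

  χ-∈ : ∀ {A : Subset n} {x} → x ∈ A → χ A x ≡ 1
  χ-∈ x∈A = cong bit ([]=⇒lookup x∈A)

  χ-∉ : ∀ {A : Subset n} {x} → x ∉ A → χ A x ≡ 0
  χ-∉ {A = A} {x} x∉A with lookup A x in eq
  ... | true  = contradiction (lookup⇒[]= x A eq) x∉A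
  ... | false = refl

  χ≤1 : ∀ (A : Subset n) x → χ A x ≤ 1
  χ≤1 A x with lookup A x
  ... | true  = ≤-refl
  ... | false = z≤n

  χ-∩ : ∀ (A B : Subset n) x → χ (A ∩ B) x ≡ χ A x * χ B x
  χ-∩ A B x rewrite lookup-zipWith _∧_ x A B with lookup A x | lookup B x
  ... | true  | true  = refl
  ... | true  | false = refl
  ... | false | _     = refl

  χ-∁ : ∀ (A : Subset n) x → χ A x + χ (∁ A) x ≡ 1
  χ-∁ A x with x ∈? A
  ... | yes x∈A = cong₂ _+_ (χ-∈ x∈A) (χ-∉ (x∈p⇒x∉∁p x∈A))
  ... | no  x∉A = cong₂ _+_ (χ-∉ x∉A) (χ-∈ (x∉p⇒x∈∁p x∉A))

  size≡∑ : ∀ (A : Subset n) → size A ≡ ∑ (allFin n) (χ A)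
  size≡∑ []      = refl
  size≡∑ {suc n} (b ∷ A) = trans (head b) (cong (bit b +_) (trans (size≡∑ A) (sym shift)))
    where
    head : ∀ b → size (b ∷ A) ≡ bit b + size A
    head true  = refl
    head false = refl
    shift : ∑ (tabulate suc) (χ (b ∷ A)) ≡ ∑ (allFin n) (χ A)
    shift = trans (cong (λ xs → ∑ xs (χ (b ∷ A))) (sym (map-tabulate id suc))) (∑-map (allFin n) suc _)

  size-split : ∀ (A M : Subset n) → size (A ∩ M) + size (A ∩ ∁ M) ≡ size A
  size-split {n} A M = begin
    size (A ∩ M) + size (A ∩ ∁ M)                                  ≡⟨ cong₂ _+_ (size≡∑ (A ∩ M)) (size≡∑ (A ∩ ∁ M)) ⟩
    ∑ (allFin n) (χ (A ∩ M)) + ∑ (allFin n) (χ (A ∩ ∁ M))          ≡⟨ sym (∑-+ (allFin n) _ _) ⟩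
    ∑ (allFin n) (λ x → χ (A ∩ M) x + χ (A ∩ ∁ M) x)               ≡⟨ ∑-cong (allFin n) (λ {x} _ → pointwise x) ⟩
    ∑ (allFin n) (χ A)                                             ≡⟨ sym (size≡∑ A) ⟩
    size A                                                         ∎
    where
    open ≡-Reasoning
    pointwise : ∀ x → χ (A ∩ M) x + χ (A ∩ ∁ M) x ≡ χ A x
    pointwise x = trans (cong₂ _+_ (χ-∩ A M x) (χ-∩ A (∁ M) x))
      (trans (sym (*-distribˡ-+ (χ A x) _ _)) (trans (cong (χ A x *_) (χ-∁ M x)) (*-identityʳ _)))

  ⊈-witness : ∀ {A B : Subset n} → B ⊈ A → ∃[ x ] x ∈ B × x ∉ A
  ⊈-witness {A = A} {B} B⊈A with nonempty? (B ∩ ∁ A)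
  ... | yes (x , x∈) = let x∈B , x∈∁A = x∈p∩q⁻ B (∁ A) x∈ in x , x∈B , x∈∁p⇒x∉p x∈∁A
  ... | no  empty    = contradiction
    (λ {x} x∈B → decidable-stable (x ∈? A) λ x∉A → empty (x , x∈p∩q⁺ (x∈B , x∉p⇒x∈∁p x∉A))) B⊈A

  ⊆-size-≡ : ∀ {A B : Subset n} → A ⊆ B → size B ≤ size A → A ≡ B
  ⊆-size-≡ {A = A} {B} A⊆B B≤A = ⊆-antisym A⊆B (decidable-stable (B ⊆? A) λ B⊈A →
    <⇒≱ (p⊂q⇒∣p∣<∣q∣ ((λ {x} → A⊆B {x}) , ⊈-witness B⊈A)) B≤A)

  0<size : ∀ {A : Subset n} → Nonempty A → 0 < size A
  0<size {A = A} (x , x∈A) = subst (_≤ size A) (∣⁅x⁆∣≡1 x)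
    (p⊆q⇒∣p∣≤∣q∣ (λ {y} y∈ → subst (_∈ A) (sym (x∈⁅y⁆⇒x≡y x y∈)) x∈A))

  deg : List (Subset n) → Fin n → ℕ
  deg xs x = ∑ xs (λ A → χ A x)

  deg≤1 : ∀ {xs : List (Subset n)} {x} → Unique xs →
          (∀ {A B} → A List.∈ xs → B List.∈ xs → x ∈ A → x ∈ B → A ≡ B) → deg xs x ≤ 1
  deg≤1 {xs = []}             []       _   = z≤n
  deg≤1 {xs = A ∷ xs} {x} (A∉ ∷ u) inj with x ∈? A
  ... | no x∉A  = subst (λ c → c + deg xs x ≤ 1) (sym (χ-∉ x∉A))
                    (deg≤1 u (λ A∈ B∈ → inj (there A∈) (there B∈)))
  ... | yes x∈A = subst (_≤ 1) (sym (cong₂ _+_ (χ-∈ x∈A) (trans (∑-cong xs others) (∑-zero xs)))) ≤-refl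
    where
    others : ∀ {B} → B List.∈ xs → χ B x ≡ 0
    others B∈ = χ-∉ λ x∈B → All.lookup A∉ B∈ (inj (here refl) (there B∈) x∈A x∈B)

  ∑-size-∩ : ∀ (xs : List (Subset n)) D →
             ∑ xs (λ A → size (A ∩ D)) ≡ ∑ (allFin n) (λ x → χ D x * deg xs x)
  ∑-size-∩ {n} xs D = begin
    ∑ xs (λ A → size (A ∩ D))                           ≡⟨ ∑-cong xs (λ {A} _ → size≡∑ (A ∩ D)) ⟩
    ∑ xs (λ A → ∑ (allFin n) (χ (A ∩ D)))               ≡⟨ ∑-swap xs (allFin n) _ ⟩
    ∑ (allFin n) (λ x → ∑ xs (λ A → χ (A ∩ D) x))       ≡⟨ ∑-cong (allFin n) (λ {x} _ → pointwise x) ⟩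
    ∑ (allFin n) (λ x → χ D x * deg xs x)               ∎
    where
    open ≡-Reasoning
    pointwise : ∀ x → ∑ xs (λ A → χ (A ∩ D) x) ≡ χ D x * deg xs x
    pointwise x = trans (∑-cong xs (λ {A} _ → trans (χ-∩ A D x) (*-comm (χ A x) _))) (∑-*ˡ xs (χ D x) _)

  -- Each point of `D` lies in at most one member, so at most |D| members can meet `D`. Applied with
  -- `D` outside the core of a sunflower, this finds a petal that misses a given set.
  avoiding-member : ∀ {xs : List (Subset n)} (D : Subset n) → Unique xs →
                    (∀ {A B x} → A List.∈ xs → B List.∈ xs → x ∈ D → x ∈ A → x ∈ B → A ≡ B) →
                    size D < length xs → ∃[ A ] A List.∈ xs × Empty (A ∩ D)
  avoiding-member {n} {xs} D u inj size<length with any? (λ A → ¬? (nonempty? (A ∩ D))) xs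
  ... | yes p = List.find p
  ... | no ¬p = contradiction size<length (≤⇒≯ (begin
    length xs                                ≡⟨ length≡∑ xs ⟩
    ∑ xs (λ _ → 1)                           ≤⟨ ∑-mono xs (λ A∈ → 0<size (meets A∈)) ⟩
    ∑ xs (λ A → size (A ∩ D))                ≡⟨ ∑-size-∩ xs D ⟩
    ∑ (allFin n) (λ x → χ D x * deg xs x)    ≤⟨ ∑-mono (allFin n) (λ {x} _ → pointwise x) ⟩
    ∑ (allFin n) (χ D)                       ≡⟨ sym (size≡∑ D) ⟩
    size D                                   ∎))
    where
    open ≤-Reasoning
    meets : ∀ {A} → A List.∈ xs → Nonempty (A ∩ D)
    meets {A} A∈ = decidable-stable (nonempty? (A ∩ D)) (λ e → ¬p (List.lose A∈ e))
    pointwise : ∀ x → χ D x * deg xs x ≤ χ D x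
    pointwise x with x ∈? D
    ... | no x∉D  = ≤-reflexive (trans (cong (_* deg xs x) (χ-∉ x∉D)) (sym (χ-∉ x∉D)))
    ... | yes x∈D = ≤-trans (*-monoʳ-≤ (χ D x) (deg≤1 u (λ A∈ B∈ → inj A∈ B∈ x∈D))) (≤-reflexive (*-identityʳ _))

-- A weak form of Deza's theorem by second moments

module Deza where

  open import Defs using (_≟ˢ_)
  open Subsets
  open import Data.Fin.Base using (Fin)
  open import Data.Fin.Subset renaming (∣_∣ to size)
  open import Data.Fin.Subset.Properties
  open import Data.List.Base using (List; []; _∷_; length; filter; allFin)
  import Data.List.Membership.Propositional as List
  open import Data.List.Membership.Propositional.Properties using (∈-filter⁻; ∈-allFin)
  open import Data.List.Relation.Unary.Any using (here; there)
  open import Data.List.Relation.Unary.All as All using ([]; _∷_)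
  open import Data.List.Relation.Unary.AllPairs using ([]; _∷_)
  open import Data.List.Relation.Unary.Unique.Propositional using (Unique)
  open import Data.List.Relation.Unary.Unique.Propositional.Properties using () renaming (filter⁺ to unique-filter)
  open import Data.Nat.Base
  open import Data.Nat.Properties
  open import Data.Nat.Tactic.RingSolver using (solve-∀)
  open import Data.Product.Base using (∃-syntax; _×_; _,_; proj₁; proj₂)
  open import Data.Sum.Base using ([_,_]′)
  open import Function.Base using (_∘_)
  open import Relation.Nullary using (yes; no; contradiction; does; ¬?)
  open import Relation.Nullary.Decidable using (dec-true; dec-false; decidable-stable)
  open import Relation.Binary.PropositionalEquality

  2xy≤x²+y² : ∀ x y → 2 * (x * y) ≤ x * x + y * y
  2xy≤x²+y² x y =
    [ ordered , (λ y≤x → subst₂ _≤_ (cong (2 *_) (*-comm y x)) (+-comm (y * y) (x * x)) (ordered y≤x)) ]′ (≤-total x y)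
    where
    ordered : ∀ {x y} → x ≤ y → 2 * (x * y) ≤ x * x + y * y
    ordered {x} x≤y with m≤n⇒∃[o]m+o≡n x≤y
    ... | d , refl = subst (2 * (x * (x + d)) ≤_) (identity x d) (m≤m+n _ (d * d))
      where
      identity : ∀ x d → 2 * (x * (x + d)) + d * d ≡ x * x + (x + d) * (x + d)
      identity = solve-∀

  private
    δ : ∀ {n} → Subset n → Subset n → ℕ
    δ A B = bit (does (A ≟ˢ B))

    δ-≡ : ∀ {n} {A B : Subset n} → A ≡ B → δ A B ≡ 1
    δ-≡ {A = A} {B} A≡B = cong bit (dec-true (A ≟ˢ B) A≡B)

    δ-≢ : ∀ {n} {A B : Subset n} → A ≢ B → δ A B ≡ 0
    δ-≢ {A = A} {B} A≢B = cong bit (dec-false (A ≟ˢ B) A≢B)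

    ∑-δ : ∀ {n} {A : Subset n} {ys} (f : Subset n → ℕ) → Unique ys → A List.∈ ys →
          ∑ ys (λ B → f B * δ A B) ≡ f A
    ∑-δ {A = A} {ys = B ∷ ys} f (B∉ys ∷ u) (here refl) = begin
      f A * δ A A + ∑ ys (λ B → f B * δ A B)    ≡⟨ cong₂ _+_ (cong (f A *_) (δ-≡ {A = A} refl)) (∑-cong ys off-diagonal) ⟩
      f A * 1 + ∑ ys (λ _ → 0)                  ≡⟨ cong₂ _+_ (*-identityʳ (f A)) (∑-zero ys) ⟩
      f A + 0                                   ≡⟨ +-identityʳ (f A) ⟩
      f A                                       ∎
      where
      open ≡-Reasoning
      off-diagonal : ∀ {B} → B List.∈ ys → f B * δ A B ≡ 0
      off-diagonal {B} B∈ = trans (cong (f B *_) (δ-≢ (All.lookup B∉ys B∈))) (*-zeroʳ (f B))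
    ∑-δ {A = A} {ys = B ∷ ys} f (B∉ys ∷ u) (there A∈) =
      cong₂ _+_ (trans (cong (f B *_) (δ-≢ λ A≡B → All.lookup B∉ys A∈ (sym A≡B))) (*-zeroʳ (f B))) (∑-δ f u A∈)

  -- Both sides are the inner product of the vectors Σ f(A) A and Σ g(B) B, evaluated point by point
  -- and through the Gram entries |A ∩ B|.
  moment : ∀ {n} (xs : List (Subset n)) (f g : Subset n → ℕ) →
           ∑ (allFin n) (λ x → ∑ xs (λ A → f A * χ A x) * ∑ xs (λ B → g B * χ B x)) ≡
           ∑ xs (λ A → ∑ xs (λ B → f A * g B * size (A ∩ B)))
  moment {n} xs f g = begin
    ∑ pts (λ x → ∑ xs (λ A → f A * χ A x) * ∑ xs (λ B → g B * χ B x))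
      ≡⟨ ∑-cong pts (λ {x} _ → sym (∑-*ʳ xs _ _)) ⟩
    ∑ pts (λ x → ∑ xs (λ A → f A * χ A x * ∑ xs (λ B → g B * χ B x)))
      ≡⟨ ∑-swap pts xs _ ⟩
    ∑ xs (λ A → ∑ pts (λ x → f A * χ A x * ∑ xs (λ B → g B * χ B x)))
      ≡⟨ ∑-cong xs (λ {A} _ → trans (∑-cong pts (λ {x} _ → sym (∑-*ˡ xs (f A * χ A x) _))) (∑-swap pts xs _)) ⟩
    ∑ xs (λ A → ∑ xs (λ B → ∑ pts (λ x → f A * χ A x * (g B * χ B x))))
      ≡⟨ ∑-cong xs (λ {A} _ → ∑-cong xs (λ {B} _ → entry A B)) ⟩
    ∑ xs (λ A → ∑ xs (λ B → f A * g B * size (A ∩ B)))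
      ∎
    where
    open ≡-Reasoning
    pts = allFin n
    regroup : ∀ a b c d → a * b * (c * d) ≡ a * c * (b * d)
    regroup = solve-∀
    entry : ∀ A B → ∑ pts (λ x → f A * χ A x * (g B * χ B x)) ≡ f A * g B * size (A ∩ B)
    entry A B = begin
      ∑ pts (λ x → f A * χ A x * (g B * χ B x))
        ≡⟨ ∑-cong pts (λ {x} _ → trans (regroup (f A) (χ A x) (g B) (χ B x))
                                       (cong (f A * g B *_) (sym (χ-∩ A B x)))) ⟩
      ∑ pts (λ x → f A * g B * χ (A ∩ B) x)   ≡⟨ ∑-*ˡ pts (f A * g B) _ ⟩
      f A * g B * ∑ pts (χ (A ∩ B))           ≡⟨ cong (f A * g B *_) (sym (size≡∑ (A ∩ B))) ⟩
      f A * g B * size (A ∩ B)                ∎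

  module _ {n k l : ℕ} {xs : List (Subset n)} (u : Unique xs)
    (uniform : ∀ {A} → A List.∈ xs → size A ≡ k)
    (meet : ∀ {A B} → A List.∈ xs → B List.∈ xs → A ≢ B → size (A ∩ B) ≡ l)
    where

    private
      -- The Gram matrix is (k - l) I + l J; moving l I to the left avoids the subtraction in ℕ.
      gram-entry : ∀ {A B} → A List.∈ xs → B List.∈ xs → size (A ∩ B) + l * δ A B ≡ k * δ A B + l
      gram-entry {A} {B} A∈ B∈ with A ≟ˢ B
      ... | yes refl = trans (cong₂ _+_ (trans (cong size (∩-idem A)) (uniform A∈)) (*-identityʳ l))
                             (cong (_+ l) (sym (*-identityʳ k)))
      ... | no A≢B   = trans (cong₂ _+_ (meet A∈ B∈ A≢B) (*-zeroʳ l))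
                       (trans (+-identityʳ l) (cong (_+ l) (sym (*-zeroʳ k))))

      gram-row : ∀ (f g : Subset n → ℕ) {A} → A List.∈ xs →
                 ∑ xs (λ B → f A * g B * size (A ∩ B)) + l * (f A * g A) ≡
                 k * (f A * g A) + l * (f A * ∑ xs g)
      gram-row f g {A} A∈ = begin
        ∑ xs (λ B → f A * g B * size (A ∩ B)) + l * (f A * g A)
          ≡⟨ cong (λ t → ∑ xs (λ B → f A * g B * size (A ∩ B)) + l * t) (sym diagonal) ⟩
        ∑ xs (λ B → f A * g B * size (A ∩ B)) + l * ∑ xs (λ B → f A * g B * δ A B)
          ≡⟨ cong (∑ xs (λ B → f A * g B * size (A ∩ B)) +_) (sym (∑-*ˡ xs l _)) ⟩
        ∑ xs (λ B → f A * g B * size (A ∩ B)) + ∑ xs (λ B → l * (f A * g B * δ A B))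
          ≡⟨ sym (∑-+ xs _ _) ⟩
        ∑ xs (λ B → f A * g B * size (A ∩ B) + l * (f A * g B * δ A B))
          ≡⟨ ∑-cong xs (λ {B} B∈ → entry B∈) ⟩
        ∑ xs (λ B → k * (f A * g B * δ A B) + l * (f A * g B))
          ≡⟨ ∑-+ xs _ _ ⟩
        ∑ xs (λ B → k * (f A * g B * δ A B)) + ∑ xs (λ B → l * (f A * g B))
          ≡⟨ cong₂ _+_ (trans (∑-*ˡ xs k _) (cong (k *_) diagonal))
                       (trans (∑-*ˡ xs l _) (cong (l *_) (∑-*ˡ xs (f A) g))) ⟩
        k * (f A * g A) + l * (f A * ∑ xs g)
          ∎
        where
        open ≡-Reasoning
        diagonal : ∑ xs (λ B → f A * g B * δ A B) ≡ f A * g A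
        diagonal = ∑-δ (λ B → f A * g B) u A∈
        factor : ∀ p s l d → p * s + l * (p * d) ≡ p * (s + l * d)
        factor = solve-∀
        expand : ∀ p k d l → p * (k * d + l) ≡ k * (p * d) + l * p
        expand = solve-∀
        entry : ∀ {B} → B List.∈ xs → f A * g B * size (A ∩ B) + l * (f A * g B * δ A B) ≡
                                      k * (f A * g B * δ A B) + l * (f A * g B)
        entry {B} B∈ = trans (factor (f A * g B) (size (A ∩ B)) l (δ A B))
          (trans (cong (f A * g B *_) (gram-entry A∈ B∈)) (expand (f A * g B) k (δ A B) l))

    -- The bilinear form of (k - l) I + l J at two weight vectors: the matrix J contributes the
    -- product of their total weights.
    gram : ∀ (f g : Subset n → ℕ) →
           ∑ xs (λ A → ∑ xs (λ B → f A * g B * size (A ∩ B))) + l * ∑ xs (λ A → f A * g A) ≡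
           k * ∑ xs (λ A → f A * g A) + l * (∑ xs f * ∑ xs g)
    gram f g = begin
      ∑ xs (λ A → ∑ xs (λ B → f A * g B * size (A ∩ B))) + l * ∑ xs (λ A → f A * g A)
        ≡⟨ cong (∑ xs (λ A → ∑ xs (λ B → f A * g B * size (A ∩ B))) +_) (sym (∑-*ˡ xs l _)) ⟩
      ∑ xs (λ A → ∑ xs (λ B → f A * g B * size (A ∩ B))) + ∑ xs (λ A → l * (f A * g A))
        ≡⟨ sym (∑-+ xs _ _) ⟩
      ∑ xs (λ A → ∑ xs (λ B → f A * g B * size (A ∩ B)) + l * (f A * g A))
        ≡⟨ ∑-cong xs (gram-row f g) ⟩
      ∑ xs (λ A → k * (f A * g A) + l * (f A * ∑ xs g))
        ≡⟨ ∑-+ xs _ _ ⟩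
      ∑ xs (λ A → k * (f A * g A)) + ∑ xs (λ A → l * (f A * ∑ xs g))
        ≡⟨ cong₂ _+_ (∑-*ˡ xs k _) (trans (∑-*ˡ xs l _) (cong (l *_) (∑-*ʳ xs (∑ xs g) f))) ⟩
      k * ∑ xs (λ A → f A * g A) + l * (∑ xs f * ∑ xs g)
        ∎
      where open ≡-Reasoning

    codeg : Fin n → ℕ
    codeg x = ∑ xs (λ A → χ (∁ A) x)

    deg+codeg : ∀ x → deg xs x + codeg x ≡ length xs
    deg+codeg x = trans (sym (∑-+ xs _ _)) (trans (∑-cong xs (λ {A} _ → χ-∁ A x)) (sym (length≡∑ xs)))

    private
      χ-idem : ∀ (A : Subset n) x → χ A x * χ A x ≡ χ A x
      χ-idem A x = trans (sym (χ-∩ A A x)) (cong (λ B → χ B x) (∩-idem A))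

      χ-disjoint : ∀ (A : Subset n) x → χ A x * χ (∁ A) x ≡ 0
      χ-disjoint A x with x ∈? A
      ... | yes x∈A = trans (cong (χ A x *_) (χ-∉ (x∈p⇒x∉∁p x∈A))) (*-zeroʳ (χ A x))
      ... | no  x∉A = cong (_* χ (∁ A) x) (χ-∉ x∉A)

    -- With d and e the numbers of members containing and missing x, the vector
    -- e · Σ_{A ∋ x} A − d · Σ_{B ∌ x} B has entry d e at x and squared norm (k − l) d e (d + e).
    deg*codeg≤ : ∀ x → deg xs x * codeg x ≤ k * length xs
    deg*codeg≤ x = subst (λ m → d * e ≤ k * m) (deg+codeg x) (cancel d e key)
      where
      pts = allFin n
      d = deg xs x
      e = codeg x
      f g : Fin n → ℕ
      f y = ∑ xs (λ A → χ A x * χ A y)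
      g y = ∑ xs (λ B → χ (∁ B) x * χ B y)
      fx≡d : f x ≡ d
      fx≡d = ∑-cong xs (λ {A} _ → χ-idem A x)
      gx≡0 : g x ≡ 0
      gx≡0 = trans (∑-cong xs (λ {B} _ → trans (*-comm (χ (∁ B) x) _) (χ-disjoint B x))) (∑-zero xs)
      ff gg fg : ℕ
      ff = ∑ pts (λ y → f y * f y)
      gg = ∑ pts (λ y → g y * g y)
      fg = ∑ pts (λ y → f y * g y)
      ff-eq : ff + l * d ≡ k * d + l * (d * d)
      ff-eq = subst₂ (λ s t → s + l * t ≡ k * t + l * (d * d)) (sym (moment xs (λ A → χ A x) (λ A → χ A x))) fx≡d (gram (λ A → χ A x) (λ A → χ A x))
      gg-eq : gg + l * e ≡ k * e + l * (e * e)
      gg-eq = subst₂ (λ s t → s + l * t ≡ k * t + l * (e * e)) (sym (moment xs (λ A → χ (∁ A) x) (λ A → χ (∁ A) x)))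
        (∑-cong xs (λ {A} _ → χ-idem (∁ A) x)) (gram (λ A → χ (∁ A) x) (λ A → χ (∁ A) x))
      fg-eq : fg ≡ l * (d * e)
      fg-eq = trans (sym (trans (cong (fg +_) (*-zeroʳ l)) (+-identityʳ fg)))
        (trans (subst₂ (λ s t → s + l * t ≡ k * t + l * (d * e)) (sym (moment xs (λ A → χ A x) (λ A → χ (∁ A) x)))
          (trans (∑-cong xs (λ {A} _ → χ-disjoint A x)) (∑-zero xs)) (gram (λ A → χ A x) (λ A → χ (∁ A) x)))
        (cong (_+ l * (d * e)) (*-zeroʳ k)))
      F G : Fin n → ℕ
      F y = 2 * (e * f y * (d * g y))
      G y = e * f y * (e * f y) + d * g y * (d * g y)
      at-x : F x + e * d * (e * d) ≤ G x
      at-x rewrite gx≡0 | fx≡d = ≤-reflexive (identity e d)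
        where
        identity : ∀ e d → 2 * (e * d * (d * 0)) + e * d * (e * d) ≡ e * d * (e * d) + d * 0 * (d * 0)
        identity = solve-∀
      ∑F : ∑ pts F ≡ 2 * (e * d) * fg
      ∑F = trans (∑-cong pts (λ {y} _ → pull e d (f y) (g y))) (∑-*ˡ pts (2 * (e * d)) _)
        where
        pull : ∀ e d f g → 2 * (e * f * (d * g)) ≡ 2 * (e * d) * (f * g)
        pull = solve-∀
      ∑G : ∑ pts G ≡ e * e * ff + d * d * gg
      ∑G = trans (∑-+ pts _ _) (cong₂ _+_ (trans (∑-cong pts (λ {y} _ → pull e (f y))) (∑-*ˡ pts (e * e) _))
                                          (trans (∑-cong pts (λ {y} _ → pull d (g y))) (∑-*ˡ pts (d * d) _)))
        where
        pull : ∀ e f → e * f * (e * f) ≡ e * e * (f * f)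
        pull = solve-∀
      -- At every point 2 x y ≤ x² + y² says that the squared entry of the difference vector is
      -- nonnegative. At x itself `g` vanishes, so the slack there is all of (e d)².
      squares : 2 * (e * d) * fg + e * d * (e * d) ≤ e * e * ff + d * d * gg
      squares = subst₂ (λ s t → s + e * d * (e * d) ≤ t) ∑F ∑G
        (∑-mono-gap pts (λ {y} _ → 2xy≤x²+y² (e * f y) (d * g y)) (∈-allFin x) at-x)
      key : d * e * (d * e) ≤ d * e * (k * (d + e))
      key = +-cancelˡ-≤ (2 * (e * d) * (l * (d * e))) _ _ (begin
        2 * (e * d) * (l * (d * e)) + d * e * (d * e)     ≡⟨ cong₂ _+_ (cong (2 * (e * d) *_) (sym fg-eq)) (cong₂ _*_ (*-comm d e) (*-comm d e)) ⟩
        2 * (e * d) * fg + e * d * (e * d)                ≤⟨ squares ⟩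
        e * e * ff + d * d * gg                           ≤⟨ m≤m+n _ _ ⟩
        -- Adding the diagonal terms l d and l e to both norms brings them into the shape that
        -- `gram` evaluates, so k - l is never formed.
        e * e * ff + d * d * gg + (e * e * (l * d) + d * d * (l * e))
          ≡⟨ collect e d ff gg (l * d) (l * e) ⟩
        e * e * (ff + l * d) + d * d * (gg + l * e)       ≡⟨ cong₂ (λ s t → e * e * s + d * d * t) ff-eq gg-eq ⟩
        e * e * (k * d + l * (d * d)) + d * d * (k * e + l * (e * e))
          ≡⟨ expand e d k l ⟩
        2 * (e * d) * (l * (d * e)) + d * e * (k * (d + e)) ∎)
        where
        open ≤-Reasoning
        collect : ∀ e d s t a b → e * e * s + d * d * t + (e * e * a + d * d * b) ≡ e * e * (s + a) + d * d * (t + b)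
        collect = solve-∀
        expand : ∀ e d k l → e * e * (k * d + l * (d * d)) + d * d * (k * e + l * (e * e)) ≡
                             2 * (e * d) * (l * (d * e)) + d * e * (k * (d + e))
        expand = solve-∀
      cancel : ∀ d e → d * e * (d * e) ≤ d * e * (k * (d + e)) → d * e ≤ k * (d + e)
      cancel d e h with d * e
      ... | zero  = z≤n
      ... | suc m = *-cancelˡ-≤ (suc m) h

  -- Counts triples of a point x of `A`, a member B through x and a member D missing x. Grouping by
  -- x exposes the product that `deg*codeg≤` bounds.
  ∑-size-∩-∁ : ∀ {n} (xs : List (Subset n)) A →
               ∑ xs (λ B → ∑ xs (λ D → size (A ∩ B ∩ ∁ D))) ≡
               ∑ (allFin n) (λ x → χ A x * (deg xs x * ∑ xs (λ D → χ (∁ D) x)))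
  ∑-size-∩-∁ {n} xs A = begin
    ∑ xs (λ B → ∑ xs (λ D → size (A ∩ B ∩ ∁ D)))
      ≡⟨ ∑-cong xs (λ {B} _ → trans (∑-cong xs (λ {D} _ → trans (size≡∑ (A ∩ B ∩ ∁ D))
           (∑-cong pts (λ {x} _ → trans (χ-∩ A (B ∩ ∁ D) x) (trans (cong (χ A x *_) (χ-∩ B (∁ D) x)) (sym (*-assoc (χ A x) _ _))))))) (∑-swap xs pts _)) ⟩
    ∑ xs (λ B → ∑ pts (λ x → ∑ xs (λ D → χ A x * χ B x * χ (∁ D) x)))
      ≡⟨ ∑-swap xs pts _ ⟩
    ∑ pts (λ x → ∑ xs (λ B → ∑ xs (λ D → χ A x * χ B x * χ (∁ D) x)))
      ≡⟨ ∑-cong pts (λ {x} _ → trans (∑-cong xs (λ {B} _ → ∑-*ˡ xs (χ A x * χ B x) _))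
           (trans (∑-*ʳ xs _ _) (trans (cong (_* _) (∑-*ˡ xs (χ A x) _)) (*-assoc (χ A x) _ _)))) ⟩
    ∑ pts (λ x → χ A x * (deg xs x * ∑ xs (λ D → χ (∁ D) x)))
      ∎
    where
    open ≡-Reasoning
    pts = allFin n

  -- For a fixed member A₀, the average over A₁ of the incidences between points of A₀ ∩ A₁ and
  -- members missing them is about k². A good A₁ thus gives S = A₀ ∩ A₁ inside all but at most k²
  -- members, hence inside more than k of them. These form a sunflower with core S, and its petals
  -- outnumber the points of any other member.
  deza : ∀ {n k l} {xs : List (Subset n)} → 0 < k → Unique xs →
         (∀ {A} → A List.∈ xs → size A ≡ k) →
         (∀ {A B} → A List.∈ xs → B List.∈ xs → A ≢ B → size (A ∩ B) ≡ l) →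
         2 * (k * k) < length xs →
         ∃[ S ] size S ≡ l × (∀ {A} → A List.∈ xs → S ⊆ A)
  deza {n} {k} {l} {A₀ ∷ ys} 0<k u@(A₀∉ys ∷ _) uniform meet (s≤s large) =
    extend (pigeonhole ys weight 0<|ys| ∑weight≤)
    where
    xs = A₀ ∷ ys
    pts = allFin n
    0<|ys| : 0 < length ys
    0<|ys| = <-≤-trans (*-mono-≤ {1} {2} (s≤s z≤n) (*-mono-≤ 0<k 0<k)) large
    weight : Subset n → ℕ
    weight B = ∑ xs (λ D → size (A₀ ∩ B ∩ ∁ D))
    ∑weight≤ : ∑ ys weight ≤ k * k * length xs
    ∑weight≤ = begin
      ∑ ys weight                                        ≤⟨ m≤n+m _ _ ⟩
      ∑ xs weight                                        ≡⟨ ∑-size-∩-∁ xs A₀ ⟩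
      ∑ pts (λ x → χ A₀ x * (deg xs x * codeg u uniform meet x))
        ≤⟨ ∑-mono pts (λ {x} _ → *-monoʳ-≤ (χ A₀ x) (deg*codeg≤ u uniform meet x)) ⟩
      ∑ pts (λ x → χ A₀ x * (k * length xs))             ≡⟨ ∑-*ʳ pts _ _ ⟩
      ∑ pts (χ A₀) * (k * length xs)                     ≡⟨ cong (_* (k * length xs)) (trans (sym (size≡∑ A₀)) (uniform (here refl))) ⟩
      k * (k * length xs)                                ≡⟨ sym (*-assoc k k _) ⟩
      k * k * length xs                                  ∎
      where open ≤-Reasoning
    extend : (∃[ A₁ ] A₁ List.∈ ys × length ys * weight A₁ ≤ k * k * length xs) →
             ∃[ S ] size S ≡ l × (∀ {A} → A List.∈ xs → S ⊆ A)
    extend (A₁ , A₁∈ys , averaged) = S , |S|≡l , S⊆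
      where
      S = A₀ ∩ A₁
      |S|≡l : size S ≡ l
      |S|≡l = meet (here refl) (there A₁∈ys) (All.lookup A₀∉ys A₁∈ys)
      -- A₀ is left out of the averaging so that A₁ differs from it, which costs a factor |xs| /
      -- |ys|. Since |ys| ≥ 2 k² > k², the resulting excess over k² is below 1 and integrality
      -- removes it.
      weight≤ : weight A₁ ≤ k * k
      weight≤ = ≮⇒≥ λ k²<w → <⇒≱ (begin-strict
        k * k * suc (length ys)          ≡⟨ *-suc (k * k) _ ⟩
        k * k + k * k * length ys        <⟨ +-monoˡ-< (k * k * length ys) (<-≤-trans k²<2k² large) ⟩
        length ys + k * k * length ys    ≡⟨ cong (length ys +_) (*-comm (k * k) _) ⟩
        length ys + length ys * (k * k)  ≡⟨ sym (*-suc (length ys) (k * k)) ⟩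
        length ys * suc (k * k)          ≤⟨ *-monoʳ-≤ (length ys) k²<w ⟩
        length ys * weight A₁            ∎) averaged
        where
        open ≤-Reasoning
        k²<2k² : k * k < 2 * (k * k)
        k²<2k² = subst (k * k <_) (cong (k * k +_) (sym (+-identityʳ (k * k))))
          (m<m+n (k * k) (*-mono-≤ 0<k 0<k))
      containing = filter (S ⊆?_) xs
      many : k < length containing
      many = +-cancelʳ-< (k * k) _ _ (begin-strict
        k + k * k                                                      ≤⟨ +-monoˡ-≤ (k * k) (m≤m*n k k {{>-nonZero 0<k}}) ⟩
        k * k + k * k                                                  ≡⟨ cong (k * k +_) (sym (+-identityʳ (k * k))) ⟩
        2 * (k * k)                                                    <⟨ s≤s large ⟩
        length xs                                                      ≡⟨ sym (length-filter+ (S ⊆?_) xs) ⟩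
        length containing + length (filter (¬? ∘ (S ⊆?_)) xs)          ≤⟨ +-monoʳ-≤ (length containing) (≤-trans few weight≤) ⟩
        length containing + k * k                                      ∎)
        where
        open ≤-Reasoning
        misses : ∀ {D} → S ⊈ D → 1 ≤ size (A₀ ∩ A₁ ∩ ∁ D)
        misses {D} S⊈D with nonempty? (A₀ ∩ A₁ ∩ ∁ D)
        ... | yes ne = 0<size ne
        ... | no  empty = contradiction (λ {x} x∈S → decidable-stable (x ∈? D) λ x∉D →
                empty (x , subst (x ∈_) (∩-assoc A₀ A₁ (∁ D)) (x∈p∩q⁺ (x∈S , x∉p⇒x∈∁p x∉D)))) S⊈D
        few : length (filter (¬? ∘ (S ⊆?_)) xs) ≤ weight A₁
        few = count xs
          where
          count : ∀ zs → length (filter (¬? ∘ (S ⊆?_)) zs) ≤ ∑ zs (λ D → size (A₀ ∩ A₁ ∩ ∁ D))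
          count []       = z≤n
          count (D ∷ zs) with S ⊆? D
          ... | yes _   = ≤-trans (count zs) (m≤n+m _ _)
          ... | no  S⊈D = +-mono-≤ (misses S⊈D) (count zs)
      in-containing : ∀ {A} → A List.∈ containing → A List.∈ xs × S ⊆ A
      in-containing = ∈-filter⁻ (S ⊆?_)
      S≡ : ∀ {A B} → A List.∈ xs → B List.∈ xs → A ≢ B → S ⊆ A ∩ B → S ≡ A ∩ B
      S≡ A∈ B∈ A≢B sub = ⊆-size-≡ sub (≤-reflexive (trans (meet A∈ B∈ A≢B) (sym |S|≡l)))
      S⊆ : ∀ {B} → B List.∈ xs → S ⊆ B
      S⊆ {B} B∈ with S ⊆? B
      ... | yes S⊆B = S⊆B
      -- The members in `containing` are disjoint outside S and number more than k = |B|, so one of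
      -- them meets B only inside S. That intersection has l = |S| points, hence is S, against S ⊈
      -- B.
      ... | no  S⊈B with avoiding-member {xs = containing} (B ∩ ∁ S) (unique-filter (S ⊆?_) u) exclusive
                           (≤-<-trans (≤-trans (∣p∩q∣≤∣p∣ B (∁ S)) (≤-reflexive (uniform B∈))) many)
        where
        exclusive : ∀ {A A' x} → A List.∈ containing → A' List.∈ containing → x ∈ B ∩ ∁ S → x ∈ A → x ∈ A' → A ≡ A'
        exclusive {A} {A'} {x} A∈ A'∈ x∈ x∈A x∈A' = decidable-stable (A ≟ˢ A') λ A≢A' →
          let A∈xs , S⊆A = in-containing A∈ ; A'∈xs , S⊆A' = in-containing A'∈ in
          x∈∁p⇒x∉p (proj₂ (x∈p∩q⁻ B (∁ S) x∈))
            (subst (x ∈_) (sym (S≡ A∈xs A'∈xs A≢A' (λ y∈ → x∈p∩q⁺ (S⊆A y∈ , S⊆A' y∈)))) (x∈p∩q⁺ (x∈A , x∈A')))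
      ... | A , A∈c , empty = λ x∈S → proj₂ (x∈p∩q⁻ A B (subst (_ ∈_) (sym A∩B≡S) x∈S))
        where
        A∈ = proj₁ (in-containing A∈c)
        A∩B⊆S : A ∩ B ⊆ S
        A∩B⊆S {x} x∈ = let x∈A , x∈B = x∈p∩q⁻ A B x∈ in
          decidable-stable (x ∈? S) λ x∉S → empty (x , x∈p∩q⁺ (x∈A , x∈p∩q⁺ (x∈B , x∉p⇒x∈∁p x∉S)))
        A≢B : A ≢ B
        A≢B A≡B = S⊈B (subst (S ⊆_) A≡B (proj₂ (in-containing A∈c)))
        A∩B≡S : A ∩ B ≡ S
        A∩B≡S = ⊆-size-≡ A∩B⊆S (≤-reflexive (trans |S|≡l (sym (meet A∈ B∈ A≢B))))

-- Extraction of the bouquet from the large layers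

module Bouquets where

  open import Defs
  open Subsets
  open Deza
  open import Data.Fin.Subset renaming (∣_∣ to size)
  open import Data.Fin.Subset.Properties
  open import Data.List.Base using (List; []; _∷_; length; filter; foldr)
  import Data.List.Membership.Propositional as List
  import Data.List.Relation.Binary.Subset.Propositional as List
  open import Data.List.Membership.Propositional.Properties using (∈-filter⁻; ∈-filter⁺)
  open import Data.List.Relation.Unary.Any using (here; there)
  open import Data.List.Relation.Unary.All as All using ([]; _∷_)
  open import Data.List.Relation.Unary.AllPairs using ([]; _∷_)
  open import Data.List.Relation.Unary.Unique.Propositional using (Unique)
  open import Data.List.Relation.Unary.Unique.Propositional.Properties using () renaming (filter⁺ to unique-filter)
  open import Data.Nat.Base using (ℕ; zero; suc; _+_; _*_; _≤_; _<_; _⊔_; z≤n; s≤s; NonZero; >-nonZero)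
  open import Data.Nat.Properties
  open import Data.Nat.Coprimality using (Coprime; coprime-divisor)
  open import Data.Nat.Divisibility using (_∣_; divides)
  open import Data.Product.Base using (∃-syntax; _×_; _,_; proj₁; proj₂)
  open import Data.Sum.Base using (_⊎_; inj₁; inj₂; [_,_]′)
  open import Function.Base using (_∘_; id)
  open import Relation.Nullary using (Dec; yes; no; contradiction; ¬?)
  open import Relation.Nullary.Decidable using (decidable-stable)
  open import Relation.Unary using (Decidable)
  open import Relation.Binary.PropositionalEquality

  module _ {A : Set} where

    two-distinct : ∀ {xs : List A} → Unique xs → 2 ≤ length xs →
                   ∃[ x ] ∃[ y ] x List.∈ xs × y List.∈ xs × x ≢ y
    two-distinct {x ∷ y ∷ xs} ((x≢y ∷ _) ∷ _) _ = x , y , here refl , there (here refl) , x≢y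
    two-distinct {_ ∷ []} _ (s≤s ())

    length≤1 : ∀ {xs : List A} → Unique xs → (∀ {x y} → x List.∈ xs → y List.∈ xs → x ≡ y) → length xs ≤ 1
    length≤1 {[]}         _ _ = z≤n
    length≤1 {x ∷ []}     _ _ = ≤-refl
    length≤1 {x ∷ y ∷ xs} ((x≢y ∷ _) ∷ _) eq = contradiction (eq (here refl) (there (here refl))) x≢y

    length-buckets : ∀ {T} (f : A → ℕ) W {xs} → Unique xs → (∀ {x} → x List.∈ xs → 0 < f x × f x ≤ W) →
                     (∀ k → length (filter (λ x → f x ≟ k) xs) ≤ T) → length xs ≤ W * T
    length-buckets f zero    {[]}     _ _ _ = z≤n
    length-buckets f zero    {x ∷ xs} _ range _ =
      let 0<fx , fx≤0 = range (here refl) in contradiction 0<fx (≤⇒≯ fx≤0)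
    length-buckets {T} f (suc W) {xs} u range bucket = begin
      length xs                              ≡⟨ sym (length-filter+ top? xs) ⟩
      length (filter top? xs) + length rest  ≤⟨ +-mono-≤ (bucket (suc W)) (length-buckets f W u-rest range-rest bucket-rest) ⟩
      T + W * T                              ∎
      where
      open ≤-Reasoning
      top? = λ x → f x ≟ suc W
      rest = filter (¬? ∘ top?) xs
      u-rest = unique-filter (¬? ∘ top?) u
      range-rest : ∀ {x} → x List.∈ rest → 0 < f x × f x ≤ W
      range-rest x∈ = let x∈xs , fx≢ = ∈-filter⁻ (¬? ∘ top?) {xs = xs} x∈ ; 0<fx , fx≤ = range x∈xs in
        0<fx , ≤-pred (≤∧≢⇒< fx≤ fx≢)
      bucket-rest : ∀ k → length (filter (λ x → f x ≟ k) rest) ≤ T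
      bucket-rest k = ≤-trans (length-unique-⊆ (unique-filter (λ x → f x ≟ k) u-rest) sub) (bucket k)
        where
        sub : filter (λ x → f x ≟ k) rest List.⊆ filter (λ x → f x ≟ k) xs
        sub x∈ = let x∈rest , fx≡k = ∈-filter⁻ (λ x → f x ≟ k) {xs = rest} x∈ in
          ∈-filter⁺ (λ x → f x ≟ k) (proj₁ (∈-filter⁻ (¬? ∘ top?) {xs = xs} x∈rest)) fx≡k

  module _ {n : ℕ} where

    maxSize : List (Subset n) → ℕ
    maxSize = foldr (λ A m → size A ⊔ m) 0

    size≤maxSize : ∀ {xs A} → A List.∈ xs → size A ≤ maxSize xs
    size≤maxSize {B ∷ xs} (here refl) = m≤m⊔n (size B) _
    size≤maxSize {B ∷ xs} (there A∈)  = ≤-trans (size≤maxSize A∈) (m≤n⊔m (size B) _)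

    maxSize-attained : ∀ xs → 0 < maxSize xs → ∃[ A ] A List.∈ xs × size A ≡ maxSize xs
    maxSize-attained (B ∷ xs) 0<max with ⊔-sel (size B) (maxSize xs)
    ... | inj₁ eq = B , here refl , sym eq
    ... | inj₂ eq = let A , A∈ , eq′ = maxSize-attained xs (subst (0 <_) eq 0<max) in A , there A∈ , trans eq′ (sym eq)

    ⋂-⊆ : ∀ {xs : List (Subset n)} {A} → A List.∈ xs → ⋂ xs ⊆ A
    ⋂-⊆ {B ∷ xs} (here refl) x∈ = proj₁ (x∈p∩q⁻ B (⋂ xs) x∈)
    ⋂-⊆ {B ∷ xs} (there A∈)  x∈ = ⋂-⊆ A∈ (proj₂ (x∈p∩q⁻ B (⋂ xs) x∈))

    ⋂-greatest : ∀ {xs : List (Subset n)} {S} → (∀ {A} → A List.∈ xs → S ⊆ A) → S ⊆ ⋂ xs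
    ⋂-greatest {[]}     _   _   = ∈⊤
    ⋂-greatest {B ∷ xs} S⊆ x∈S = x∈p∩q⁺ (S⊆ (here refl) x∈S , ⋂-greatest (λ A∈ → S⊆ (there A∈)) x∈S)

    ⋂-sunflower : ∀ {xs : List (Subset n)} {S} → Unique xs → 2 ≤ length xs → (∀ {A} → A List.∈ xs → S ⊆ A) →
                  (∀ {A B} → A List.∈ xs → B List.∈ xs → A ≢ B → A ∩ B ≡ S) → ⋂ xs ≡ S
    ⋂-sunflower u 2≤ S⊆ meet = let A , B , A∈ , B∈ , A≢B = two-distinct u 2≤ in
      ⊆-antisym (λ x∈ → subst (_ ∈_) (meet A∈ B∈ A≢B) (x∈p∩q⁺ (⋂-⊆ A∈ x∈ , ⋂-⊆ B∈ x∈))) (⋂-greatest S⊆)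

  -- The condition on intersections is cleared of denominators, b |A ∩ B| = a |A| or a |B|, so the
  -- whole extraction takes place in ℕ.
  module Extraction {n : ℕ} (a b : ℕ) (0<a : 0 < a) (a<b : a < b) (coprime : Coprime b a) (F : Family n)
    (nonempty : ∀ {A} → A ∈ᶠ F → Nonempty A)
    (fractional : ∀ {A B} → A ∈ᶠ F → B ∈ᶠ F → A ≢ B →
                  b * size (A ∩ B) ≡ a * size A ⊎ b * size (A ∩ B) ≡ a * size B)
    (W : ℕ) (bounded : ∀ {A} → A ∈ᶠ F → size A ≤ W)
    where

    private instance
      a≢0 : NonZero a
      a≢0 = >-nonZero 0<a
      b≢0 : NonZero b
      b≢0 = >-nonZero (<-trans 0<a a<b)

    -- One threshold with three uses: it is at least 2 k² for each size k ≤ W, as `deza` asks; at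
    -- least W, so that every set of size at most W misses a petal; and at least 2, so that a good
    -- layer keeps two members after losing one.
    T : ℕ
    T = 2 * (W * W)

    Good : ℕ → Set
    Good k = T < card (F ⟨ k ⟩)

    good? : ∀ k → Dec (Good k)
    good? k = T <? card (F ⟨ k ⟩)

    layer⁻ : ∀ {G : Family n} {k A} → A ∈ᶠ G ⟨ k ⟩ → A ∈ᶠ G × size A ≡ k
    layer⁻ {G} {k} = ∈-filter⁻ (λ A → size A ≟ k) {xs = members G}

    layer⁺ : ∀ {G : Family n} {k A} → A ∈ᶠ G → size A ≡ k → A ∈ᶠ G ⟨ k ⟩
    layer⁺ {G} {k} = ∈-filter⁺ (λ A → size A ≟ k) {xs = members G}

    module _ {k} (good : Good k) where

      good-inhabited : ∃[ A ] A ∈ᶠ F ⟨ k ⟩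
      good-inhabited = head (members (F ⟨ k ⟩)) good
        where
        head : ∀ xs → T < length xs → ∃[ A ] A List.∈ xs
        head (A ∷ _) _ = A , here refl

      0<k : 0 < k
      0<k = let A , A∈ = good-inhabited ; A∈F , |A|≡k = layer⁻ {F} A∈ in subst (0 <_) |A|≡k (0<size (nonempty A∈F))

      k≤W : k ≤ W
      k≤W = let A , A∈ = good-inhabited ; A∈F , |A|≡k = layer⁻ {F} A∈ in subst (_≤ W) |A|≡k (bounded A∈F)

      2≤T : 2 ≤ T
      2≤T = *-monoʳ-≤ 2 (*-mono-≤ 0<W 0<W)
        where
        0<W = ≤-trans 0<k k≤W

      3≤card : 3 ≤ card (F ⟨ k ⟩)
      3≤card = ≤-<-trans 2≤T good

      meet-in-layer : ∀ {A B} → A ∈ᶠ F ⟨ k ⟩ → B ∈ᶠ F ⟨ k ⟩ → A ≢ B → b * size (A ∩ B) ≡ a * k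
      meet-in-layer A∈ B∈ A≢B =
        let A∈F , |A|≡k = layer⁻ {F} A∈ ; B∈F , |B|≡k = layer⁻ {F} B∈ in
        [ (λ eq → trans eq (cong (a *_) |A|≡k)) , (λ eq → trans eq (cong (a *_) |B|≡k)) ]′ (fractional A∈F B∈F A≢B)

      -- Two distinct members meet in s points with b s = a k, and b is coprime to a.
      b∣k : b ∣ k
      b∣k = let A , B , A∈ , B∈ , A≢B = two-distinct (unique (F ⟨ k ⟩)) (<⇒≤ 3≤card) in
        coprime-divisor {b} {a} {k} coprime
          (divides (size (A ∩ B)) (trans (sym (meet-in-layer A∈ B∈ A≢B)) (*-comm b _)))

      index : ℕ
      index = _∣_.quotient b∣k

      k≡index*b : k ≡ index * b
      k≡index*b = _∣_.equality b∣k

      0<index : 0 < index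
      0<index = n≢0⇒n>0 λ index≡0 → <⇒≢ 0<k (sym (trans k≡index*b (cong (_* b) index≡0)))

      from-b* : ∀ {s} → b * s ≡ a * k → s ≡ index * a
      from-b* {s} eq = *-cancelˡ-≡ s (index * a) b (begin
        b * s             ≡⟨ eq ⟩
        a * k             ≡⟨ cong (a *_) (trans k≡index*b (*-comm index b)) ⟩
        a * (b * index)   ≡⟨ sym (*-assoc a b index) ⟩
        a * b * index     ≡⟨ cong (_* index) (*-comm a b) ⟩
        b * a * index     ≡⟨ *-assoc b a index ⟩
        b * (a * index)   ≡⟨ cong (b *_) (*-comm a index) ⟩
        b * (index * a)   ∎)
        where open ≡-Reasoning

      private
        meet-size : ∀ {A B} → A ∈ᶠ F ⟨ k ⟩ → B ∈ᶠ F ⟨ k ⟩ → A ≢ B → size (A ∩ B) ≡ index * a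
        meet-size A∈ B∈ A≢B = from-b* (meet-in-layer A∈ B∈ A≢B)

        kernel : ∃[ S ] size S ≡ index * a × (∀ {A} → A ∈ᶠ F ⟨ k ⟩ → S ⊆ A)
        kernel = deza 0<k (unique (F ⟨ k ⟩)) (λ A∈ → proj₂ (layer⁻ {F} A∈)) meet-size
          (≤-<-trans (*-monoʳ-≤ 2 (*-mono-≤ k≤W k≤W)) good)

        S : Subset n
        S = proj₁ kernel

        meet≡S : ∀ {A B} → A ∈ᶠ F ⟨ k ⟩ → B ∈ᶠ F ⟨ k ⟩ → A ≢ B → A ∩ B ≡ S
        meet≡S A∈ B∈ A≢B = sym (⊆-size-≡ (λ x∈ → x∈p∩q⁺ (proj₂ (proj₂ kernel) A∈ x∈ , proj₂ (proj₂ kernel) B∈ x∈))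
          (≤-reflexive (trans (meet-size A∈ B∈ A≢B) (sym (proj₁ (proj₂ kernel))))))

        core≡S : core (F ⟨ k ⟩) ≡ S
        core≡S = ⋂-sunflower (unique (F ⟨ k ⟩)) (<⇒≤ 3≤card) (proj₂ (proj₂ kernel)) meet≡S

      core-size : size (core (F ⟨ k ⟩)) ≡ index * a
      core-size = trans (cong size core≡S) (proj₁ (proj₂ kernel))

      meet≡core : ∀ {A B} → A ∈ᶠ F ⟨ k ⟩ → B ∈ᶠ F ⟨ k ⟩ → A ≢ B → A ∩ B ≡ core (F ⟨ k ⟩)
      meet≡core A∈ B∈ A≢B = trans (meet≡S A∈ B∈ A≢B) (sym core≡S)

      -- The petals of a good layer are disjoint and number more than W, so some petal has no point
      -- in common with `D`.
      avoiding : ∀ D → size D ≤ W → ∃[ A ] A ∈ᶠ F ⟨ k ⟩ × A ∩ D ⊆ core (F ⟨ k ⟩)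
      avoiding D |D|≤W = A , proj₁ (proj₂ avoider) , λ {x} x∈ → let x∈A , x∈D = x∈p∩q⁻ A D x∈ in
        decidable-stable (x ∈? K) λ x∉K → proj₂ (proj₂ avoider) (x , x∈p∩q⁺ (x∈A , x∈p∩q⁺ (x∈D , x∉p⇒x∈∁p x∉K)))
        where
        K = core (F ⟨ k ⟩)
        W<card : W < card (F ⟨ k ⟩)
        W<card = ≤-<-trans (≤-trans (m≤m*n W W {{>-nonZero (≤-trans 0<k k≤W)}}) (m≤n*m (W * W) 2)) good
        exclusive : ∀ {A B x} → A ∈ᶠ F ⟨ k ⟩ → B ∈ᶠ F ⟨ k ⟩ → x ∈ D ∩ ∁ K → x ∈ A → x ∈ B → A ≡ B
        exclusive {A} {B} {x} A∈ B∈ x∈ x∈A x∈B = decidable-stable (A ≟ˢ B) λ A≢B →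
          x∈∁p⇒x∉p (proj₂ (x∈p∩q⁻ D (∁ K) x∈)) (subst (x ∈_) (meet≡core A∈ B∈ A≢B) (x∈p∩q⁺ (x∈A , x∈B)))
        avoider : ∃[ A ] A ∈ᶠ F ⟨ k ⟩ × Empty (A ∩ D ∩ ∁ K)
        avoider = avoiding-member {xs = members (F ⟨ k ⟩)} (D ∩ ∁ K) (unique (F ⟨ k ⟩)) exclusive
          (≤-<-trans (∣p∩q∣≤∣p∣ D (∁ K)) (≤-<-trans |D|≤W W<card))
        A = proj₁ avoider

    module _ {k l} (good-k : Good k) (good-l : Good l) (k<l : k < l) where

      private
        i = index good-k
        j = index good-l
        Kk = core (F ⟨ k ⟩)
        Kl = core (F ⟨ l ⟩)

        i<j : i < j
        i<j = *-cancelʳ-< b i j (subst₂ _<_ (k≡index*b good-k) (k≡index*b good-l) k<l)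

        ia<ja : i * a < j * a
        ia<ja = *-monoˡ-< a i<j

      cross-meet : ∀ {A B} → A ∈ᶠ F ⟨ k ⟩ → B ∈ᶠ F ⟨ l ⟩ → size (A ∩ B) ≡ i * a ⊎ size (A ∩ B) ≡ j * a
      cross-meet {A} {B} A∈ B∈ =
        let A∈F , |A|≡k = layer⁻ {F} A∈ ; B∈F , |B|≡l = layer⁻ {F} B∈ in
        [ (λ eq → inj₁ (from-b* good-k (trans eq (cong (a *_) |A|≡k))))
        , (λ eq → inj₂ (from-b* good-l (trans eq (cong (a *_) |B|≡l)))) ]′
        (fractional A∈F B∈F λ A≡B → <⇒≢ k<l (trans (sym |A|≡k) (trans (cong size A≡B) |B|≡l)))

      -- Choose A in layer k with petal avoiding Kl, then B in layer l with petal avoiding A. The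
      -- intersection A ∩ B lies in A ∩ Kl, hence in Kk, yet has at least i a = |Kk| points; so it
      -- equals Kk, and it lies in Kl. Properness is the comparison of sizes i a < j a.
      core-⊂ : Kk ⊂ Kl
      core-⊂ = (λ {x} → Kk⊆Kl {x}) , ⊈-witness λ Kl⊆Kk →
        <⇒≱ (subst₂ _<_ (sym (core-size good-k)) (sym (core-size good-l)) ia<ja) (p⊆q⇒∣p∣≤∣q∣ Kl⊆Kk)
        where
        |Kl|≤W : size Kl ≤ W
        |Kl|≤W = ≤-trans (≤-reflexive (core-size good-l)) (≤-trans (*-monoʳ-≤ j (<⇒≤ a<b))
                   (≤-trans (≤-reflexive (sym (k≡index*b good-l))) (k≤W good-l)))
        avoider-k : ∃[ A ] A ∈ᶠ F ⟨ k ⟩ × A ∩ Kl ⊆ Kk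
        avoider-k = avoiding good-k Kl |Kl|≤W
        A = proj₁ avoider-k
        A∈ = proj₁ (proj₂ avoider-k)
        A∩Kl⊆Kk = proj₂ (proj₂ avoider-k)
        avoider-l : ∃[ B ] B ∈ᶠ F ⟨ l ⟩ × B ∩ A ⊆ Kl
        avoider-l = avoiding good-l A (bounded (proj₁ (layer⁻ {F} A∈)))
        B = proj₁ avoider-l
        B∈ = proj₁ (proj₂ avoider-l)
        B∩A⊆Kl = proj₂ (proj₂ avoider-l)
        A∩B⊆Kk : A ∩ B ⊆ Kk
        A∩B⊆Kk x∈ = let x∈A , x∈B = x∈p∩q⁻ A B x∈ in A∩Kl⊆Kk (x∈p∩q⁺ (x∈A , B∩A⊆Kl (x∈p∩q⁺ (x∈B , x∈A))))
        size≥ : i * a ≤ size (A ∩ B)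
        size≥ = [ ≤-reflexive ∘ sym , (λ eq → ≤-trans (<⇒≤ ia<ja) (≤-reflexive (sym eq))) ]′ (cross-meet A∈ B∈)
        A∩B≡Kk : A ∩ B ≡ Kk
        A∩B≡Kk = ⊆-size-≡ A∩B⊆Kk (≤-trans (≤-reflexive (core-size good-k)) size≥)
        Kk⊆Kl : Kk ⊆ Kl
        Kk⊆Kl {x} x∈ = let x∈A , x∈B = x∈p∩q⁻ A B (subst (x ∈_) (sym A∩B≡Kk) x∈) in B∩A⊆Kl (x∈p∩q⁺ (x∈B , x∈A))

      -- For a B in layer l whose petal avoids A, the trace A ∩ Kl is A ∩ B, which has i a or j a
      -- points: as many as Kk, which it contains, or as many as Kl, which contains it.
      trace-dichotomy : ∀ {A} → A ∈ᶠ F ⟨ k ⟩ → A ∩ Kl ≡ Kk ⊎ Kl ⊆ A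
      trace-dichotomy {A} A∈ = [ inj₁ ∘ small , (λ eq → inj₂ (λ {x} → large eq {x})) ]′ (cross-meet A∈ B∈)
        where
        avoider : ∃[ B ] B ∈ᶠ F ⟨ l ⟩ × B ∩ A ⊆ Kl
        avoider = avoiding good-l A (bounded (proj₁ (layer⁻ {F} A∈)))
        B = proj₁ avoider
        B∈ = proj₁ (proj₂ avoider)
        B∩A⊆Kl = proj₂ (proj₂ avoider)
        A∩Kl≡A∩B : A ∩ Kl ≡ A ∩ B
        A∩Kl≡A∩B = ⊆-antisym
          (λ x∈ → let x∈A , x∈Kl = x∈p∩q⁻ A Kl x∈ in x∈p∩q⁺ (x∈A , ⋂-⊆ B∈ x∈Kl))
          (λ x∈ → let x∈A , x∈B = x∈p∩q⁻ A B x∈ in x∈p∩q⁺ (x∈A , B∩A⊆Kl (x∈p∩q⁺ (x∈B , x∈A))))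
        small : size (A ∩ B) ≡ i * a → A ∩ Kl ≡ Kk
        small eq = sym (⊆-size-≡ (λ x∈ → x∈p∩q⁺ (⋂-⊆ A∈ x∈ , proj₁ core-⊂ x∈))
          (≤-reflexive (trans (cong size A∩Kl≡A∩B) (trans eq (sym (core-size good-k))))))
        large : size (A ∩ B) ≡ j * a → Kl ⊆ A
        large eq x∈ = p∩q⊆p A Kl (subst (_ ∈_) (sym A∩Kl≡Kl) x∈)
          where
          A∩Kl≡Kl : A ∩ Kl ≡ Kl
          A∩Kl≡Kl = ⊆-size-≡ (p∩q⊆q A Kl)
            (≤-reflexive (trans (core-size good-l) (trans (sym eq) (cong size (sym A∩Kl≡A∩B)))))

      -- Two distinct exceptional members would both contain Kl, whereas their intersection is the
      -- strictly smaller Kk.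
      exceptional-unique : ∀ {A B} → A ∈ᶠ F ⟨ k ⟩ → B ∈ᶠ F ⟨ k ⟩ → A ∩ Kl ≢ Kk → B ∩ Kl ≢ Kk → A ≡ B
      exceptional-unique {A} {B} A∈ B∈ A≢ B≢ = decidable-stable (A ≟ˢ B) λ A≢B →
        let _ , x , x∈Kl , x∉Kk = core-⊂ in
        x∉Kk (subst (x ∈_) (meet≡core good-k A∈ B∈ A≢B) (x∈p∩q⁺ (contains A∈ A≢ x∈Kl , contains B∈ B≢ x∈Kl)))
        where
        contains : ∀ {A} → A ∈ᶠ F ⟨ k ⟩ → A ∩ Kl ≢ Kk → Kl ⊆ A
        contains A∈ A≢ = [ (λ eq → contradiction eq A≢) , id ]′ (trace-dichotomy A∈)

    G : Family n
    G = filterᶠ (λ A → good? (size A)) F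

    top : ℕ
    top = maxSize (members G)

    -- If no layer is good then `top` is 0 and this is the empty intersection, the full ground set;
    -- `F*` is empty in that case.
    M : Subset n
    M = core (F ⟨ top ⟩)

    Regular : Subset n → Set
    Regular A = A ∩ M ≡ core (F ⟨ size A ⟩)

    regular? : Decidable Regular
    regular? A = (A ∩ M) ≟ˢ core (F ⟨ size A ⟩)

    F* : Family n
    F* = filterᶠ regular? G

    G⁻ : ∀ {A} → A ∈ᶠ G → A ∈ᶠ F × Good (size A)
    G⁻ = ∈-filter⁻ (λ A → good? (size A)) {xs = members F}

    F*⁻ : ∀ {A} → A ∈ᶠ F* → (A ∈ᶠ F × Good (size A)) × Regular A
    F*⁻ A∈ = let A∈G , reg = ∈-filter⁻ regular? {xs = members G} A∈ in G⁻ A∈G , reg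

    F*⁺ : ∀ {A} → A ∈ᶠ F → Good (size A) → Regular A → A ∈ᶠ F*
    F*⁺ A∈ good reg = ∈-filter⁺ regular? (∈-filter⁺ (λ A → good? (size A)) A∈ good) reg

    F*⊆F : F* ⊆ᶠ F
    F*⊆F A∈ = proj₁ (proj₁ (F*⁻ A∈))

    size≤top : ∀ {k} → Good k → k ≤ top
    size≤top good = let A , A∈ = good-inhabited good ; A∈F , |A|≡k = layer⁻ {F} A∈ in
      subst (_≤ top) |A|≡k (size≤maxSize {xs = members G} (∈-filter⁺ (λ A → good? (size A)) A∈F (subst Good (sym |A|≡k) good)))

    good-top : ∀ {k} → Good k → Good top
    good-top good = let T , T∈ , eq = maxSize-attained (members G) (≤-trans (0<k good) (size≤top good)) in
      subst Good eq (proj₂ (G⁻ T∈))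

    irregular : ℕ → List (Subset n)
    irregular k = filter (¬? ∘ regular?) (members (F ⟨ k ⟩))

    -- Below the top size this is `exceptional-unique`; at the top size every member contains M, so
    -- none is irregular.
    irregular≤1 : ∀ {k} → Good k → length (irregular k) ≤ 1
    irregular≤1 {k} good = length≤1 (unique-filter (¬? ∘ regular?) (unique (F ⟨ k ⟩))) same
      where
      same : ∀ {A B} → A List.∈ irregular k → B List.∈ irregular k → A ≡ B
      same {A} {B} A∈ B∈ = [ below-top , at-top ]′ (m≤n⇒m<n∨m≡n (size≤top good))
        where
        irregular⁻ : ∀ {A} → A List.∈ irregular k → A ∈ᶠ F ⟨ k ⟩ × A ∩ M ≢ core (F ⟨ k ⟩)
        irregular⁻ {A} A∈ = let A∈k , ¬reg = ∈-filter⁻ (¬? ∘ regular?) {xs = members (F ⟨ k ⟩)} A∈ in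
          A∈k , λ eq → ¬reg (trans eq (cong (λ s → core (F ⟨ s ⟩)) (sym (proj₂ (layer⁻ {F} A∈k)))))
        below-top : k < top → A ≡ B
        below-top k<top = let A∈k , A≢ = irregular⁻ A∈ ; B∈k , B≢ = irregular⁻ B∈ in
          exceptional-unique good (good-top good) k<top A∈k B∈k A≢ B≢
        at-top : k ≡ top → A ≡ B
        at-top k≡top = let A∈k , A≢ = irregular⁻ A∈ in contradiction
          (trans (cong (λ s → A ∩ core (F ⟨ s ⟩)) (sym k≡top))
            (⊆-antisym (p∩q⊆q A _) (λ x∈ → x∈p∩q⁺ (⋂-⊆ A∈k x∈ , x∈)))) A≢

    layer*⁺ : ∀ {k A} → Good k → A ∈ᶠ F ⟨ k ⟩ → Regular A → A ∈ᶠ F* ⟨ k ⟩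
    layer*⁺ good A∈ reg = let A∈F , |A|≡k = layer⁻ {F} A∈ in
      layer⁺ {F*} (F*⁺ A∈F (subst Good (sym |A|≡k) good) reg) |A|≡k

    layer*⊆layer : ∀ {k} → F* ⟨ k ⟩ ⊆ᶠ F ⟨ k ⟩
    layer*⊆layer A∈ = let A∈* , |A|≡k = layer⁻ {F*} A∈ in layer⁺ {F} (F*⊆F A∈*) |A|≡k

    2≤card* : ∀ {k} → Good k → 2 ≤ card (F* ⟨ k ⟩)
    2≤card* {k} good = ≤-trans (+-cancelʳ-≤ 1 2 _ (begin
      3                                                                       ≤⟨ 3≤card good ⟩
      card (F ⟨ k ⟩)                                                          ≡⟨ sym (length-filter+ regular? (members (F ⟨ k ⟩))) ⟩
      length (filter regular? (members (F ⟨ k ⟩))) + length (irregular k)     ≤⟨ +-monoʳ-≤ _ (irregular≤1 good) ⟩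
      length (filter regular? (members (F ⟨ k ⟩))) + 1                        ∎))
      (length-unique-⊆ (unique-filter regular? (unique (F ⟨ k ⟩)))
        λ A∈ → let A∈k , reg = ∈-filter⁻ regular? {xs = members (F ⟨ k ⟩)} A∈ in layer*⁺ good A∈k reg)
      where open ≤-Reasoning

    -- Two surviving members still meet exactly in the old core, so removing a member of the layer
    -- cannot enlarge it.
    core*≡core : ∀ {k} → Good k → core (F* ⟨ k ⟩) ≡ core (F ⟨ k ⟩)
    core*≡core {k} good = ⋂-sunflower (unique (F* ⟨ k ⟩)) (2≤card* good)
      (λ A∈ → ⋂-⊆ (layer*⊆layer A∈)) (λ A∈ B∈ → meet≡core good (layer*⊆layer A∈) (layer*⊆layer B∈))

    isSizeOf⇒good : ∀ {k} → IsSizeOf k F* → Good k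
    isSizeOf⇒good (A , A∈ , |A|≡k) = subst Good |A|≡k (proj₂ (proj₁ (F*⁻ A∈)))

    isBouquet : IsBouquet F*
    isBouquet = record { sunflower = sunflower ; chain = chain ; trace = trace }
      where
      sunflower : ∀ {k} → IsSizeOf k F* → IsSunflower (F* ⟨ k ⟩) × 2 ≤ card (F* ⟨ k ⟩)
      sunflower k∈ = let good = isSizeOf⇒good k∈ in
        (λ A∈ B∈ A≢B → trans
          (meet≡core good (layer*⊆layer A∈) (layer*⊆layer B∈) A≢B) (sym (core*≡core good))) , 2≤card* good
      chain : ∀ {k l} → IsSizeOf k F* → IsSizeOf l F* → k < l → core (F* ⟨ k ⟩) ⊂ core (F* ⟨ l ⟩)
      chain k∈ l∈ k<l = let good-k = isSizeOf⇒good k∈ ; good-l = isSizeOf⇒good l∈ in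
        subst₂ _⊂_ (sym (core*≡core good-k)) (sym (core*≡core good-l)) (core-⊂ good-k good-l k<l)
      trace : ∀ {k} → IsSizeOf k F* → (∀ {l} → IsSizeOf l F* → l ≤ k) →
              ∀ {A} → A ∈ᶠ F* → A ∩ core (F* ⟨ k ⟩) ≡ core (F* ⟨ size A ⟩)
      trace {k} k∈ max {A} A∈ = begin
        A ∩ core (F* ⟨ k ⟩)       ≡⟨ cong (A ∩_) (trans (core*≡core good-k) (cong (λ s → core (F ⟨ s ⟩)) k≡top)) ⟩
        A ∩ M                     ≡⟨ proj₂ (F*⁻ A∈) ⟩
        core (F ⟨ size A ⟩)       ≡⟨ sym (core*≡core (proj₂ (proj₁ (F*⁻ A∈)))) ⟩
        core (F* ⟨ size A ⟩)      ∎
        where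
        open ≡-Reasoning
        good-k = isSizeOf⇒good k∈
        top∈ : IsSizeOf top F*
        top∈ = let B , _ , B∈ , _ = two-distinct (unique (F* ⟨ top ⟩)) (2≤card* (good-top good-k)) in B , layer⁻ {F*} B∈
        -- The layer of size `top` keeps at least two members, so the largest size in `F*` is the
        -- one that defines M.
        k≡top : k ≡ top
        k≡top = ≤-antisym (size≤top good-k) (max top∈)

    -- A layer that is not good loses at most T members, a good one at most a single irregular
    -- member, and the sizes range over 1, ..., W.
    F∖F*-small : card (F ∖ F*) ≤ W * T
    F∖F*-small = length-buckets size W (unique (F ∖ F*)) (λ A∈ → let A∈F , _ = ∖⁻ A∈ in 0<size (nonempty A∈F) , bounded A∈F) bucket
      where
      open import Data.List.Membership.DecPropositional (_≟ˢ_ {n}) using () renaming (_∈?_ to _∈ˡ?_)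
      ∖⁻ : ∀ {A} → A ∈ᶠ F ∖ F* → A ∈ᶠ F × A List.∉ members F*
      ∖⁻ = ∈-filter⁻ (λ A → ¬? (A ∈ˡ? members F*)) {xs = members F}
      u : ∀ k → Unique (members ((F ∖ F*) ⟨ k ⟩))
      u k = unique ((F ∖ F*) ⟨ k ⟩)
      bucket : ∀ k → card ((F ∖ F*) ⟨ k ⟩) ≤ T
      bucket k = decide (good? k)
        where
        decide : Dec (Good k) → card ((F ∖ F*) ⟨ k ⟩) ≤ T
        decide (no ¬good) = ≤-trans (length-unique-⊆ (u k) λ A∈ →
          let A∈∖ , |A|≡k = layer⁻ {F ∖ F*} A∈ in layer⁺ {F} (proj₁ (∖⁻ A∈∖)) |A|≡k) (≮⇒≥ ¬good)
        decide (yes good) = ≤-trans (length-unique-⊆ (u k) sub) (≤-trans (irregular≤1 good) (≤-trans (s≤s z≤n) (2≤T good)))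
          where
          sub : members ((F ∖ F*) ⟨ k ⟩) List.⊆ irregular k
          sub A∈ = let A∈∖ , |A|≡k = layer⁻ {F ∖ F*} A∈ ; A∈F , A∉ = ∖⁻ A∈∖ ; A∈k = layer⁺ {F} A∈F |A|≡k in
            ∈-filter⁺ (¬? ∘ regular?) A∈k λ reg → A∉ (proj₁ (layer⁻ {F*} (layer*⁺ good A∈k reg)))

    member-sizes : ∀ {A} → A ∈ᶠ F* → ∃[ i ] 0 < i × size A ≡ i * b × size (A ∩ M) ≡ i * a
    member-sizes A∈ = let (A∈F , good) , reg = F*⁻ A∈ in
      index good , 0<index good , k≡index*b good , trans (cong size reg) (core-size good)

    -- Distinct members of one layer meet in its core, which by regularity lies inside M.
    outside-injective : ∀ {A B x} → A ∈ᶠ F* → B ∈ᶠ F* → x ∉ M → x ∈ A → x ∈ B → size A ≡ size B → A ≡ B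
    outside-injective {A} {B} {x} A∈ B∈ x∉M x∈A x∈B |A|≡|B| = decidable-stable (A ≟ˢ B) λ A≢B →
      let (A∈F , good) , reg = F*⁻ A∈ in
      x∉M (proj₂ (x∈p∩q⁻ A M (subst (x ∈_)
        (trans (meet≡core good (layer⁺ {F} A∈F refl) (layer⁺ {F} (F*⊆F B∈) (sym |A|≡|B|)) A≢B) (sym reg))
        (x∈p∩q⁺ (x∈A , x∈B)))))

    -- Let |A| < |B|. By regularity and the chain of cores, A ∩ M lies in A ∩ B. If b |A ∩ B| = a
    -- |A|, both sets have the same size and coincide, contradicting x ∉ M. So b |A ∩ B| = a |B|,
    -- and |A ∩ B| ≤ |A|.
    outside-ratio : ∀ {A B x} → A ∈ᶠ F* → B ∈ᶠ F* → x ∉ M → x ∈ A → x ∈ B → a * size B ≤ b * size A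
    outside-ratio {A} {B} {x} A∈ B∈ x∉M x∈A x∈B = [ unequal , *-mono-≤ (<⇒≤ a<b) ]′ (<-≤-connex (size A) (size B))
      where
      unequal : size A < size B → a * size B ≤ b * size A
      unequal |A|<|B| = [ impossible , (λ eq → ≤-trans (≤-reflexive (sym eq)) (*-monoʳ-≤ b (∣p∩q∣≤∣p∣ A B))) ]′
        (fractional (F*⊆F A∈) (F*⊆F B∈) (λ A≡B → <⇒≢ |A|<|B| (cong size A≡B)))
        where
        good-A = proj₂ (proj₁ (F*⁻ A∈))
        good-B = proj₂ (proj₁ (F*⁻ B∈))
        reg-A = proj₂ (F*⁻ A∈)
        reg-B = proj₂ (F*⁻ B∈)
        A∩M⊆A∩B : A ∩ M ⊆ A ∩ B
        A∩M⊆A∩B {y} y∈ = x∈p∩q⁺ (p∩q⊆p A M y∈ ,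
          p∩q⊆p B M (subst (y ∈_) (sym reg-B) (proj₁ (core-⊂ good-A good-B |A|<|B|) (subst (y ∈_) reg-A y∈))))
        A∩M≡A∩B : b * size (A ∩ B) ≡ a * size A → A ∩ M ≡ A ∩ B
        A∩M≡A∩B eq = ⊆-size-≡ A∩M⊆A∩B (≤-reflexive (trans (from-b* good-A eq) (sym (trans (cong size reg-A) (core-size good-A)))))
        impossible : b * size (A ∩ B) ≡ a * size A → a * size B ≤ b * size A
        impossible eq = contradiction (subst (x ∈_) (sym (A∩M≡A∩B eq)) (x∈p∩q⁺ (x∈A , x∈B))) (λ x∈ → x∉M (p∩q⊆q A M x∈))

-- Natural numbers as rationals

module Rationals where

  open import Defs using (fromℕ)
  open Sums
  open Subsets using (∑)
  open import Data.Nat.Base as ℕ using (ℕ; zero; suc)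
  import Data.Nat.Properties as ℕ
  import Data.Integer.Base as ℤ
  import Data.Integer.Properties as ℤ
  open import Data.Rational.Base
  open import Data.Rational.Properties
  open import Data.Rational.Unnormalised.Base as ℚᵘ using (mkℚᵘ; *≡*)
  import Data.Rational.Unnormalised.Properties as ℚᵘ
  open import Data.List.Base using (List; []; _∷_; length)
  open import Algebra.Bundles using (CommutativeMonoid)
  import Algebra.Properties.CommutativeSemigroup as CommutativeSemigroupProperties
  open import Algebra.Structures using (module IsCommutativeRing)
  open import Data.Product.Base using (_,_)
  open import Relation.Binary.PropositionalEquality

  module ∑ℚ = Sum _+_ _*_ 0ℚ 1ℚ (IsCommutativeRing.isCommutativeSemiring +-*-isCommutativeRing)
                  _≤_ ≤-isPreorder +-mono-≤

  open CommutativeSemigroupProperties (CommutativeMonoid.commutativeSemigroup +-0-commutativeMonoid) public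
    using (xy∙z≈xz∙y)

  +-cancelʳ-≤ : ∀ z {x y} → x + z ≤ y + z → x ≤ y
  +-cancelʳ-≤ z {x} {y} h = subst₂ _≤_ (undo x) (undo y) (+-monoˡ-≤ (- z) h)
    where
    undo : ∀ t → t + z - z ≡ t
    undo t = trans (+-assoc t z (- z)) (trans (cong (t +_) (+-inverseʳ z)) (+-identityʳ t))

  -- Normalisation divides by a gcd and does not reduce on variables, so the identity is checked on
  -- unnormalised fractions, where it is integer arithmetic.
  fromℕ-+ : ∀ m n → fromℕ (m ℕ.+ n) ≡ fromℕ m + fromℕ n
  fromℕ-+ m n = toℚᵘ-injective (begin
    toℚᵘ (fromℕ (m ℕ.+ n))                    ≈⟨ toℚᵘ-fromℚᵘ (mkℚᵘ (ℤ.+ (m ℕ.+ n)) 0) ⟩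
    mkℚᵘ (ℤ.+ (m ℕ.+ n)) 0                      ≈⟨ *≡* (cong (ℤ._* ℤ.+ 1) (cong₂ ℤ._+_ (sym (ℤ.*-identityʳ (ℤ.+ m))) (sym (ℤ.*-identityʳ (ℤ.+ n))))) ⟩
    mkℚᵘ (ℤ.+ m) 0 ℚᵘ.+ mkℚᵘ (ℤ.+ n) 0            ≈⟨ ℚᵘ.+-cong (toℚᵘ-fromℚᵘ (mkℚᵘ (ℤ.+ m) 0)) (toℚᵘ-fromℚᵘ (mkℚᵘ (ℤ.+ n) 0)) ⟨
    toℚᵘ (fromℕ m) ℚᵘ.+ toℚᵘ (fromℕ n)        ≈⟨ toℚᵘ-homo-+ (fromℕ m) (fromℕ n) ⟨
    toℚᵘ (fromℕ m + fromℕ n)                  ∎)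
    where open ℚᵘ.≃-Reasoning

  fromℕ-* : ∀ m n → fromℕ (m ℕ.* n) ≡ fromℕ m * fromℕ n
  fromℕ-* zero    n = sym (*-zeroˡ (fromℕ n))
  fromℕ-* (suc m) n = begin
    fromℕ (n ℕ.+ m ℕ.* n)            ≡⟨ fromℕ-+ n (m ℕ.* n) ⟩
    fromℕ n + fromℕ (m ℕ.* n)        ≡⟨ cong₂ _+_ (sym (*-identityˡ (fromℕ n))) (fromℕ-* m n) ⟩
    1ℚ * fromℕ n + fromℕ m * fromℕ n ≡⟨ sym (*-distribʳ-+ (fromℕ n) 1ℚ (fromℕ m)) ⟩
    (1ℚ + fromℕ m) * fromℕ n         ≡⟨ cong (_* fromℕ n) (sym (fromℕ-+ 1 m)) ⟩
    fromℕ (suc m) * fromℕ n          ∎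
    where open ≡-Reasoning

  /-*-cancel : ∀ i d .{{_ : ℕ.NonZero d}} → (i / d) * fromℕ d ≡ i / 1
  /-*-cancel i (suc d) = toℚᵘ-injective (begin
    toℚᵘ ((i / suc d) * fromℕ (suc d))             ≈⟨ toℚᵘ-homo-* (i / suc d) (fromℕ (suc d)) ⟩
    toℚᵘ (i / suc d) ℚᵘ.* toℚᵘ (fromℕ (suc d))     ≈⟨ ℚᵘ.*-cong (toℚᵘ-fromℚᵘ (mkℚᵘ i d)) (toℚᵘ-fromℚᵘ (mkℚᵘ (ℤ.+ suc d) 0)) ⟩
    mkℚᵘ i d ℚᵘ.* mkℚᵘ (ℤ.+ suc d) 0                 ≈⟨ *≡* (trans (ℤ.*-identityʳ _) (cong (λ t → i ℤ.* ℤ.+ suc t) (sym (ℕ.*-identityʳ d)))) ⟩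
    mkℚᵘ i 0                                       ≈⟨ toℚᵘ-fromℚᵘ (mkℚᵘ i 0) ⟨
    toℚᵘ (i / 1)                                   ∎)
    where open ℚᵘ.≃-Reasoning

  fromℕ-nonNeg : ∀ {n} → NonNegative (fromℕ n)
  fromℕ-nonNeg {n} = normalize-nonNeg n 1

  fromℕ-pos : ∀ {n} → 0 ℕ.< n → Positive (fromℕ n)
  fromℕ-pos {suc n} _ = normalize-pos (suc n) 1

  0≤fromℕ : ∀ n → 0ℚ ≤ fromℕ n
  0≤fromℕ n = nonNegative⁻¹ (fromℕ n) {{fromℕ-nonNeg {n}}}

  p≤p+q : ∀ p {q} → 0ℚ ≤ q → p ≤ p + q
  p≤p+q p 0≤q = subst (_≤ p + _) (+-identityʳ p) (+-monoʳ-≤ p 0≤q)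

  fromℕ-mono-≤ : ∀ {m n} → m ℕ.≤ n → fromℕ m ≤ fromℕ n
  fromℕ-mono-≤ {m} m≤n with ℕ.m≤n⇒∃[o]m+o≡n m≤n
  ... | o , refl = subst (fromℕ m ≤_) (sym (fromℕ-+ m o)) (p≤p+q (fromℕ m) (0≤fromℕ o))

  fromℕ-mono-< : ∀ {m n} → m ℕ.< n → fromℕ m < fromℕ n
  fromℕ-mono-< {m} m<n = <-≤-trans
    (subst₂ _<_ (+-identityʳ (fromℕ m)) (trans (+-comm (fromℕ m) 1ℚ) (sym (fromℕ-+ 1 m)))
      (+-monoʳ-< (fromℕ m) (positive⁻¹ 1ℚ)))
    (fromℕ-mono-≤ m<n)

  fromℕ-cancel-≤ : ∀ {m n} → fromℕ m ≤ fromℕ n → m ℕ.≤ n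
  fromℕ-cancel-≤ h = ℕ.≮⇒≥ λ n<m → <-irrefl refl (<-≤-trans (fromℕ-mono-< n<m) h)

  fromℕ-cancel-< : ∀ {m n} → fromℕ m < fromℕ n → m ℕ.< n
  fromℕ-cancel-< h = ℕ.≰⇒> λ n≤m → <-irrefl refl (<-≤-trans h (fromℕ-mono-≤ n≤m))

  fromℕ-injective : ∀ {m n} → fromℕ m ≡ fromℕ n → m ≡ n
  fromℕ-injective eq = ℕ.≤-antisym (fromℕ-cancel-≤ (≤-reflexive eq)) (fromℕ-cancel-≤ (≤-reflexive (sym eq)))

  fromℕ-∑ : ∀ {A : Set} (xs : List A) f → fromℕ (∑ xs f) ≡ ∑ℚ.∑ xs (λ x → fromℕ (f x))
  fromℕ-∑ []       f = refl
  fromℕ-∑ (x ∷ xs) f = trans (fromℕ-+ (f x) (∑ xs f)) (cong (fromℕ (f x) +_) (fromℕ-∑ xs f))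

  ∑ℚ-const : ∀ {A : Set} (xs : List A) c → ∑ℚ.∑ xs (λ _ → c) ≡ c * fromℕ (length xs)
  ∑ℚ-const []       c = sym (*-zeroʳ c)
  ∑ℚ-const (x ∷ xs) c = begin
    c + ∑ℚ.∑ xs (λ _ → c)               ≡⟨ cong₂ _+_ (sym (*-identityʳ c)) (∑ℚ-const xs c) ⟩
    c * 1ℚ + c * fromℕ (length xs)      ≡⟨ sym (*-distribˡ-+ c 1ℚ _) ⟩
    c * (1ℚ + fromℕ (length xs))        ≡⟨ cong (c *_) (sym (fromℕ-+ 1 (length xs))) ⟩
    c * fromℕ (suc (length xs))         ∎
    where open ≡-Reasoning

-- Reciprocal sums over index sets of bounded ratio

module Harmonic where

  open import Defs using (fromℕ; harmonic)
  open Rationals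
  open import Data.Nat.Base as ℕ using (ℕ; zero; suc; z≤n; s≤s; z<s)
  import Data.Nat.Properties as ℕ
  import Data.Nat.DivMod as ℕ
  open import Data.Nat.Tactic.RingSolver using (solve-∀)
  import Data.Integer.Base as ℤ
  open import Data.Rational.Base
  open import Data.Rational.Properties
  open import Data.List.Base using (List; []; _∷_; _++_)
  open import Data.List.Membership.Propositional using (_∈_; _∉_)
  open import Data.List.Membership.DecPropositional ℕ._≟_ using (_∈?_)
  open import Data.List.Membership.Propositional.Properties using (∈-++⁻)
  open import Data.List.Relation.Unary.Any using (here; there)
  open import Data.List.Relation.Unary.All as All using ([]; _∷_)
  open import Data.List.Relation.Unary.AllPairs using ([]; _∷_)
  open import Data.List.Relation.Unary.Unique.Propositional using (Unique)
  open import Data.List.Relation.Unary.Unique.Propositional.Properties using (++⁺)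
  open import Data.Product.Base using (∃-syntax; _×_; _,_; proj₁; proj₂)
  open import Data.Sum.Base using (_⊎_; inj₁; inj₂)
  open import Function.Base using (_∘_)
  open import Relation.Nullary using (yes; no; contradiction)
  open import Relation.Nullary.Decidable using (toWitness)
  open import Relation.Binary.PropositionalEquality

  open ∑ℚ

  -- The value 0 at 0 makes this a total function, usable as a weight or as a divisor by n without a
  -- side condition.
  recip : ℕ → ℚ
  recip zero    = 0ℚ
  recip (suc i) = ℤ.+ 1 / suc i

  recip-inverse : ∀ {i} → 0 ℕ.< i → recip i * fromℕ i ≡ 1ℚ
  recip-inverse {suc i} _ = /-*-cancel (ℤ.+ 1) (suc i)

  recip-pos : ∀ {i} → 0 ℕ.< i → Positive (recip i)
  recip-pos {suc i} _ = normalize-pos 1 (suc i)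

  0≤recip : ∀ i → 0ℚ ≤ recip i
  0≤recip zero    = ≤-refl
  0≤recip (suc i) = <⇒≤ (positive⁻¹ (recip (suc i)) {{recip-pos {suc i} z<s}})

  recip-anti : ∀ {i j} → 0 ℕ.< i → i ℕ.≤ j → recip j ≤ recip i
  recip-anti {i} {j} 0<i i≤j = *-cancelʳ-≤-pos (fromℕ j) {{fromℕ-pos 0<j}} (begin
    recip j * fromℕ j     ≡⟨ recip-inverse 0<j ⟩
    1ℚ                    ≡⟨ sym (recip-inverse 0<i) ⟩
    recip i * fromℕ i     ≤⟨ *-monoˡ-≤-nonNeg (recip i) {{nonNegative (0≤recip i)}} (fromℕ-mono-≤ i≤j) ⟩
    recip i * fromℕ j     ∎)
    where
    open ≤-Reasoning
    0<j = ℕ.<-≤-trans 0<i i≤j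

  recip-scale : ∀ {q r} → 0 ℕ.< q → 0 ℕ.< r → fromℕ r * recip (q ℕ.* r) ≡ recip q
  recip-scale {q} {r} 0<q 0<r = begin
    fromℕ r * recip (q ℕ.* r)                             ≡⟨ sym (*-identityˡ _) ⟩
    1ℚ * (fromℕ r * recip (q ℕ.* r))                      ≡⟨ cong (_* (fromℕ r * recip (q ℕ.* r))) (sym (recip-inverse 0<q)) ⟩
    recip q * fromℕ q * (fromℕ r * recip (q ℕ.* r))       ≡⟨ *-assoc (recip q) _ _ ⟩
    recip q * (fromℕ q * (fromℕ r * recip (q ℕ.* r)))     ≡⟨ cong (recip q *_) (sym (*-assoc (fromℕ q) _ _)) ⟩
    recip q * (fromℕ q * fromℕ r * recip (q ℕ.* r))       ≡⟨ cong (λ t → recip q * (t * recip (q ℕ.* r))) (sym (fromℕ-* q r)) ⟩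
    recip q * (fromℕ (q ℕ.* r) * recip (q ℕ.* r))         ≡⟨ cong (recip q *_) (*-comm _ (recip (q ℕ.* r))) ⟩
    recip q * (recip (q ℕ.* r) * fromℕ (q ℕ.* r))         ≡⟨ cong (recip q *_) (recip-inverse (ℕ.*-mono-< 0<q 0<r)) ⟩
    recip q * 1ℚ                                          ≡⟨ *-identityʳ (recip q) ⟩
    recip q                                               ∎
    where open ≡-Reasoning

  range : ℕ → List ℕ
  range zero    = []
  range (suc N) = suc N ∷ range N

  ∈-range⁺ : ∀ {i N} → 0 ℕ.< i → i ℕ.≤ N → i ∈ range N
  ∈-range⁺ {suc i} {zero}  _   ()
  ∈-range⁺ {i}     {suc N} 0<i i≤ with i ℕ.≟ suc N
  ... | yes refl = here refl
  ... | no  i≢   = there (∈-range⁺ 0<i (ℕ.≤-pred (ℕ.≤∧≢⇒< i≤ i≢)))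

  ∈-range⁻ : ∀ {i N} → i ∈ range N → 0 ℕ.< i × i ℕ.≤ N
  ∈-range⁻ {N = suc N} (here refl) = z<s , ℕ.≤-refl
  ∈-range⁻ {N = suc N} (there i∈)  = let 0<i , i≤N = ∈-range⁻ i∈ in 0<i , ℕ.m≤n⇒m≤1+n i≤N

  range-unique : ∀ N → Unique (range N)
  range-unique zero    = []
  range-unique (suc N) = All.tabulate (λ i∈ → ℕ.<⇒≢ (s≤s (proj₂ (∈-range⁻ i∈))) ∘ sym) ∷ range-unique N

  ∑-range : ∀ N → ∑ (range N) recip ≡ harmonic N
  ∑-range zero    = refl
  ∑-range (suc N) = trans (+-comm (recip (suc N)) _) (cong (_+ recip (suc N)) (∑-range N))

  ∑-recip≤harmonic : ∀ {L N} → Unique L → (∀ {i} → i ∈ L → 0 ℕ.< i × i ℕ.≤ N) → ∑ L recip ≤ harmonic N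
  ∑-recip≤harmonic {L} {N} u range⊇ = subst (∑ L recip ≤_) (∑-range N)
    (∑-unique-⊆ (λ {i} _ → 0≤recip i) u (λ i∈ → let 0<i , i≤N = range⊇ i∈ in ∈-range⁺ 0<i i≤N))

  -- Adjoining the missing index keeps the list distinct and within range, and 1/N is the smallest
  -- reciprocal it can contribute.
  ∑-recip-missing : ∀ {L N i₀} → Unique L → (∀ {i} → i ∈ L → 0 ℕ.< i × i ℕ.≤ N) →
                    0 ℕ.< i₀ → i₀ ℕ.≤ N → i₀ ∉ L → ∑ L recip + recip N ≤ harmonic N
  ∑-recip-missing {L} {N} {i₀} u range⊇ 0<i₀ i₀≤N i₀∉L = begin
    ∑ L recip + recip N      ≤⟨ +-monoʳ-≤ (∑ L recip) (recip-anti 0<i₀ i₀≤N) ⟩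
    ∑ L recip + recip i₀     ≡⟨ +-comm (∑ L recip) _ ⟩
    ∑ (i₀ ∷ L) recip         ≤⟨ ∑-recip≤harmonic
                                  (All.tabulate (λ i∈ i₀≡i → i₀∉L (subst (_∈ L) (sym i₀≡i) i∈)) ∷ u)
                                  (λ { (here refl) → 0<i₀ , i₀≤N ; (there i∈) → range⊇ i∈ }) ⟩
    harmonic N               ∎
    where open ≤-Reasoning

  -- Adjoining 1, ..., r to `L` gives distinct indices up to `N`. The partial sum stays on the left,
  -- so no difference of harmonic numbers is formed.
  ∑-recip-above : ∀ {L r N} → Unique L → r ℕ.≤ N → (∀ {i} → i ∈ L → r ℕ.< i × i ℕ.≤ N) →
                  ∑ L recip + harmonic r ≤ harmonic N
  ∑-recip-above {L} {r} {N} u r≤N range⊇ = begin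
    ∑ L recip + harmonic r               ≡⟨ cong (∑ L recip +_) (sym (∑-range r)) ⟩
    ∑ L recip + ∑ (range r) recip        ≡⟨ sym (∑-++ L (range r) recip) ⟩
    ∑ (L ++ range r) recip               ≤⟨ ∑-recip≤harmonic (++⁺ u (range-unique r) disjoint) within ⟩
    harmonic N                           ∎
    where
    open ≤-Reasoning
    disjoint : ∀ {i} → i ∈ L × i ∈ range r → _
    disjoint (i∈L , i∈r) = ℕ.<⇒≱ (proj₁ (range⊇ i∈L)) (proj₂ (∈-range⁻ i∈r))
    within : ∀ {i} → i ∈ L ++ range r → 0 ℕ.< i × i ℕ.≤ N
    within i∈ with ∈-++⁻ L i∈
    ... | inj₁ i∈L = let r<i , i≤N = range⊇ i∈L in ℕ.≤-<-trans z≤n r<i , i≤N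
    ... | inj₂ i∈r = let 0<i , i≤r = ∈-range⁻ i∈r in 0<i , ℕ.≤-trans i≤r r≤N

  harmonic-+ : ∀ N s → harmonic (s ℕ.+ N) ≤ harmonic N + fromℕ s * recip (suc N)
  harmonic-+ N zero    = ≤-reflexive (sym (trans (cong (harmonic N +_) (*-zeroˡ (recip (suc N)))) (+-identityʳ _)))
  harmonic-+ N (suc s) = begin
    harmonic (s ℕ.+ N) + recip (suc (s ℕ.+ N))                    ≤⟨ +-mono-≤ (harmonic-+ N s) (recip-anti z<s (s≤s (ℕ.m≤n+m N s))) ⟩
    harmonic N + fromℕ s * recip (suc N) + recip (suc N)          ≡⟨ +-assoc (harmonic N) _ _ ⟩
    harmonic N + (fromℕ s * recip (suc N) + recip (suc N))        ≡⟨ cong (harmonic N +_) (collect (fromℕ s) (recip (suc N))) ⟩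
    harmonic N + (1ℚ + fromℕ s) * recip (suc N)                   ≡⟨ cong (λ t → harmonic N + t * recip (suc N)) (sym (fromℕ-+ 1 s)) ⟩
    harmonic N + fromℕ (suc s) * recip (suc N)                    ∎
    where
    open ≤-Reasoning
    collect : ∀ x y → x * y + y ≡ (1ℚ + x) * y
    collect x y = trans (+-comm (x * y) y) (trans (cong (_+ x * y) (sym (*-identityˡ y))) (sym (*-distribʳ-+ y 1ℚ x)))

  -- 1/(r + 1) + ⋯ + 1/(2 r + 1) decreases in r, and equals 5/6 at r = 1.
  harmonic-double : ∀ r → harmonic (2 ℕ.* suc r ℕ.+ 1) + recip 6 ≤ harmonic (suc r) + 1ℚ
  harmonic-double zero    = toWitness {a? = harmonic 3 + recip 6 ≤? harmonic 1 + 1ℚ} _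
  harmonic-double (suc r) = begin
    harmonic (2 ℕ.* suc (suc r) ℕ.+ 1) + recip 6                ≡⟨ cong (λ t → harmonic t + recip 6) (index r) ⟩
    harmonic (2 ℕ.+ m) + recip 6                                ≤⟨ +-monoˡ-≤ (recip 6) (harmonic-+ m 2) ⟩
    harmonic m + fromℕ 2 * recip (suc m) + recip 6              ≡⟨ xy∙z≈xz∙y (harmonic m) (fromℕ 2 * recip (suc m)) (recip 6) ⟩
    harmonic m + recip 6 + fromℕ 2 * recip (suc m)              ≡⟨ cong (λ t → harmonic m + recip 6 + fromℕ 2 * recip t) (double r) ⟩
    harmonic m + recip 6 + fromℕ 2 * recip (suc (suc r) ℕ.* 2)  ≡⟨ cong (λ t → harmonic m + recip 6 + t) (recip-scale {suc (suc r)} {2} z<s z<s) ⟩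
    harmonic m + recip 6 + recip (suc (suc r))                  ≤⟨ +-monoˡ-≤ (recip (suc (suc r))) (harmonic-double r) ⟩
    harmonic (suc r) + 1ℚ + recip (suc (suc r))                 ≡⟨ xy∙z≈xz∙y (harmonic (suc r)) 1ℚ (recip (suc (suc r))) ⟩
    harmonic (suc (suc r)) + 1ℚ                                 ∎
    where
    open ≤-Reasoning
    m = 2 ℕ.* suc r ℕ.+ 1
    index : ∀ r → 2 ℕ.* suc (suc r) ℕ.+ 1 ≡ 2 ℕ.+ (2 ℕ.* suc r ℕ.+ 1)
    index = solve-∀
    double : ∀ r → suc (2 ℕ.* suc r ℕ.+ 1) ≡ suc (suc r) ℕ.* 2
    double = solve-∀

  -- With R = r + 2, the indices from R to (q + 2) R - 1 split into blocks of length R. The block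
  -- starting at j R sums to at most R / (j R) = 1/j, and the first one, by `harmonic-double`, even
  -- to at most 5/6 because R ≥ 2. This is the source of the 1/6.
  harmonic-blocks : ∀ q r → harmonic (suc (suc q) ℕ.* suc (suc r) ℕ.∸ 1) + recip 6 ≤ harmonic (suc r) + harmonic (suc q)
  harmonic-blocks zero r = subst (λ t → harmonic t + recip 6 ≤ harmonic (suc r) + 1ℚ) (index r) (harmonic-double r)
    where
    index : ∀ r → 2 ℕ.* suc r ℕ.+ 1 ≡ suc (r ℕ.+ suc (suc (r ℕ.+ 0)))
    index = solve-∀
  harmonic-blocks (suc q) r = begin
    harmonic (R ℕ.+ suc (suc q) ℕ.* R ℕ.∸ 1) + recip 6          ≡⟨ cong (λ t → harmonic t + recip 6) (ℕ.+-∸-assoc R {suc (suc q) ℕ.* R} {1} (s≤s z≤n)) ⟩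
    harmonic (R ℕ.+ m) + recip 6                                ≤⟨ +-monoˡ-≤ (recip 6) (harmonic-+ m R) ⟩
    harmonic m + fromℕ R * recip (suc (suc q) ℕ.* R) + recip 6  ≡⟨ cong (λ t → harmonic m + t + recip 6) (recip-scale {suc (suc q)} {R} z<s z<s) ⟩
    harmonic m + recip (suc (suc q)) + recip 6                  ≡⟨ xy∙z≈xz∙y (harmonic m) (recip (suc (suc q))) (recip 6) ⟩
    harmonic m + recip 6 + recip (suc (suc q))                  ≤⟨ +-monoˡ-≤ (recip (suc (suc q))) (harmonic-blocks q r) ⟩
    harmonic (suc r) + harmonic (suc q) + recip (suc (suc q))   ≡⟨ +-assoc (harmonic (suc r)) _ _ ⟩
    harmonic (suc r) + harmonic (suc (suc q))                   ∎
    where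
    open ≤-Reasoning
    R = suc (suc r)
    m = suc (suc q) ℕ.* R ℕ.∸ 1

  minimum : ∀ i L → ∃[ r ] r ∈ i ∷ L × (∀ {j} → j ∈ i ∷ L → r ℕ.≤ j)
  minimum i []      = i , here refl , λ { (here refl) → ℕ.≤-refl }
  minimum i (j ∷ L) with minimum j L
  ... | r , r∈ , r≤ with ℕ.≤-total i r
  ...   | inj₁ i≤r = i , here refl , λ { (here refl) → ℕ.≤-refl ; (there j∈) → ℕ.≤-trans i≤r (r≤ j∈) }
  ...   | inj₂ r≤i = r , there r∈ , λ { (here refl) → r≤i ; (there j∈) → r≤ j∈ }

  module _ (a b : ℕ) (0<a : 0 ℕ.< a) (a<b : a ℕ.< b) where

    private
      instance
        a≢0 : ℕ.NonZero a
        a≢0 = ℕ.>-nonZero 0<a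
      q : ℕ
      q = b ℕ./ a
      0<q : 0 ℕ.< q
      0<q = ℕ.m≥n⇒m/n>0 (ℕ.<⇒≤ a<b)
      b<a+qa : b ℕ.< a ℕ.+ q ℕ.* a
      b<a+qa = subst (ℕ._< a ℕ.+ q ℕ.* a) (sym (ℕ.m≡m%n+[m/n]*n b a)) (ℕ.+-monoˡ-< (q ℕ.* a) (ℕ.m%n<n b a))

    -- A common lower bound for the two possible losses: 1/6 when the least index is at least 2, and
    -- 1/q when all indices are at most q but one is absent.
    gap : ℚ
    gap = recip (6 ℕ.* q)

    gap-pos : Positive gap
    gap-pos = recip-pos (ℕ.*-mono-< {0} {6} z<s 0<q)

    -- Meant for the points of M, which have weight 0 and may be uncovered.
    gap≤harmonic : gap ≤ harmonic q
    gap≤harmonic = ≤-trans (recip-anti 0<q (ℕ.m≤n*m q 6))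
      (subst (_≤ harmonic q) (+-identityˡ (recip q)) (∑-recip-missing {[]} [] (λ ()) 0<q ℕ.≤-refl (λ ())))

    module _ {L} (u : Unique L) (pos : ∀ {i} → i ∈ L → 0 ℕ.< i)
      (ratio : ∀ {i j} → i ∈ L → j ∈ L → a ℕ.* j ℕ.≤ b ℕ.* i) where

      private
        below : ∀ {r} → r ∈ L → ∀ {i} → i ∈ L → i ℕ.< suc q ℕ.* r
        below {r} r∈ {i} i∈ = ℕ.*-cancelˡ-< a i (suc q ℕ.* r) (begin-strict
          a ℕ.* i                    ≤⟨ ratio r∈ i∈ ⟩
          b ℕ.* r                    <⟨ ℕ.*-monoˡ-< r {{ℕ.>-nonZero (pos r∈)}} b<a+qa ⟩
          (a ℕ.+ q ℕ.* a) ℕ.* r      ≡⟨ regroup a q r ⟩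
          a ℕ.* (suc q ℕ.* r)        ∎)
          where
          open ℕ.≤-Reasoning
          regroup : ∀ a q r → (a ℕ.+ q ℕ.* a) ℕ.* r ≡ a ℕ.* (suc q ℕ.* r)
          regroup = solve-∀

        no-one : ∀ {r} q′ → q ≡ suc q′ → suc (suc r) ∈ L → (∀ {i} → i ∈ L → suc (suc r) ℕ.≤ i) →
                 ∑ L recip + recip 6 ≤ harmonic q
        no-one {r} q′ q≡ r∈ least = +-cancelʳ-≤ (harmonic (suc r)) (begin
          ∑ L recip + recip 6 + harmonic (suc r)     ≡⟨ xy∙z≈xz∙y (∑ L recip) (recip 6) (harmonic (suc r)) ⟩
          ∑ L recip + harmonic (suc r) + recip 6     ≤⟨ +-monoˡ-≤ (recip 6) (∑-recip-above u r≤N (λ i∈ → least i∈ , i≤N i∈)) ⟩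
          harmonic N + recip 6                       ≤⟨ harmonic-blocks q′ r ⟩
          harmonic (suc r) + harmonic (suc q′)       ≡⟨ +-comm (harmonic (suc r)) _ ⟩
          harmonic (suc q′) + harmonic (suc r)       ≡⟨ cong (λ t → harmonic t + harmonic (suc r)) (sym q≡) ⟩
          harmonic q + harmonic (suc r)              ∎)
          where
          open ≤-Reasoning
          N = suc (suc q′) ℕ.* suc (suc r) ℕ.∸ 1
          i≤N : ∀ {i} → i ∈ L → i ℕ.≤ N
          i≤N i∈ = ℕ.≤-pred (subst (λ t → _ ℕ.< suc t ℕ.* suc (suc r)) q≡ (below r∈ i∈))
          r≤N : suc r ℕ.≤ N
          r≤N = ℕ.≤-trans (ℕ.n≤1+n (suc r)) (i≤N r∈)

        -- If 1 occurs, the ratio bound confines all indices to 1, ..., q. Otherwise the least index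
        -- is at least 2 and the blocks already lose 1/6. The empty list falls vacuously under the
        -- first alternative.
        dichotomy : (∀ {i} → i ∈ L → i ℕ.≤ q) ⊎ ∑ L recip + gap ≤ harmonic q
        dichotomy with 1 ∈? L
        ... | yes 1∈ = inj₁ λ {i} i∈ → ℕ.≤-pred (subst (i ℕ.<_) (ℕ.*-identityʳ (suc q)) (below 1∈ i∈))
        ... | no 1∉ = go L refl
          where
          go : ∀ L′ → L ≡ L′ → (∀ {i} → i ∈ L → i ℕ.≤ q) ⊎ ∑ L recip + gap ≤ harmonic q
          go []       refl = inj₁ λ ()
          go (i ∷ L′) refl with minimum i L′
          ... | zero          , r∈ , least = contradiction (pos r∈) λ ()
          ... | suc zero      , r∈ , least = contradiction r∈ 1∉
          ... | suc (suc r)   , r∈ , least = inj₂ (≤-trans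
            (+-monoʳ-≤ (∑ L recip) (recip-anti {6} z<s (ℕ.m≤m*n 6 q {{ℕ.>-nonZero 0<q}})))
            (no-one (ℕ.pred q) (sym (ℕ.suc-pred q {{ℕ.>-nonZero 0<q}})) r∈ least))

      ∑-recip≤ : ∑ L recip ≤ harmonic q
      ∑-recip≤ with dichotomy
      ... | inj₁ small = ∑-recip≤harmonic u (λ i∈ → pos i∈ , small i∈)
      ... | inj₂ h = ≤-trans (p≤p+q (∑ L recip) (0≤recip (6 ℕ.* q))) h

      ∑-recip-gap : ∀ {i} → 0 ℕ.< i → i ℕ.≤ q → i ∉ L → ∑ L recip + gap ≤ harmonic q
      ∑-recip-gap 0<i i≤q i∉ with dichotomy
      ... | inj₂ h = h
      ... | inj₁ small = ≤-trans (+-monoʳ-≤ (∑ L recip) (recip-anti 0<q (ℕ.m≤n*m q 6)))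
                           (∑-recip-missing u (λ i∈ → pos i∈ , small i∈) 0<i i≤q i∉)

-- Double counting with weights 1/i

module Weights where

  open import Defs using (fromℕ; harmonic)
  open Subsets using (χ; χ-∈; χ-∉; χ≤1; χ-∩; size≡∑; size-split)
  open Rationals
  open Harmonic
  open import Data.Nat.Base as ℕ using (ℕ; _∸_)
  import Data.Nat.Properties as ℕ
  import Data.Nat.DivMod as ℕ
  open import Data.Rational.Base
  open import Data.Rational.Properties
  open import Data.Bool.Base using (not)
  open import Data.Fin.Base using (Fin)
  open import Data.Fin.Subset using (Subset; _∈_; _∉_; _∩_; ∁) renaming (∣_∣ to size)
  open import Data.Fin.Subset.Properties using (_∈?_; x∈p∩q⁻; x∈∁p⇒x∉p; x∉p⇒x∈∁p)
  open import Data.List.Base using (List; []; _∷_; length; map; filter; allFin)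
  open import Data.List.Properties using (length-tabulate)
  import Data.List.Membership.Propositional as List
  open import Data.List.Membership.Propositional.Properties using (∈-filter⁻; ∈-map⁻)
  open import Data.List.Relation.Unary.Any as Any using (here; there; any?)
  open import Data.List.Relation.Unary.All as All using (All; []; _∷_; all?)
  open import Data.List.Relation.Unary.All.Properties using (¬All⇒Any¬)
  open import Data.List.Relation.Unary.AllPairs using ([]; _∷_)
  open import Data.List.Relation.Unary.Unique.Propositional using (Unique)
  open import Data.List.Relation.Unary.Unique.Propositional.Properties using () renaming (filter⁺ to unique-filter)
  open import Data.Product.Base using (∃-syntax; _×_; _,_; proj₁; proj₂)
  open import Data.Vec.Base using (tabulate)
  open import Data.Vec.Properties using (lookup∘tabulate; []=⇒lookup; lookup⇒[]=)
  open import Function.Base using (_∘_; id)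
  open import Relation.Nullary using (Dec; yes; no; contradiction; does; _×-dec_; ¬_)
  open import Relation.Nullary.Decidable using (dec-true; dec-false; decidable-stable)
  open import Relation.Binary.PropositionalEquality

  open ∑ℚ using (∑)

  unique-map : ∀ {A B : Set} (f : A → B) {xs} → Unique xs →
               (∀ {x y} → x List.∈ xs → y List.∈ xs → f x ≡ f y → x ≡ y) → Unique (map f xs)
  unique-map f {[]}     []       _   = []
  unique-map f {x ∷ xs} (x∉ ∷ u) inj =
    All.tabulate distinct ∷ unique-map f u (λ y∈ z∈ → inj (there y∈) (there z∈))
    where
    distinct : ∀ {z} → z List.∈ map f xs → f x ≢ z
    distinct z∈ fx≡z with ∈-map⁻ f z∈
    ... | y , y∈ , refl = All.lookup x∉ y∈ (inj (here refl) (there y∈) fx≡z)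

  ∑-filter-∈ : ∀ {n} (xs : List (Subset n)) x (w : Subset n → ℚ) →
               ∑ xs (λ A → w A * fromℕ (χ A x)) ≡ ∑ (filter (x ∈?_) xs) w
  ∑-filter-∈ []       x w = refl
  ∑-filter-∈ (A ∷ xs) x w with x ∈? A
  ... | yes x∈A = cong₂ _+_ (trans (cong (λ c → w A * fromℕ c) (χ-∈ x∈A)) (*-identityʳ (w A))) (∑-filter-∈ xs x w)
  ... | no  x∉A = trans (cong₂ _+_ (trans (cong (λ c → w A * fromℕ c) (χ-∉ x∉A)) (*-zeroʳ (w A))) (∑-filter-∈ xs x w))
                        (+-identityˡ _)

  module Weighing {n : ℕ} (a b : ℕ) (0<a : 0 ℕ.< a) (a<b : a ℕ.< b) {xs : List (Subset n)} (u : Unique xs) (M : Subset n)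
    (sizes : ∀ {A} → A List.∈ xs → ∃[ i ] 0 ℕ.< i × size A ≡ i ℕ.* b × size (A ∩ M) ≡ i ℕ.* a)
    (injective : ∀ {A B x} → A List.∈ xs → B List.∈ xs → x ∉ M → x ∈ A → x ∈ B → size A ≡ size B → A ≡ B)
    (ratio : ∀ {A B x} → A List.∈ xs → B List.∈ xs → x ∉ M → x ∈ A → x ∈ B → a ℕ.* size B ℕ.≤ b ℕ.* size A)
    where

    private
      instance
        a≢0 : ℕ.NonZero a
        a≢0 = ℕ.>-nonZero 0<a
        b≢0 : ℕ.NonZero b
        b≢0 = ℕ.>-nonZero (ℕ.<-trans 0<a a<b)
      q : ℕ
      q = b ℕ./ a
      γ : ℚ
      γ = gap a b 0<a a<b
      pts : List (Fin n)
      pts = allFin n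

    HasSize : Fin n → ℕ → Set
    HasSize x i = ∃[ A ] A List.∈ xs × size A ≡ i ℕ.* b × x ∈ A

    -- Quantifying over finite lists makes this decidable, so that the uncovered points form an
    -- actual `Subset` whose size can be summed.
    Covered : Fin n → Set
    Covered x = All (λ i → Any.Any (λ A → size A ≡ i ℕ.* b × x ∈ A) xs) (range q)

    covered? : ∀ x → Dec (Covered x)
    covered? x = all? (λ i → any? (λ A → (size A ℕ.≟ i ℕ.* b) ×-dec (x ∈? A)) xs) (range q)

    uncovered : Subset n
    uncovered = tabulate (λ x → not (does (covered? x)))

    ∈-uncovered⁻ : ∀ {x} → x ∈ uncovered → ¬ Covered x
    ∈-uncovered⁻ {x} x∈ c = contradiction (trans (sym (cong not (dec-true (covered? x) c)))
                              (trans (sym (lookup∘tabulate _ x)) ([]=⇒lookup x∈))) λ ()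

    ∉-uncovered⁻ : ∀ {x} → x ∉ uncovered → ∀ i → 1 ℕ.≤ i → i ℕ.≤ q → HasSize x i
    ∉-uncovered⁻ {x} x∉ i 1≤i i≤q = List.find (All.lookup covered (∈-range⁺ 1≤i i≤q))
      where
      covered : Covered x
      covered = decidable-stable (covered? x) λ ¬c →
        x∉ (lookup⇒[]= x uncovered (trans (lookup∘tabulate _ x) (cong not (dec-false (covered? x) ¬c))))

    private
      -- Division by b, rather than the witness in `sizes`, gives a function on all subsets; on
      -- members it agrees with that witness.
      idx : Subset n → ℕ
      idx A = size A ℕ./ b

      module _ {A} (A∈ : A List.∈ xs) where
        size≡idx*b : size A ≡ idx A ℕ.* b
        size≡idx*b = let i , _ , eq , _ = sizes A∈ in
          trans eq (cong (ℕ._* b) (sym (trans (cong (ℕ._/ b) eq) (ℕ.m*n/n≡m i b))))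

        0<idx : 0 ℕ.< idx A
        0<idx = let i , 0<i , eq , _ = sizes A∈ in
          subst (0 ℕ.<_) (sym (trans (cong (ℕ._/ b) eq) (ℕ.m*n/n≡m i b))) 0<i

        outside-size : size (A ∩ ∁ M) ≡ (b ∸ a) ℕ.* idx A
        outside-size with sizes A∈
        ... | i , _ , eq , eqM = begin
          size (A ∩ ∁ M)                                 ≡⟨ sym (ℕ.m+n∸m≡n (size (A ∩ M)) _) ⟩
          size (A ∩ M) ℕ.+ size (A ∩ ∁ M) ∸ size (A ∩ M) ≡⟨ cong₂ _∸_ (trans (size-split A M) eq) eqM ⟩
          i ℕ.* b ∸ i ℕ.* a                              ≡⟨ sym (ℕ.*-distribˡ-∸ i b a) ⟩
          i ℕ.* (b ∸ a)                                  ≡⟨ ℕ.*-comm i (b ∸ a) ⟩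
          (b ∸ a) ℕ.* i                                  ≡⟨ cong ((b ∸ a) ℕ.*_) (sym (trans (cong (ℕ._/ b) eq) (ℕ.m*n/n≡m i b))) ⟩
          (b ∸ a) ℕ.* idx A                              ∎
          where open ≡-Reasoning

        unit-weight : recip (idx A) * fromℕ (size (A ∩ ∁ M)) ≡ fromℕ (b ∸ a)
        unit-weight = begin
          recip (idx A) * fromℕ (size (A ∩ ∁ M))                 ≡⟨ cong (λ s → recip (idx A) * fromℕ s) outside-size ⟩
          recip (idx A) * fromℕ ((b ∸ a) ℕ.* idx A)              ≡⟨ cong (recip (idx A) *_) (fromℕ-* (b ∸ a) (idx A)) ⟩
          recip (idx A) * (fromℕ (b ∸ a) * fromℕ (idx A))        ≡⟨ cong (recip (idx A) *_) (*-comm (fromℕ (b ∸ a)) _) ⟩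
          recip (idx A) * (fromℕ (idx A) * fromℕ (b ∸ a))        ≡⟨ sym (*-assoc (recip (idx A)) _ _) ⟩
          recip (idx A) * fromℕ (idx A) * fromℕ (b ∸ a)          ≡⟨ cong (_* fromℕ (b ∸ a)) (recip-inverse 0<idx) ⟩
          1ℚ * fromℕ (b ∸ a)                                     ≡⟨ *-identityˡ _ ⟩
          fromℕ (b ∸ a)                                          ∎
          where open ≡-Reasoning

      weight : Fin n → ℚ
      weight x = ∑ xs (λ A → recip (idx A) * fromℕ (χ (A ∩ ∁ M) x))

      total : fromℕ (b ∸ a) * fromℕ (length xs) ≡ ∑ pts weight
      total = begin
        fromℕ (b ∸ a) * fromℕ (length xs)                            ≡⟨ sym (∑ℚ-const xs _) ⟩
        ∑ xs (λ _ → fromℕ (b ∸ a))                                   ≡⟨ ∑ℚ.∑-cong xs (λ {A} A∈ → trans (sym (unit-weight A∈))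
                                                                          (cong (recip (idx A) *_) (size-as-sum (A ∩ ∁ M)))) ⟩
        ∑ xs (λ A → recip (idx A) * ∑ pts (λ x → fromℕ (χ (A ∩ ∁ M) x)))  ≡⟨ ∑ℚ.∑-cong xs (λ {A} _ → sym (∑ℚ.∑-*ˡ pts (recip (idx A)) _)) ⟩
        ∑ xs (λ A → ∑ pts (λ x → recip (idx A) * fromℕ (χ (A ∩ ∁ M) x)))  ≡⟨ ∑ℚ.∑-swap xs pts _ ⟩
        ∑ pts weight                                                 ∎
        where
        open ≡-Reasoning
        size-as-sum : ∀ (A : Subset n) → fromℕ (size A) ≡ ∑ pts (λ x → fromℕ (χ A x))
        size-as-sum A = trans (cong fromℕ (size≡∑ A)) (fromℕ-∑ pts (χ A))

      module _ {x} (x∉M : x ∉ M) where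

        through : List (Subset n)
        through = filter (x ∈?_) xs

        through⁻ : ∀ {A} → A List.∈ through → A List.∈ xs × x ∈ A
        through⁻ = ∈-filter⁻ (x ∈?_) {xs = xs}

        indices : List ℕ
        indices = map idx through

        weight≡ : weight x ≡ ∑ indices recip
        weight≡ = begin
          ∑ xs (λ A → recip (idx A) * fromℕ (χ (A ∩ ∁ M) x))   ≡⟨ ∑ℚ.∑-cong xs (λ {A} _ → cong (λ c → recip (idx A) * fromℕ c) (outside A)) ⟩
          ∑ xs (λ A → recip (idx A) * fromℕ (χ A x))           ≡⟨ ∑-filter-∈ xs x (recip ∘ idx) ⟩
          ∑ through (recip ∘ idx)                              ≡⟨ sym (∑ℚ.∑-map through idx recip) ⟩
          ∑ indices recip                                      ∎
          where
          open ≡-Reasoning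
          outside : ∀ A → χ (A ∩ ∁ M) x ≡ χ A x
          outside A = trans (χ-∩ A (∁ M) x) (trans (cong (χ A x ℕ.*_) (χ-∈ (x∉p⇒x∈∁p x∉M))) (ℕ.*-identityʳ _))

        indices-unique : Unique indices
        indices-unique = unique-map idx (unique-filter (x ∈?_) u) λ A∈ B∈ eq →
          let A∈xs , x∈A = through⁻ A∈ ; B∈xs , x∈B = through⁻ B∈ in
          injective A∈xs B∈xs x∉M x∈A x∈B (trans (size≡idx*b A∈xs) (trans (cong (ℕ._* b) eq) (sym (size≡idx*b B∈xs))))

        indices-pos : ∀ {i} → i List.∈ indices → 0 ℕ.< i
        indices-pos i∈ with ∈-map⁻ idx i∈
        ... | A , A∈ , refl = 0<idx (proj₁ (through⁻ A∈))

        indices-ratio : ∀ {i j} → i List.∈ indices → j List.∈ indices → a ℕ.* j ℕ.≤ b ℕ.* i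
        indices-ratio i∈ j∈ with ∈-map⁻ idx i∈ | ∈-map⁻ idx j∈
        ... | A , A∈ , refl | B , B∈ , refl =
          let A∈xs , x∈A = through⁻ A∈ ; B∈xs , x∈B = through⁻ B∈ in
          ℕ.*-cancelʳ-≤ (a ℕ.* idx B) (b ℕ.* idx A) b (subst₂ ℕ._≤_
            (trans (cong (a ℕ.*_) (size≡idx*b B∈xs)) (sym (ℕ.*-assoc a (idx B) b)))
            (trans (cong (b ℕ.*_) (size≡idx*b A∈xs)) (sym (ℕ.*-assoc b (idx A) b)))
            (ratio A∈xs B∈xs x∉M x∈A x∈B))

        missing-index : ¬ Covered x → ∃[ i ] (0 ℕ.< i × i ℕ.≤ q) × i List.∉ indices
        missing-index ¬c =
          let i , i∈ , none = List.find (¬All⇒Any¬ (λ i → any? (λ A → (size A ℕ.≟ i ℕ.* b) ×-dec (x ∈? A)) xs) (range q) ¬c)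
          in i , ∈-range⁻ i∈ , absent none
          where
          absent : ∀ {i} → ¬ Any.Any (λ A → size A ≡ i ℕ.* b × x ∈ A) xs → i List.∉ indices
          absent none i∈ with ∈-map⁻ idx i∈
          ... | A , A∈ , refl = let A∈xs , x∈A = through⁻ A∈ in none (List.lose A∈xs (size≡idx*b A∈xs , x∈A))

      γ*χ≤γ : ∀ x → γ * fromℕ (χ uncovered x) ≤ γ
      γ*χ≤γ x = subst (γ * fromℕ (χ uncovered x) ≤_) (*-identityʳ γ)
        (*-monoˡ-≤-nonNeg γ {{pos⇒nonNeg γ {{gap-pos a b 0<a a<b}}}} (fromℕ-mono-≤ {n = 1} (χ≤1 uncovered x)))

      -- A point of M has weight 0 and pays for the gap out of the harmonic number. Outside M, a
      -- covered point needs only the block bound, while an uncovered one misses some index and so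
      -- leaves the gap free.
      pointwise : ∀ x → weight x + γ * fromℕ (χ uncovered x) ≤ harmonic q
      pointwise x = split (x ∈? M) (x ∈? uncovered)
        where
        weight≡0 : x ∈ M → weight x ≡ 0ℚ
        weight≡0 x∈M = trans (∑ℚ.∑-cong xs (λ {A} _ → trans
          (cong (λ c → recip (idx A) * fromℕ c) (χ-∉ λ x∈ → x∈∁p⇒x∉p (proj₂ (x∈p∩q⁻ A (∁ M) x∈)) x∈M))
          (*-zeroʳ (recip (idx A))))) (∑ℚ.∑-zero xs)
        split : Dec (x ∈ M) → Dec (x ∈ uncovered) → weight x + γ * fromℕ (χ uncovered x) ≤ harmonic q
        split (yes x∈M) _ =
          ≤-trans (≤-reflexive (trans (cong (_+ γ * fromℕ (χ uncovered x)) (weight≡0 x∈M)) (+-identityˡ _)))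
                  (≤-trans (γ*χ≤γ x) (gap≤harmonic a b 0<a a<b))
        split (no x∉M) (no x∉) =
          ≤-trans (≤-reflexive (trans (cong₂ _+_ (weight≡ x∉M)
                    (trans (cong (λ c → γ * fromℕ c) (χ-∉ x∉)) (*-zeroʳ γ))) (+-identityʳ _)))
            (∑-recip≤ a b 0<a a<b (indices-unique x∉M) (indices-pos x∉M) (indices-ratio x∉M))
        split (no x∉M) (yes x∈) = let i , (0<i , i≤q) , i∉ = missing-index x∉M (∈-uncovered⁻ x∈) in
          ≤-trans (+-mono-≤ (≤-reflexive (weight≡ x∉M)) (γ*χ≤γ x))
            (∑-recip-gap a b 0<a a<b (indices-unique x∉M) (indices-pos x∉M) (indices-ratio x∉M) 0<i i≤q i∉)

    -- Keeping the uncovered points on the left lets one inequality serve twice: dropping their term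
    -- bounds the family, and near equality in that bound makes them few.
    weighing : fromℕ (b ∸ a) * fromℕ (length xs) + γ * fromℕ (size uncovered) ≤ harmonic q * fromℕ n
    weighing = begin
      fromℕ (b ∸ a) * fromℕ (length xs) + γ * fromℕ (size uncovered)
        ≡⟨ cong₂ _+_ total (trans (cong (γ *_) (trans (cong fromℕ (size≡∑ uncovered)) (fromℕ-∑ pts (χ uncovered)))) (sym (∑ℚ.∑-*ˡ pts γ _))) ⟩
      ∑ pts weight + ∑ pts (λ x → γ * fromℕ (χ uncovered x))    ≡⟨ sym (∑ℚ.∑-+ pts weight _) ⟩
      ∑ pts (λ x → weight x + γ * fromℕ (χ uncovered x))        ≤⟨ ∑ℚ.∑-mono pts (λ {x} _ → pointwise x) ⟩
      ∑ pts (λ _ → harmonic q)                                  ≡⟨ ∑ℚ-const pts (harmonic q) ⟩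
      harmonic q * fromℕ (length pts)                           ≡⟨ cong (λ t → harmonic q * fromℕ t) (length-tabulate {n = n} id) ⟩
      harmonic q * fromℕ n                                      ∎
      where open ≤-Reasoning

-- From the finite inequality to the asymptotic statements

module Asymptotics where

  open import Defs
  open Subsets using (length-filter+; length-unique-⊆)
  open Bouquets
  open Rationals
  open Harmonic
  open Weights
  open import Data.Nat.Base as ℕ using (ℕ; zero; suc; z≤n; s≤s; z<s; _∸_)
  import Data.Nat.Properties as ℕ
  import Data.Nat.DivMod as ℕ
  open import Data.Nat.GCD using (gcd)
  open import Data.Nat.Coprimality using (gcd≡1⇒coprime) renaming (sym to coprime-sym)
  open import Data.Nat.Tactic.RingSolver using (solve-∀)
  import Data.Integer.Base as ℤ
  import Data.Integer.Properties as ℤ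
  open import Data.Rational.Base
  open import Data.Rational.Properties
  open import Data.Fin.Base using (Fin)
  open import Data.Fin.Subset using (Subset; _∈_; _∉_) renaming (∣_∣ to size)
  open import Data.Fin.Subset.Properties using (∣p∣≤n)
  open import Data.List.Base using (List; []; _∷_)
  import Data.List.Membership.DecPropositional as DecMembership
  open import Data.List.Membership.Propositional.Properties using (∈-filter⁻)
  open import Data.List.Relation.Unary.Unique.Propositional.Properties using () renaming (filter⁺ to unique-filter)
  open import Data.Product.Base using (Σ-syntax; ∃-syntax; _×_; _,_; proj₁; proj₂)
  open import Data.Sum.Base as Sum
  open import Relation.Binary.PropositionalEquality

  archimedean : ∀ ε .{{_ : Positive ε}} → ∃[ m ] 1ℚ ≤ ε * fromℕ m
  -- The denominator of ε is a suitable multiplier: the product is the numerator, which is at least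
  -- 1.
  archimedean ε@(mkℚ (ℤ.+ suc i) d _) = suc d ,
    subst (1ℚ ≤_) (sym (trans (cong (_* fromℕ (suc d)) (sym (↥p/↧p≡p ε))) (/-*-cancel (ℤ.+ suc i) (suc d))))
      (fromℕ-mono-≤ {1} {suc i} (s≤s z≤n))

  *-monoˡ-≤-0≤ : ∀ {p q r} → 0ℚ ≤ r → p ≤ q → r * p ≤ r * q
  *-monoˡ-≤-0≤ {r = r} 0≤r = *-monoˡ-≤-nonNeg r {{nonNegative 0≤r}}

  cube-mono-≤ : ∀ {p q} → 0ℚ ≤ p → p ≤ q → cube p ≤ cube q
  cube-mono-≤ {p} {q} 0≤p p≤q = ≤-trans (*-monoʳ-≤-nonNeg p {{nonNegative 0≤p}} (square 0≤p p≤q))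
                                        (*-monoˡ-≤-0≤ (≤-trans 0≤pp (square 0≤p p≤q)) p≤q)
    where
    square : 0ℚ ≤ p → p ≤ q → p * p ≤ q * q
    square 0≤p p≤q = ≤-trans (*-monoˡ-≤-0≤ 0≤p p≤q) (*-monoʳ-≤-nonNeg q {{nonNegative (≤-trans 0≤p p≤q)}} p≤q)
    0≤pp : 0ℚ ≤ p * p
    0≤pp = subst (_≤ p * p) (*-zeroʳ p) (*-monoˡ-≤-0≤ 0≤p 0≤p)

  -- The condition f(n) = o(n) with ε replaced by 1/m and cleared of fractions.
  Negligible : (ℕ → ℕ) → Set
  Negligible f = ∀ m → ∃[ N ] (∀ n → N ℕ.≤ n → m ℕ.* f n ℕ.≤ n)

  negligible⇒IsO : ∀ {f} → Negligible f → IsO[n] f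
  negligible⇒IsO {f} negl ε = let m , 1≤εm = archimedean ε ; N , bound = negl m in N , λ n N≤n → begin
    fromℕ (f n)                       ≡⟨ sym (*-identityˡ _) ⟩
    1ℚ * fromℕ (f n)                  ≤⟨ *-monoʳ-≤-nonNeg (fromℕ (f n)) {{fromℕ-nonNeg {f n}}} 1≤εm ⟩
    ε * fromℕ m * fromℕ (f n)         ≡⟨ *-assoc ε _ _ ⟩
    ε * (fromℕ m * fromℕ (f n))       ≡⟨ cong (ε *_) (sym (fromℕ-* m (f n))) ⟩
    ε * fromℕ (m ℕ.* f n)             ≤⟨ *-monoˡ-≤-nonNeg ε {{pos⇒nonNeg ε}} (fromℕ-mono-≤ (bound n N≤n)) ⟩
    ε * fromℕ n                       ∎
    where open ≤-Reasoning

  -- Here δ(n) is f(n)/n. The equation is demanded at n = 0 as well, which is where f(0) = 0 enters.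
  IsO-quotient : ∀ (f : ℕ → ℚ) → f 0 ≡ 0ℚ → (∀ n → 0ℚ ≤ f n) →
                 (∀ ε .{{_ : Positive ε}} → ∃[ N ] (∀ n → N ℕ.≤ n → f n ≤ ε * fromℕ n)) →
                 ∃[ δ ] IsO[1] δ × (∀ n → δ n * fromℕ n ≡ f n)
  IsO-quotient f f0≡0 0≤f small = δ , δ-small , δ-quotient
    where
    δ : ℕ → ℚ
    δ n = f n * recip n
    δ-quotient : ∀ n → δ n * fromℕ n ≡ f n
    δ-quotient zero    = trans (*-zeroʳ (δ 0)) (sym f0≡0)
    δ-quotient (suc n) = trans (*-assoc (f (suc n)) _ _) (trans (cong (f (suc n) *_) (recip-inverse {suc n} z<s)) (*-identityʳ _))
    0≤δ : ∀ n → 0ℚ ≤ δ n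
    0≤δ n = subst (_≤ δ n) (*-zeroˡ (recip n)) (*-monoʳ-≤-nonNeg (recip n) {{nonNegative (0≤recip n)}} (0≤f n))
    δ-small : IsO[1] δ
    δ-small ε = let N , bound = small ε in suc N , λ n N<n →
      subst (_≤ ε) (sym (0≤p⇒∣p∣≡p (0≤δ n)))
        (*-cancelʳ-≤-pos (fromℕ n) {{fromℕ-pos (ℕ.≤-trans (s≤s z≤n) N<n)}}
          (subst (_≤ ε * fromℕ n) (sym (δ-quotient n)) (bound n (ℕ.<⇒≤ N<n))))

  -- The lower cut of ε times the cube root of n consists of rationals q for which some r > q/ε has
  -- r³ < n; taking q = ε m |A| gives (m |A|)³ < n.
  bounded⇒cube≤ : ∀ {w : ℕ → ℝ} {F : ∀ n → Family n} → IsO[∛n] w → (∀ n → IsBounded (w n) (F n)) →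
                  ∀ m → ∃[ N ] (∀ n → N ℕ.≤ n → ∀ {A} → A ∈ᶠ F n →
                    m ℕ.* size A ℕ.* (m ℕ.* size A) ℕ.* (m ℕ.* size A) ℕ.≤ n)
  bounded⇒cube≤ {w} {F} w-small bounded m =
    proj₁ (w-small ε) , λ n N≤n {A} A∈ → cases n N≤n A∈ (size A) refl
    where
    ε : ℚ
    -- With 1/(m + 1) in place of 1/m, the number ε m k is strictly below k, as membership in a
    -- lower cut requires. For k = 0 strictness fails, hence the separate case.
    ε = recip (suc m)
    instance
      ε>0 : Positive ε
      ε>0 = recip-pos {suc m} z<s
      ε≢0 : NonZero ε
      ε≢0 = pos⇒nonZero ε
    cases : ∀ n → proj₁ (w-small ε) ℕ.≤ n → ∀ {A} → A ∈ᶠ F n → ∀ k → size A ≡ k → m ℕ.* k ℕ.* (m ℕ.* k) ℕ.* (m ℕ.* k) ℕ.≤ n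
    cases n N≤n A∈ zero    _  = subst (ℕ._≤ n) (sym (cong (λ t → t ℕ.* t ℕ.* t) (ℕ.*-zeroʳ m))) z≤n
    cases n N≤n {A} A∈ k@(suc _) |A|≡k = ℕ.<⇒≤ (fromℕ-cancel-< (≤-<-trans
      (≤-trans (≤-reflexive fromℕ-cube) (cube-mono-≤ (0≤fromℕ x) (<⇒≤ x<r))) r³<n))
      where
      x = m ℕ.* k
      fromℕ-cube : fromℕ (x ℕ.* x ℕ.* x) ≡ cube (fromℕ x)
      fromℕ-cube = trans (fromℕ-* (x ℕ.* x) x) (cong (_* fromℕ x) (fromℕ-* x x))
      εx<k : ε * fromℕ x < fromℕ k
      εx<k = <-≤-trans (*-monoʳ-<-pos ε (fromℕ-mono-< (ℕ.m<n+m x {k} z<s)))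
        (≤-reflexive (trans (cong (ε *_) (fromℕ-* (suc m) k)) (trans (sym (*-assoc ε _ _))
          (trans (cong (_* fromℕ k) (recip-inverse {suc m} z<s)) (*-identityˡ _)))))
      in-cut : ∃[ r ] 1/ ε * (ε * fromℕ x) < r × cube r < fromℕ n
      in-cut = proj₂ (w-small ε) n N≤n (bounded n A∈ (subst (λ s → ε * fromℕ x < fromℕ s) (sym |A|≡k) εx<k))
      r³<n = proj₂ (proj₂ in-cut)
      x<r : fromℕ x < proj₁ in-cut
      x<r = subst (_< proj₁ in-cut) (trans (sym (*-assoc (1/ ε) ε _)) (trans (cong (_* fromℕ x) (*-inverseˡ ε)) (*-identityˡ _)))
        (proj₁ (proj₂ in-cut))

  width : ∀ {n} → Family n → ℕ
  width F = maxSize (members F)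

  exceptions : ∀ {n} → Family n → ℕ
  exceptions F = width F ℕ.* (2 ℕ.* (width F ℕ.* width F))

  -- The cube bound is used with multiplier 2 m, since 2 m W³ ≤ (2 m W)³. The width is attained by a
  -- member unless it is 0, so the bound on members transfers to it.
  exceptions-negligible : ∀ {w : ℕ → ℝ} {F : ∀ n → Family n} → IsO[∛n] w → (∀ n → IsBounded (w n) (F n)) →
                          Negligible (λ n → exceptions (F n))
  exceptions-negligible {w} {F} w-small bounded m =
    let N , bound = bounded⇒cube≤ {w} {F} w-small bounded (2 ℕ.* m) in N , λ n N≤n → ℕ.≤-trans (estimate (width (F n))) (cubes n (bound n N≤n))
    where
    x≤x³ : ∀ x → x ℕ.≤ x ℕ.* x ℕ.* x
    x≤x³ zero    = z≤n
    x≤x³ x@(suc _) = ℕ.≤-trans (ℕ.m≤m*n x x) (ℕ.m≤m*n (x ℕ.* x) x)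
    estimate : ∀ W → m ℕ.* (W ℕ.* (2 ℕ.* (W ℕ.* W))) ℕ.≤ 2 ℕ.* m ℕ.* W ℕ.* (2 ℕ.* m ℕ.* W) ℕ.* (2 ℕ.* m ℕ.* W)
    estimate W = begin
      m ℕ.* (W ℕ.* (2 ℕ.* (W ℕ.* W)))                                     ≡⟨ lhs m W ⟩
      2 ℕ.* m ℕ.* (W ℕ.* W ℕ.* W)                                         ≤⟨ ℕ.*-monoˡ-≤ (W ℕ.* W ℕ.* W) (x≤x³ (2 ℕ.* m)) ⟩
      2 ℕ.* m ℕ.* (2 ℕ.* m) ℕ.* (2 ℕ.* m) ℕ.* (W ℕ.* W ℕ.* W)             ≡⟨ rhs (2 ℕ.* m) W ⟩
      2 ℕ.* m ℕ.* W ℕ.* (2 ℕ.* m ℕ.* W) ℕ.* (2 ℕ.* m ℕ.* W)               ∎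
      where
      open ℕ.≤-Reasoning
      lhs : ∀ m W → m ℕ.* (W ℕ.* (2 ℕ.* (W ℕ.* W))) ≡ 2 ℕ.* m ℕ.* (W ℕ.* W ℕ.* W)
      lhs = solve-∀
      rhs : ∀ x W → x ℕ.* x ℕ.* x ℕ.* (W ℕ.* W ℕ.* W) ≡ x ℕ.* W ℕ.* (x ℕ.* W) ℕ.* (x ℕ.* W)
      rhs = solve-∀
    cubes : ∀ n → (∀ {A} → A ∈ᶠ F n → 2 ℕ.* m ℕ.* size A ℕ.* (2 ℕ.* m ℕ.* size A) ℕ.* (2 ℕ.* m ℕ.* size A) ℕ.≤ n) →
            2 ℕ.* m ℕ.* width (F n) ℕ.* (2 ℕ.* m ℕ.* width (F n)) ℕ.* (2 ℕ.* m ℕ.* width (F n)) ℕ.≤ n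
    cubes n bound = Sum.[ attained , trivial ]′ (ℕ.m≤n⇒m<n∨m≡n (z≤n {width (F n)}))
      where
      P : ℕ → Set
      P s = 2 ℕ.* m ℕ.* s ℕ.* (2 ℕ.* m ℕ.* s) ℕ.* (2 ℕ.* m ℕ.* s) ℕ.≤ n
      attained : 0 ℕ.< width (F n) → P (width (F n))
      attained 0<W = let A , A∈ , eq = maxSize-attained (members (F n)) 0<W in subst P eq (bound A∈)
      trivial : 0 ≡ width (F n) → P (width (F n))
      trivial 0≡W = subst P 0≡W (subst (ℕ._≤ n) (sym (cong (λ t → t ℕ.* t ℕ.* t) (ℕ.*-zeroʳ (2 ℕ.* m)))) z≤n)

  -- Provides the value at n = 0 that `IsO-quotient` asks for.
  exceptions-zero : ∀ (F : Family 0) → exceptions F ≡ 0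
  exceptions-zero F = cong (λ W → W ℕ.* (2 ℕ.* (W ℕ.* W))) (ℕ.n≤0⇒n≡0 (bound (members F)))
    where
    bound : ∀ (xs : List (Subset 0)) → maxSize xs ℕ.≤ 0
    bound []       = z≤n
    bound (A ∷ xs) = ℕ.⊔-lub (∣p∣≤n A) (bound xs)

  module _ (a b : ℕ) (1≤a : 1 ℕ.≤ a) (a<b : a ℕ.< b) where

    private
      θ  = ratio a b 1≤a a<b
      Cθ = C a b 1≤a a<b
      q  = ⌊b/a⌋ a b 1≤a a<b
      instance
        b≢0 : ℕ.NonZero b
        b≢0 = ℕ.>-nonZero (ℕ.<-trans 1≤a a<b)
        b-a≢0 : ℕ.NonZero (b ∸ a)
        b-a≢0 = ℕ.>-nonZero (ℕ.m<n⇒0<n∸m a<b)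

    b*θ : ∀ k → fromℕ b * (θ * fromℕ k) ≡ fromℕ (a ℕ.* k)
    b*θ k = begin
      fromℕ b * (θ * fromℕ k)     ≡⟨ sym (*-assoc (fromℕ b) θ _) ⟩
      fromℕ b * θ * fromℕ k       ≡⟨ cong (_* fromℕ k) (trans (*-comm (fromℕ b) θ) (/-*-cancel (ℤ.+ a) b)) ⟩
      fromℕ a * fromℕ k           ≡⟨ sym (fromℕ-* a k) ⟩
      fromℕ (a ℕ.* k)             ∎
      where open ≡-Reasoning

    θ-multiple⇒ : ∀ {s k} → fromℕ s ≡ θ * fromℕ k → b ℕ.* s ≡ a ℕ.* k
    θ-multiple⇒ {s} {k} eq = fromℕ-injective (trans (fromℕ-* b s) (trans (cong (fromℕ b *_) eq) (b*θ k)))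

    θ-multiple⇐ : ∀ {s k} → b ℕ.* s ≡ a ℕ.* k → fromℕ s ≡ θ * fromℕ k
    θ-multiple⇐ {s} {k} eq = ≤-antisym (cancel (≤-reflexive both)) (cancel (≤-reflexive (sym both)))
      where
      both : fromℕ b * fromℕ s ≡ fromℕ b * (θ * fromℕ k)
      both = trans (sym (fromℕ-* b s)) (trans (cong fromℕ eq) (sym (b*θ k)))
      cancel : ∀ {x y} → fromℕ b * x ≤ fromℕ b * y → x ≤ y
      cancel = *-cancelˡ-≤-pos (fromℕ b) {{fromℕ-pos (ℕ.<-trans 1≤a a<b)}}

    0≤C : 0ℚ ≤ Cθ
    0≤C = subst (_≤ Cθ) (*-zeroʳ c) (*-monoˡ-≤-0≤ (<⇒≤ (positive⁻¹ c {{normalize-pos 1 (b ∸ a)}}))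
            (subst (0ℚ ≤_) (∑-range q) (∑ℚ.∑-nonneg (range q) (λ {i} _ → 0≤recip i))))
      where
      c : ℚ
      c = ℤ.+ 1 / (b ∸ a)

    γ : ℚ
    γ = (ℤ.+ 1 / (b ∸ a)) * gap a b 1≤a a<b

    γ>0 : Positive γ
    γ>0 = pos*pos⇒pos (ℤ.+ 1 / (b ∸ a)) {{normalize-pos 1 (b ∸ a)}} (gap a b 1≤a a<b) {{gap-pos a b 1≤a a<b}}

    module Structure (gcd≡1 : gcd a b ≡ 1) {n : ℕ} (F : Family n) (intersecting : IsIntersecting θ F) where

      private
        module I = IsIntersecting intersecting
        module E = Extraction a b 1≤a a<b (coprime-sym (gcd≡1⇒coprime gcd≡1)) F I.nonempty
          (λ A∈ B∈ A≢B → Sum.map θ-multiple⇒ θ-multiple⇒ (I.intersecting A∈ B∈ A≢B))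
          (width F) size≤maxSize
        module W = Weighing a b 1≤a a<b (unique E.F*) E.M E.member-sizes E.outside-injective E.outside-ratio

      F* : Family n
      F* = E.F*

      F*-isBouquet : IsBouquet F*
      F*-isBouquet = E.isBouquet

      F*⊆F : F* ⊆ᶠ F
      F*⊆F = E.F*⊆F

      uncovered : Subset n
      uncovered = W.uncovered

      covers : ∀ {x} → x ∉ uncovered → ∀ i → 1 ℕ.≤ i → i ℕ.≤ q → ∃[ A ] A ∈ᶠ F* × size A ≡ i ℕ.* b × x ∈ A
      covers = W.∉-uncovered⁻

      card-∖≤ : card (F ∖ F*) ℕ.≤ exceptions F
      card-∖≤ = E.F∖F*-small

      card≤ : card F ℕ.≤ card F* ℕ.+ exceptions F
      card≤ = ℕ.≤-trans (ℕ.≤-reflexive (sym (length-filter+ (_∈? members F*) (members F))))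
        (ℕ.+-mono-≤ (length-unique-⊆ (unique-filter (_∈? members F*) (unique F))
          λ A∈ → proj₂ (∈-filter⁻ (_∈? members F*) {xs = members F} A∈)) card-∖≤)
        where open DecMembership (_≟ˢ_ {n}) using (_∈?_)

      weighted : fromℕ (card F*) + γ * fromℕ (size uncovered) ≤ Cθ * fromℕ n
      weighted = begin
        fromℕ (card F*) + γ * fromℕ (size uncovered)
          ≡⟨ cong₂ _+_ unit (*-assoc c g _) ⟩
        c * (fromℕ (b ∸ a) * fromℕ (card F*)) + c * (g * fromℕ (size uncovered))
          ≡⟨ sym (*-distribˡ-+ c _ _) ⟩
        c * (fromℕ (b ∸ a) * fromℕ (card F*) + g * fromℕ (size uncovered))
          ≤⟨ *-monoˡ-≤-0≤ (<⇒≤ (positive⁻¹ c {{normalize-pos 1 (b ∸ a)}})) W.weighing ⟩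
        c * (harmonic q * fromℕ n)
          ≡⟨ sym (*-assoc c (harmonic q) _) ⟩
        Cθ * fromℕ n
          ∎
        where
        open ≤-Reasoning
        c g : ℚ
        c = ℤ.+ 1 / (b ∸ a)
        g = gap a b 1≤a a<b
        unit : fromℕ (card F*) ≡ c * (fromℕ (b ∸ a) * fromℕ (card F*))
        unit = trans (sym (*-identityˡ _)) (trans (cong (_* fromℕ (card F*)) (sym (/-*-cancel (ℤ.+ 1) (b ∸ a)))) (*-assoc c _ _))

      card-upper : fromℕ (card F) + γ * fromℕ (size uncovered) ≤ Cθ * fromℕ n + fromℕ (exceptions F)
      card-upper = begin
        fromℕ (card F) + γ * u                            ≤⟨ +-monoˡ-≤ (γ * u) (fromℕ-mono-≤ card≤) ⟩
        fromℕ (card F* ℕ.+ exceptions F) + γ * u          ≡⟨ cong (_+ γ * u) (fromℕ-+ (card F*) (exceptions F)) ⟩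
        fromℕ (card F*) + e + γ * u                       ≡⟨ xy∙z≈xz∙y (fromℕ (card F*)) e (γ * u) ⟩
        fromℕ (card F*) + γ * u + e                       ≤⟨ +-monoˡ-≤ e weighted ⟩
        Cθ * fromℕ n + e                                  ∎
        where
        open ≤-Reasoning
        u = fromℕ (size uncovered)
        e = fromℕ (exceptions F)

      0≤γu : 0ℚ ≤ γ * fromℕ (size uncovered)
      0≤γu = subst (_≤ γ * fromℕ (size uncovered)) (*-zeroʳ γ)
        (*-monoˡ-≤-0≤ (<⇒≤ (positive⁻¹ γ {{γ>0}})) (0≤fromℕ (size uncovered)))

    module _ (gcd≡1 : gcd a b ≡ 1) {w : ℕ → ℝ} (w-small : IsO[∛n] w) {F : ∀ n → Family n}
      (bounded : ∀ n → IsBounded (w n) (F n)) (intersecting : ∀ n → IsIntersecting θ (F n)) where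

      private
        module S n = Structure gcd≡1 (F n) (intersecting n)

        exceptions-small : IsO[n] (λ n → exceptions (F n))
        exceptions-small = negligible⇒IsO (exceptions-negligible {w} {F} w-small bounded)

      upper-bound : ∃[ δ ] IsO[1] δ × (∀ n → fromℕ (card (F n)) ≤ (Cθ + δ n) * fromℕ n)
      upper-bound =
        let δ , δ-small , δ-quotient = IsO-quotient (λ n → fromℕ (exceptions (F n)))
              (cong fromℕ (exceptions-zero (F 0))) (λ n → 0≤fromℕ (exceptions (F n))) exceptions-small
        in δ , δ-small , λ n → begin
          fromℕ (card (F n))                                       ≤⟨ p≤p+q _ (S.0≤γu n) ⟩
          fromℕ (card (F n)) + γ * fromℕ (size (S.uncovered n))    ≤⟨ S.card-upper n ⟩
          Cθ * fromℕ n + fromℕ (exceptions (F n))                  ≡⟨ cong (Cθ * fromℕ n +_) (sym (δ-quotient n)) ⟩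
          Cθ * fromℕ n + δ n * fromℕ n                             ≡⟨ sym (*-distribʳ-+ (fromℕ n) Cθ (δ n)) ⟩
          (Cθ + δ n) * fromℕ n                                     ∎
        where open ≤-Reasoning

      module _ {δ : ℕ → ℚ} (δ-small : IsO[1] δ) (tight : ∀ n → fromℕ (card (F n)) ≡ (Cθ + δ n) * fromℕ n) where

        -- Tightness turns `card-upper` into a bound by -δ(n) n plus the exceptions. Since δ(n) may
        -- have either sign, -δ(n) is replaced by its absolute value.
        γ*uncovered≤ : ∀ n → γ * fromℕ (size (S.uncovered n)) ≤ ∣ δ n ∣ * fromℕ n + fromℕ (exceptions (F n))
        γ*uncovered≤ n = +-cancelʳ-≤ (Cθ * fromℕ n + δ n * fromℕ n) (begin
          u + (Cθ * N + δ n * N)                     ≡⟨ +-comm u _ ⟩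
          (Cθ * N + δ n * N) + u                     ≡⟨ cong (_+ u) (sym (trans (tight n) (*-distribʳ-+ N Cθ (δ n)))) ⟩
          fromℕ (card (F n)) + u                     ≤⟨ S.card-upper n ⟩
          Cθ * N + e                                 ≤⟨ +-monoʳ-≤ (Cθ * N) absorb ⟩
          Cθ * N + (δ n * N + (∣ δ n ∣ * N + e))     ≡⟨ sym (+-assoc (Cθ * N) _ _) ⟩
          (Cθ * N + δ n * N) + (∣ δ n ∣ * N + e)     ≡⟨ +-comm (Cθ * N + δ n * N) _ ⟩
          (∣ δ n ∣ * N + e) + (Cθ * N + δ n * N)     ∎)
          where
          open ≤-Reasoning
          N = fromℕ n
          u = γ * fromℕ (size (S.uncovered n))
          e = fromℕ (exceptions (F n))
          0≤p+∣p∣ : ∀ p → 0ℚ ≤ p + ∣ p ∣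
          0≤p+∣p∣ p = subst (0ℚ ≤_) (+-comm ∣ p ∣ p) (subst (_≤ ∣ p ∣ + p) (+-inverseˡ p)
            (+-monoˡ-≤ p (subst (- p ≤_) (∣-p∣≡∣p∣ p) (p≤∣p∣ (- p)))))
            where
            p≤∣p∣ : ∀ p → p ≤ ∣ p ∣
            p≤∣p∣ p = Sum.[ (λ 0≤p → ≤-reflexive (sym (0≤p⇒∣p∣≡p 0≤p))) , (λ p≤0 → ≤-trans p≤0 (0≤∣p∣ p)) ]′ (≤-total 0ℚ p)
          absorb : e ≤ δ n * N + (∣ δ n ∣ * N + e)
          absorb = begin
            e                                    ≡⟨ sym (+-identityˡ e) ⟩
            0ℚ + e                               ≡⟨ cong (_+ e) (sym (*-zeroˡ N)) ⟩
            0ℚ * N + e                           ≤⟨ +-monoˡ-≤ e (*-monoʳ-≤-nonNeg N {{fromℕ-nonNeg {n}}} (0≤p+∣p∣ (δ n))) ⟩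
            (δ n + ∣ δ n ∣) * N + e              ≡⟨ cong (_+ e) (*-distribʳ-+ N (δ n) ∣ δ n ∣) ⟩
            δ n * N + ∣ δ n ∣ * N + e            ≡⟨ +-assoc (δ n * N) _ e ⟩
            δ n * N + (∣ δ n ∣ * N + e)          ∎

        uncovered-small : IsO[n] (λ n → size (S.uncovered n))
        uncovered-small ε = let N₁ , bound₁ = δ-small ε′ {{ε′>0}} ; N₂ , bound₂ = exceptions-small ε′ {{ε′>0}} in
          N₁ ℕ.⊔ N₂ , λ n N≤n → *-cancelˡ-≤-pos γ {{γ>0}} (begin
            γ * fromℕ (size (S.uncovered n))                     ≤⟨ γ*uncovered≤ n ⟩
            ∣ δ n ∣ * fromℕ n + fromℕ (exceptions (F n))         ≤⟨ +-mono-≤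
              (*-monoʳ-≤-nonNeg (fromℕ n) {{fromℕ-nonNeg {n}}} (bound₁ n (ℕ.≤-trans (ℕ.m≤m⊔n N₁ N₂) N≤n)))
              (bound₂ n (ℕ.≤-trans (ℕ.m≤n⊔m N₁ N₂) N≤n)) ⟩
            ε′ * fromℕ n + ε′ * fromℕ n                          ≡⟨ sym (*-distribʳ-+ (fromℕ n) ε′ ε′) ⟩
            (ε′ + ε′) * fromℕ n                                  ≡⟨ cong (_* fromℕ n) halves ⟩
            γ * ε * fromℕ n                                      ≡⟨ *-assoc γ ε _ ⟩
            γ * (ε * fromℕ n)                                    ∎)
          where
          open ≤-Reasoning
          ε′ : ℚ
          -- The two error terms, |δ(n)| n and the exceptions, share the budget γ ε n equally.
          ε′ = γ * ε * ½
          ε′>0 : Positive ε′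
          ε′>0 = pos*pos⇒pos (γ * ε) {{pos*pos⇒pos γ {{γ>0}} ε}} ½
          halves : ε′ + ε′ ≡ γ * ε
          halves = trans (sym (*-distribˡ-+ (γ * ε) ½ ½)) (*-identityʳ _)

        stability : Σ[ F* ∈ (∀ n → Family n) ]
          (∀ n → IsBouquet (F* n) × F* n ⊆ᶠ F n) ×
          IsO[n] (λ n → card (F n ∖ F* n)) ×
          (Σ[ E ∈ (∀ n → Subset n) ] IsO[n] (λ n → size (E n)) ×
           (∀ n (x : Fin n) → x ∉ E n → ∀ i → 1 ℕ.≤ i → i ℕ.≤ q →
            ∃[ A ] A ∈ᶠ F* n × size A ≡ i ℕ.* b × x ∈ A))
        stability = S.F* , (λ n → S.F*-isBouquet n , S.F*⊆F n) , few-removed ,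
                    S.uncovered , uncovered-small , λ n x x∉ → S.covers n x∉
          where
          few-removed : IsO[n] (λ n → card (F n ∖ S.F* n))
          few-removed ε = let N , bound = exceptions-small ε in
            N , λ n N≤n → ≤-trans (fromℕ-mono-≤ (S.card-∖≤ n)) (bound n N≤n)

-- Sharpness by tiling with finite blocks of petals

module Constructions where

  open import Defs
  open Rationals
  open Asymptotics
  open import Data.Nat.Base as ℕ using (ℕ; zero; suc; z≤n; s≤s; z<s; _∸_; _≡ᵇ_)
  import Data.Nat.Properties as ℕ
  import Data.Nat.DivMod as ℕ
  open import Data.Nat.GCD using (gcd; gcd-greatest)
  open import Data.Nat.Divisibility using (_∣_; divides; ∣-refl; ∣1⇒≡1)
  open import Data.Nat.Tactic.RingSolver using (solve-∀)
  import Data.Integer.Base as ℤ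
  open import Data.Rational.Base
  open import Data.Rational.Properties hiding (_≟_)
  open import Data.Bool.Base using (true; false; _∧_)
  open import Data.Bool.Properties using () renaming (_≟_ to _≟ᵇ_)
  open import Data.Fin.Base using (toℕ)
  open import Data.Fin.Subset using (Subset; _∩_; ⊥; ⊤; Nonempty) renaming (∣_∣ to size)
  open import Data.Fin.Subset.Properties using (∣⊥∣≡0; ∣⊤∣≡n; ∩-idem; ∩-zeroˡ; ∩-zeroʳ; nonempty?; Empty-unique; ∩-comm)
  open import Data.Vec.Base as Vec using ([]; _∷_; tabulate) renaming (_++_ to _++ᵛ_)
  open import Data.Vec.Properties using (≡-dec; ++-injectiveˡ; ++-injectiveʳ; zipWith-++)
  import Data.Product.Properties as Product
  open import Data.List.Base using (List; []; _∷_; _++_; length; map; upTo)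
  open import Data.List.Properties using (length-map; length-++)
  open import Data.List.Membership.Propositional using (_∈_)
  open import Data.List.Membership.Propositional.Properties using (∈-map⁻; ∈-++⁻)
  open import Data.List.Relation.Unary.Any using (here; there)
  open import Data.List.Relation.Unary.All as All using (All; []; _∷_; all?)
  import Data.List.Relation.Unary.All.Properties as All
  open import Data.List.Relation.Unary.AllPairs as AllPairs using (AllPairs; []; _∷_; allPairs?)
  import Data.List.Relation.Unary.AllPairs.Properties as AllPairs
  open import Data.Product.Base using (Σ-syntax; ∃-syntax; _×_; _,_; proj₁; proj₂)
  open import Data.Sum.Base as Sum using (_⊎_; inj₁; inj₂)
  open import Function.Base using (_∘_)
  open import Relation.Nullary using (Dec; yes; no; contradiction; _×-dec_; _⊎-dec_; ¬?)
  open import Relation.Nullary.Decidable using (toWitness)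
  open import Relation.Binary.Definitions using (Symmetric)
  open import Relation.Binary.PropositionalEquality

  size-++ : ∀ {m n} (p : Subset m) (q : Subset n) → size (p ++ᵛ q) ≡ size p ℕ.+ size q
  size-++ []          q = refl
  size-++ (true  ∷ p) q = cong suc (size-++ p q)
  size-++ (false ∷ p) q = size-++ p q

  size-∩-++ : ∀ {m n} (p p′ : Subset m) (q q′ : Subset n) →
              size ((p ++ᵛ q) ∩ (p′ ++ᵛ q′)) ≡ size (p ∩ p′) ℕ.+ size (q ∩ q′)
  size-∩-++ p p′ q q′ = trans (cong size (zipWith-++ _∧_ p q p′ q′)) (size-++ (p ∩ p′) (q ∩ q′))

  size>0⇒nonempty : ∀ {n} {A : Subset n} → 0 ℕ.< size A → Nonempty A
  size>0⇒nonempty {n} {A} 0<|A| with nonempty? A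
  ... | yes ne   = ne
  ... | no empty = contradiction (trans (cong size (Empty-unique empty)) (∣⊥∣≡0 n)) (ℕ.<⇒≢ 0<|A| ∘ sym)

  allPairs-lookup : ∀ {A : Set} {R : A → A → Set} {xs : List A} → Symmetric R → AllPairs R xs →
                    ∀ {x y} → x ∈ xs → y ∈ xs → x ≢ y → R x y
  allPairs-lookup sym-R (_ ∷ _)   (here refl) (here refl) x≢y = contradiction refl x≢y
  allPairs-lookup sym-R (Rx ∷ _)  (here refl) (there y∈)  _   = All.lookup Rx y∈
  allPairs-lookup sym-R (Rx ∷ _)  (there x∈)  (here refl) _   = sym-R (All.lookup Rx x∈)
  allPairs-lookup sym-R (_ ∷ Rxs) (there x∈)  (there y∈)  x≢y = allPairs-lookup sym-R Rxs x∈ y∈ x≢y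

  module _ (a b : ℕ) where

    θ-Related : ℕ → ℕ → ℕ → Set
    θ-Related s k l = b ℕ.* s ≡ a ℕ.* k ⊎ b ℕ.* s ≡ a ℕ.* l

    θ-related? : ∀ s k l → Dec (θ-Related s k l)
    θ-related? s k l = (b ℕ.* s ℕ.≟ a ℕ.* k) ⊎-dec (b ℕ.* s ℕ.≟ a ℕ.* l)

    -- A core together with a petal placed outside of it.
    Cell : ℕ → ℕ → Set
    Cell c m = Subset c × Subset m

    module _ {c m : ℕ} where

      cellSize : Cell c m → ℕ
      cellSize (K , P) = size K ℕ.+ size P

      SameBlock : Cell c m → Cell c m → Set
      SameBlock X@(K , P) Y@(K′ , P′) = X ≢ Y × θ-Related (size (K ∩ K′) ℕ.+ size (P ∩ P′)) (cellSize X) (cellSize Y)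

      -- Petals placed in different blocks are disjoint, so only the cores, which all share the same
      -- c points, contribute to the intersection.
      OtherBlock : Cell c m → Cell c m → Set
      OtherBlock X@(K , P) Y@(K′ , P′) = θ-Related (size (K ∩ K′)) (cellSize X) (cellSize Y)

      sameBlock? : ∀ X Y → Dec (SameBlock X Y)
      sameBlock? X Y = ¬? (Product.≡-dec (≡-dec _≟ᵇ_) (≡-dec _≟ᵇ_) X Y) ×-dec θ-related? _ _ _

      otherBlock? : ∀ X Y → Dec (OtherBlock X Y)
      otherBlock? X Y = θ-related? _ _ _

    -- The condition `other-block` also compares each cell with itself, because every cell recurs in
    -- all blocks; nonempty petals keep these copies distinct. Distinctness within a block is part
    -- of `SameBlock`, so uniqueness of the tiled list comes along with the intersection condition.
    record Template (c B : ℕ) (cells : List (Cell c B)) (S : ℕ) : Set where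
      field
        same-block  : AllPairs SameBlock cells
        other-block : All (λ X → All (OtherBlock X) cells) cells
        petals      : All (λ X → 0 ℕ.< size (proj₂ X)) cells
        sizes       : All (λ X → cellSize X ℕ.≤ S) cells

    module Tiling {c B : ℕ} {cells : List (Cell c B)} {S : ℕ} (template : Template c B cells S) where
      open Template template

      padʳ : ∀ {m} r → Cell c m → Cell c (m ℕ.+ r)
      padʳ r (K , P) = K , P ++ᵛ ⊥

      padˡ : ∀ {m} → Cell c m → Cell c (B ℕ.+ m)
      padˡ (K , Q) = K , ⊥ ++ᵛ Q

      tiles : ∀ t → List (Cell c (t ℕ.* B))
      tiles zero    = []
      tiles (suc t) = map (padʳ (t ℕ.* B)) cells ++ map padˡ (tiles t)

      length-tiles : ∀ t → length (tiles t) ≡ t ℕ.* length cells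
      length-tiles zero    = refl
      length-tiles (suc t) = trans (length-++ (map (padʳ (t ℕ.* B)) cells))
        (cong₂ ℕ._+_ (length-map _ cells) (trans (length-map _ (tiles t)) (length-tiles t)))

      -- All that padding preserves and all that the relation between different blocks depends on:
      -- the core and the size of the petal.
      Copy : ∀ {m} → Cell c m → Set
      Copy (K , Q) = ∃[ P ] (K , P) ∈ cells × size Q ≡ size P

      size-padʳ : ∀ {m} r (P : Subset m) → size (P ++ᵛ ⊥ {r}) ≡ size P
      size-padʳ r P = trans (size-++ P ⊥) (trans (cong (size P ℕ.+_) (∣⊥∣≡0 r)) (ℕ.+-identityʳ _))

      size-padˡ : ∀ {m} (Q : Subset m) → size (⊥ {B} ++ᵛ Q) ≡ size Q
      size-padˡ Q = trans (size-++ (⊥ {B}) Q) (cong (ℕ._+ size Q) (∣⊥∣≡0 B))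

      copy : ∀ t {X} → X ∈ tiles t → Copy X
      copy (suc t) X∈ with ∈-++⁻ (map (padʳ (t ℕ.* B)) cells) X∈
      ... | inj₁ X∈ˡ with ∈-map⁻ (padʳ (t ℕ.* B)) X∈ˡ
      ...   | (K , P) , Y∈ , refl = P , Y∈ , size-padʳ (t ℕ.* B) P
      copy (suc t) X∈ | inj₂ X∈ʳ with ∈-map⁻ padˡ X∈ʳ
      ...   | (K , Q) , Y∈ , refl = let P , KP∈ , eq = copy t Y∈ in P , KP∈ , trans (size-padˡ Q) eq

      θ-cong : ∀ {s s′ k k′ l l′} → s′ ≡ s → k′ ≡ k → l′ ≡ l → θ-Related s k l → θ-Related s′ k′ l′
      θ-cong refl refl refl h = h

      padʳ-sameBlock : ∀ {m} r {X Y : Cell c m} → SameBlock X Y → SameBlock (padʳ r X) (padʳ r Y)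
      padʳ-sameBlock r {K , P} {K′ , P′} (X≢Y , h) =
        (λ eq → X≢Y (cong₂ _,_ (cong proj₁ eq) (++-injectiveˡ P P′ (cong proj₂ eq)))) ,
        θ-cong (cong (size (K ∩ K′) ℕ.+_) (trans (size-∩-++ P P′ ⊥ ⊥)
                 (trans (cong (size (P ∩ P′) ℕ.+_) (trans (cong size (∩-idem (⊥ {r}))) (∣⊥∣≡0 r))) (ℕ.+-identityʳ _))))
               (cong (size K ℕ.+_) (size-padʳ r P)) (cong (size K′ ℕ.+_) (size-padʳ r P′)) h

      padˡ-sameBlock : ∀ {m} {X Y : Cell c m} → SameBlock X Y → SameBlock (padˡ X) (padˡ Y)
      padˡ-sameBlock {X = K , Q} {K′ , Q′} (X≢Y , h) =
        (λ eq → X≢Y (cong₂ _,_ (cong proj₁ eq) (++-injectiveʳ ⊥ ⊥ (cong proj₂ eq)))) ,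
        θ-cong (cong (size (K ∩ K′) ℕ.+_) (trans (size-∩-++ (⊥ {B}) ⊥ Q Q′)
                 (cong (ℕ._+ size (Q ∩ Q′)) (trans (cong size (∩-idem (⊥ {B}))) (∣⊥∣≡0 B)))))
               (cong (size K ℕ.+_) (size-padˡ Q)) (cong (size K′ ℕ.+_) (size-padˡ Q′)) h

      -- The padded petals are disjoint, so the condition reduces to `other-block` for the cells
      -- being copied. Distinctness is seen in the first block, where one side has a nonempty petal
      -- and the other nothing.
      cross-sameBlock : ∀ t {X Y} → X ∈ cells → Y ∈ tiles t → SameBlock (padʳ (t ℕ.* B) X) (padˡ Y)
      cross-sameBlock t {K , P} {K′ , Q} X∈ Y∈ =
        (λ eq → ℕ.<⇒≢ (All.lookup petals X∈) (sym (trans (cong size (++-injectiveˡ P ⊥ (cong proj₂ eq))) (∣⊥∣≡0 B)))) ,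
        θ-cong (trans (cong (size (K ∩ K′) ℕ.+_) (trans (size-∩-++ P ⊥ ⊥ Q)
                 (cong₂ ℕ._+_ (trans (cong size (∩-zeroʳ P)) (∣⊥∣≡0 B)) (trans (cong size (∩-zeroˡ Q)) (∣⊥∣≡0 (t ℕ.* B))))))
                 (ℕ.+-identityʳ _))
               (cong (size K ℕ.+_) (size-padʳ (t ℕ.* B) P)) (cong (size K′ ℕ.+_) (trans (size-padˡ Q) |Q|≡|P′|))
               (All.lookup (All.lookup other-block X∈) Y′∈)
        where
        Y′∈ = proj₁ (proj₂ (copy t Y∈))
        |Q|≡|P′| = proj₂ (proj₂ (copy t Y∈))

      tiles-sameBlock : ∀ t → AllPairs SameBlock (tiles t)
      tiles-sameBlock zero    = []
      tiles-sameBlock (suc t) = AllPairs.++⁺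
        (AllPairs.map⁺ (AllPairs.map (padʳ-sameBlock (t ℕ.* B)) same-block))
        (AllPairs.map⁺ (AllPairs.map padˡ-sameBlock (tiles-sameBlock t)))
        (All.map⁺ (All.tabulate λ X∈ → All.map⁺ (All.tabulate λ Y∈ → cross-sameBlock t X∈ Y∈)))

      flatten : ∀ {m} → Cell c m → Subset (c ℕ.+ m)
      flatten (K , P) = K ++ᵛ P

      FlatRelated : ∀ {n} → Subset n → Subset n → Set
      FlatRelated A A′ = A ≢ A′ × θ-Related (size (A ∩ A′)) (size A) (size A′)

      flatten-related : ∀ {m} {X Y : Cell c m} → SameBlock X Y → FlatRelated (flatten X) (flatten Y)
      flatten-related {X = K , P} {K′ , P′} (X≢Y , h) =
        (λ eq → X≢Y (cong₂ _,_ (++-injectiveˡ K K′ eq) (++-injectiveʳ K K′ eq))) ,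
        θ-cong (size-∩-++ K K′ P P′) (size-++ K P) (size-++ K′ P′) h

      sets : ∀ t r → List (Subset (c ℕ.+ (t ℕ.* B ℕ.+ r)))
      sets t r = map flatten (map (padʳ r) (tiles t))

      sets-related : ∀ t r → AllPairs FlatRelated (sets t r)
      sets-related t r = AllPairs.map⁺ (AllPairs.map (λ {X} {Y} → flatten-related {X = X} {Y})
        (AllPairs.map⁺ (AllPairs.map (padʳ-sameBlock r) (tiles-sameBlock t))))

      record Instance (n : ℕ) : Set where
        field
          F            : Family n
          set-nonempty : ∀ {A} → A ∈ᶠ F → Nonempty A
          related      : ∀ {A A′} → A ∈ᶠ F → A′ ∈ᶠ F → A ≢ A′ → θ-Related (size (A ∩ A′)) (size A) (size A′)
          bounded      : ∀ {A} → A ∈ᶠ F → size A ℕ.≤ S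
          dense        : length cells ℕ.* n ℕ.≤ B ℕ.* card F ℕ.+ length cells ℕ.* (n ℕ.⊓ (c ℕ.+ B))

      tiled : ∀ t r → r ℕ.≤ B → Instance (c ℕ.+ (t ℕ.* B ℕ.+ r))
      tiled t r r≤B = record
        { F            = family (sets t r) (AllPairs.map proj₁ (sets-related t r))
        ; set-nonempty = λ A∈ → let (K , P) , X∈ , eq = origin A∈ in
            size>0⇒nonempty (subst (0 ℕ.<_) (sym eq) (ℕ.<-≤-trans (All.lookup petals X∈) (ℕ.m≤n+m (size P) (size K))))
        ; related      = allPairs-lookup {R = Related} (λ {A} {A′} → related-sym {A} {A′}) (AllPairs.map proj₂ (sets-related t r))
        ; bounded      = λ A∈ → let X , X∈ , eq = origin A∈ in subst (ℕ._≤ S) (sym eq) (All.lookup sizes X∈)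
        ; dense        = dense
        }
        where
        n = c ℕ.+ (t ℕ.* B ℕ.+ r)
        u = length cells
        Related : Subset n → Subset n → Set
        Related A A′ = θ-Related (size (A ∩ A′)) (size A) (size A′)
        related-sym : Symmetric Related
        related-sym {A} {A′} h = subst (λ s → θ-Related s (size A′) (size A)) (cong size (∩-comm A A′)) (Sum.swap h)
        origin : ∀ {A} → A ∈ sets t r → ∃[ X ] X ∈ cells × size A ≡ cellSize X
        origin A∈ with ∈-map⁻ flatten A∈
        ... | X , X∈ , refl with ∈-map⁻ (padʳ r) X∈
        ...   | (K , Q) , Y∈ , refl = let P , KP∈ , eq = copy t Y∈ in
          (K , P) , KP∈ , trans (size-++ K (Q ++ᵛ ⊥)) (cong (size K ℕ.+_) (trans (size-padʳ r Q) eq))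
        dense : u ℕ.* n ℕ.≤ B ℕ.* length (sets t r) ℕ.+ u ℕ.* (n ℕ.⊓ (c ℕ.+ B))
        dense = Sum.[ (λ n≤ → ℕ.≤-trans (ℕ.≤-reflexive (cong (u ℕ.*_) (sym (ℕ.m≤n⇒m⊓n≡m n≤)))) (ℕ.m≤n+m _ _))
                    , (λ ≤n → ℕ.≤-trans full (ℕ.≤-reflexive (cong (λ s → B ℕ.* length (sets t r) ℕ.+ u ℕ.* s) (sym (ℕ.m≥n⇒m⊓n≡n ≤n))))) ]′
                (ℕ.≤-total n (c ℕ.+ B))
          where
          count : length (sets t r) ≡ t ℕ.* u
          count = trans (length-map flatten (map (padʳ r) (tiles t))) (trans (length-map (padʳ r) (tiles t)) (length-tiles t))
          regroup : ∀ u c t B s → u ℕ.* (c ℕ.+ (t ℕ.* B ℕ.+ s)) ≡ B ℕ.* (t ℕ.* u) ℕ.+ u ℕ.* (c ℕ.+ s)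
          regroup = solve-∀
          full : u ℕ.* n ℕ.≤ B ℕ.* length (sets t r) ℕ.+ u ℕ.* (c ℕ.+ B)
          full = begin
            u ℕ.* (c ℕ.+ (t ℕ.* B ℕ.+ r))                          ≤⟨ ℕ.*-monoʳ-≤ u (ℕ.+-monoʳ-≤ c (ℕ.+-monoʳ-≤ (t ℕ.* B) r≤B)) ⟩
            u ℕ.* (c ℕ.+ (t ℕ.* B ℕ.+ B))                          ≡⟨ regroup u c t B B ⟩
            B ℕ.* (t ℕ.* u) ℕ.+ u ℕ.* (c ℕ.+ B)                    ≡⟨ cong (λ s → B ℕ.* s ℕ.+ u ℕ.* (c ℕ.+ B)) (sym count) ⟩
            B ℕ.* length (sets t r) ℕ.+ u ℕ.* (c ℕ.+ B)            ∎
            where open ℕ.≤-Reasoning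

      tiling : .{{_ : ℕ.NonZero B}} → ∀ n → Instance n
      tiling n with c ℕ.≤? n
      ... | yes c≤n = subst Instance split (tiled ((n ∸ c) ℕ./ B) ((n ∸ c) ℕ.% B) (ℕ.<⇒≤ (ℕ.m%n<n (n ∸ c) B)))
        where
        split : c ℕ.+ ((n ∸ c) ℕ./ B ℕ.* B ℕ.+ (n ∸ c) ℕ.% B) ≡ n
        split = trans (cong (c ℕ.+_) (trans (ℕ.+-comm _ ((n ∸ c) ℕ.% B)) (sym (ℕ.m≡m%n+[m/n]*n (n ∸ c) B)))) (ℕ.m+[n∸m]≡n c≤n)
      -- With too few points for the core, the empty family suffices: the permitted deficit is then
      -- the whole left side.
      ... | no  c≰n = record
        { F            = family [] []
        ; set-nonempty = λ ()
        ; related      = λ ()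
        ; bounded      = λ ()
        ; dense        = ℕ.≤-trans (ℕ.≤-reflexive (cong (length cells ℕ.*_) (sym (ℕ.m≤n⇒m⊓n≡m
                           (ℕ.≤-trans (ℕ.<⇒≤ (ℕ.≰⇒> c≰n)) (ℕ.m≤m+n c B)))))) (ℕ.m≤n+m _ (B ℕ.* 0))
        }

  -- A rational below s, divided by ε, falls below r = s/ε, and r³ < n as soon as n exceeds a
  -- natural number above r³. That number is found by applying `archimedean` to 1/r³.
  constant-isO : ∀ s → 0 ℕ.< s → IsO[∛n] (λ _ → fromℚ (fromℕ s))
  constant-isO s 0<s ε = let N , r³≤N = unbounded in suc N , λ n N<n {q} q<s →
    r , *-monoʳ-<-pos (1/ ε) q<s , ≤-<-trans r³≤N (fromℕ-mono-< N<n)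
    where
    instance
      ε≢0 : NonZero ε
      ε≢0 = pos⇒nonZero ε
      1/ε>0 : Positive (1/ ε)
      1/ε>0 = 1/pos⇒pos ε
    r : ℚ
    r = 1/ ε * fromℕ s
    r>0 : Positive r
    r>0 = pos*pos⇒pos (1/ ε) (fromℕ s) {{fromℕ-pos 0<s}}
    instance
      r³>0 : Positive (cube r)
      r³>0 = pos*pos⇒pos (r * r) {{pos*pos⇒pos r {{r>0}} r {{r>0}}}} r {{r>0}}
      r³≢0 : NonZero (cube r)
      r³≢0 = pos⇒nonZero (cube r)
    unbounded : ∃[ N ] cube r ≤ fromℕ N
    unbounded = let N , 1≤ = archimedean (1/ cube r) {{1/pos⇒pos (cube r)}} in N ,
      subst₂ _≤_ (*-identityʳ (cube r))
        (trans (sym (*-assoc (cube r) (1/ cube r) (fromℕ N)))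
          (trans (cong (_* fromℕ N) (*-inverseʳ (cube r))) (*-identityˡ (fromℕ N))))
        (*-monoˡ-≤-nonNeg (cube r) {{pos⇒nonNeg (cube r)}} 1≤)

  module _ (a b : ℕ) (1≤a : 1 ℕ.≤ a) (a<b : a ℕ.< b) where

    private
      θ  = ratio a b 1≤a a<b
      Cθ = C a b 1≤a a<b

    Sharp : Set₁
    Sharp =
      Σ[ w ∈ (ℕ → ℝ) ] (∀ n → fromℚ 0ℚ <ᵣ w n) × IsO[∛n] w ×
      (Σ[ F ∈ (∀ n → Family n) ] (∀ n → IsBounded (w n) (F n)) × (∀ n → IsIntersecting θ (F n)) ×
      (∃[ δ ] IsO[1] δ × (∀ n → (Cθ - δ n) * fromℕ n ≤ fromℕ (card (F n)))))

    -- The density hypothesis says that one block carries exactly Cθ sets per point, so only the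
    -- core and an incomplete last block cost anything. The sets have bounded size, hence a constant
    -- w is enough; writing it as a successor makes it positive.
    template⇒sharp : ∀ {c B cells s} → Template a b c B cells (suc s) → 0 ℕ.< B →
                     Cθ * fromℕ B ≡ fromℕ (length cells) → Sharp
    template⇒sharp {c} {B} {cells} {s} template 0<B density =
      (λ _ → fromℚ (fromℕ (suc s))) ,
      (λ _ → ½ , positive⁻¹ ½ , <-≤-trans ½<1 (fromℕ-mono-≤ {1} {suc s} (s≤s z≤n))) ,
      constant-isO (suc s) z<s ,
      F , (λ n {A} A∈ q<|A| → <-≤-trans q<|A| (fromℕ-mono-≤ (Instance.bounded (tiling n) A∈))) ,
      (λ n → record
        { nonempty     = Instance.set-nonempty (tiling n)
        ; intersecting = λ A∈ B∈ A≢B → Sum.map (θ-multiple⇐ a b 1≤a a<b) (θ-multiple⇐ a b 1≤a a<b)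
                           (Instance.related (tiling n) A∈ B∈ A≢B) }) ,
      δ , δ-small , lower
      where
      open Tiling a b template
      instance
        B≢0 : ℕ.NonZero B
        B≢0 = ℕ.>-nonZero 0<B
      ½<1 : ½ < 1ℚ
      ½<1 = toWitness {a? = ½ <? 1ℚ} _
      F : ∀ n → Family n
      F n = Instance.F (tiling n)
      deficit : ℕ → ℚ
      deficit n = Cθ * fromℕ (n ℕ.⊓ (c ℕ.+ B))
      deficit-small : ∀ ε .{{_ : Positive ε}} → ∃[ N ] (∀ n → N ℕ.≤ n → deficit n ≤ ε * fromℕ n)
      deficit-small ε = let m , 1≤εm = archimedean ε in m ℕ.* K , λ n mK≤n → begin
        Cθ * fromℕ (n ℕ.⊓ (c ℕ.+ B))      ≤⟨ *-monoˡ-≤-0≤ (0≤C a b 1≤a a<b) (fromℕ-mono-≤ (ℕ.m⊓n≤n n _)) ⟩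
        Cθ * fromℕ (c ℕ.+ B)              ≤⟨ C*[c+B]≤ ⟩
        fromℕ K                           ≡⟨ sym (*-identityˡ _) ⟩
        1ℚ * fromℕ K                      ≤⟨ *-monoʳ-≤-nonNeg (fromℕ K) {{fromℕ-nonNeg {K}}} 1≤εm ⟩
        ε * fromℕ m * fromℕ K             ≡⟨ trans (*-assoc ε _ _) (cong (ε *_) (sym (fromℕ-* m K))) ⟩
        ε * fromℕ (m ℕ.* K)               ≤⟨ *-monoˡ-≤-nonNeg ε {{pos⇒nonNeg ε}} (fromℕ-mono-≤ mK≤n) ⟩
        ε * fromℕ n                       ∎
        where
        open ≤-Reasoning
        -- A natural number above Cθ (c + B): inflating by the factor B ≥ 1 turns Cθ into the number
        -- of cells.
        K = length cells ℕ.* (c ℕ.+ B)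
        C*[c+B]≤ : Cθ * fromℕ (c ℕ.+ B) ≤ fromℕ K
        C*[c+B]≤ = begin
          Cθ * fromℕ (c ℕ.+ B)                       ≤⟨ *-monoˡ-≤-0≤ (0≤C a b 1≤a a<b) (fromℕ-mono-≤ (ℕ.m≤n*m (c ℕ.+ B) B)) ⟩
          Cθ * fromℕ (B ℕ.* (c ℕ.+ B))               ≡⟨ cong (Cθ *_) (fromℕ-* B _) ⟩
          Cθ * (fromℕ B * fromℕ (c ℕ.+ B))           ≡⟨ sym (*-assoc Cθ _ _) ⟩
          Cθ * fromℕ B * fromℕ (c ℕ.+ B)             ≡⟨ cong (_* fromℕ (c ℕ.+ B)) density ⟩
          fromℕ (length cells) * fromℕ (c ℕ.+ B)     ≡⟨ sym (fromℕ-* (length cells) _) ⟩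
          fromℕ K                                    ∎
      quotient : ∃[ δ ] IsO[1] δ × (∀ n → δ n * fromℕ n ≡ deficit n)
      quotient = IsO-quotient deficit (*-zeroʳ Cθ)
        (λ n → subst (_≤ deficit n) (*-zeroʳ Cθ) (*-monoˡ-≤-0≤ (0≤C a b 1≤a a<b) (0≤fromℕ (n ℕ.⊓ (c ℕ.+ B)))))
        deficit-small
      δ = proj₁ quotient
      δ-small = proj₁ (proj₂ quotient)
      δ-quotient = proj₂ (proj₂ quotient)
      lower : ∀ n → (Cθ - δ n) * fromℕ n ≤ fromℕ (card (F n))
      lower n = *-cancelˡ-≤-pos (fromℕ B) {{fromℕ-pos 0<B}} (begin
        fromℕ B * ((Cθ - δ n) * N)                                   ≡⟨ cong (fromℕ B *_) (trans (*-distribʳ-+ N Cθ (- δ n))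
                                                                          (cong (Cθ * N +_) (trans (sym (neg-distribˡ-* (δ n) N)) (cong -_ (δ-quotient n))))) ⟩
        fromℕ B * (Cθ * N - deficit n)                               ≡⟨ *-distribˡ-+ (fromℕ B) (Cθ * N) (- deficit n) ⟩
        fromℕ B * (Cθ * N) + fromℕ B * - deficit n                   ≡⟨ cong (fromℕ B * (Cθ * N) +_) (sym (neg-distribʳ-* (fromℕ B) (deficit n))) ⟩
        fromℕ B * (Cθ * N) - fromℕ B * deficit n                     ≡⟨ cong₂ _-_ (scaled n) (scaled (n ℕ.⊓ (c ℕ.+ B))) ⟩
        fromℕ (u ℕ.* n) - D                                          ≤⟨ +-monoˡ-≤ (- D) (fromℕ-mono-≤ (Instance.dense (tiling n))) ⟩
        fromℕ (B ℕ.* card (F n) ℕ.+ u ℕ.* (n ℕ.⊓ (c ℕ.+ B))) - D     ≡⟨ cong (_- D) (fromℕ-+ (B ℕ.* card (F n)) _) ⟩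
        fromℕ (B ℕ.* card (F n)) + D - D                             ≡⟨ trans (+-assoc (fromℕ (B ℕ.* card (F n))) D (- D))
                                                                          (trans (cong (fromℕ (B ℕ.* card (F n)) +_) (+-inverseʳ D)) (+-identityʳ _)) ⟩
        fromℕ (B ℕ.* card (F n))                                     ≡⟨ fromℕ-* B (card (F n)) ⟩
        fromℕ B * fromℕ (card (F n))                                 ∎)
        where
        open ≤-Reasoning
        N = fromℕ n
        u = length cells
        D = fromℕ (u ℕ.* (n ℕ.⊓ (c ℕ.+ B)))
        scaled : ∀ m → fromℕ B * (Cθ * fromℕ m) ≡ fromℕ (u ℕ.* m)
        scaled m = trans (sym (*-assoc (fromℕ B) Cθ (fromℕ m))) (trans (cong (_* fromℕ m) (trans (*-comm (fromℕ B) Cθ) density)) (sym (fromℕ-* u m)))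

  module _ {B : ℕ} where

    fibre : (ℕ → ℕ) → ℕ → Subset B
    fibre f v = tabulate (λ x → f (toℕ x) ≡ᵇ v)

  -- On a block of two points, the singletons are petals of sets of size 2 and the whole block is
  -- the petal of a set of size 4. A small and a large set of one block share a core point and a
  -- petal point, half of 4. This makes 3 sets per 2 points, and Cθ = 3/2.
  halfCells : List (Cell 1 2 2 2)
  halfCells = (true ∷ false ∷ [] , true ∷ false ∷ []) ∷ (true ∷ false ∷ [] , false ∷ true ∷ []) ∷ (⊤ , ⊤) ∷ []

  half : Template 1 2 2 2 halfCells 4
  half = record
    { same-block  = toWitness {a? = allPairs? (sameBlock? 1 2) halfCells} _
    ; other-block = toWitness {a? = all? (λ X → all? (otherBlock? 1 2 X) halfCells) halfCells} _
    ; petals      = toWitness {a? = all? (λ X → 0 ℕ.<? size (proj₂ X)) halfCells} _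
    ; sizes       = toWitness {a? = all? (λ X → cellSize 1 2 X ℕ.≤? 4) halfCells} _
    }

  -- Arrange the 24 points in 4 rows of 6: the petals of sizes 6, 4 and 2 are the
  -- rows, the columns, and the pairs of neighbours within a row.
  thirdCells : List (Cell 1 3 3 24)
  thirdCells =
    map (λ v → true ∷ true ∷ true ∷ [] , fibre (ℕ._/ 6) v) (upTo 4) ++
    map (λ v → true ∷ true ∷ false ∷ [] , fibre (ℕ._% 6) v) (upTo 6) ++
    map (λ v → true ∷ false ∷ false ∷ [] , fibre (ℕ._/ 2) v) (upTo 12)

  -- A row and a column meet in one point, which together with 2 core points makes 3 = 9/3. A pair
  -- meets a column in at most one point, giving 1 or 2, and lies in a row or misses it, giving 3 or
  -- 1. The 4 + 6 + 12 = 22 cells on 24 points match Cθ = 11/12.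
  third : Template 1 3 3 24 thirdCells 9
  third = record
    { same-block  = toWitness {a? = allPairs? (sameBlock? 1 3) thirdCells} _
    ; other-block = toWitness {a? = all? (λ X → all? (otherBlock? 1 3 X) thirdCells) thirdCells} _
    ; petals      = toWitness {a? = all? (λ X → 0 ℕ.<? size (proj₂ X)) thirdCells} _
    ; sizes       = toWitness {a? = all? (λ X → cellSize 1 3 X ℕ.≤? 9) thirdCells} _
    }

  -- For θ > 1/2 the only index is 1, so Cθ = 1/(b - a) and a single sunflower with core size a and
  -- petals of size b - a is optimal.
  single : ∀ {a b} → a ℕ.< b → Template a b a (b ∸ a) ((⊤ , ⊤) ∷ []) b
  single {a} {b} a<b = record
    { same-block  = [] ∷ []
    ; other-block = (inj₁ (trans (cong (b ℕ.*_) (trans (cong size (∩-idem (⊤ {a}))) (∣⊤∣≡n a)))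
                      (trans (ℕ.*-comm b a) (cong (a ℕ.*_) (sym total)))) ∷ []) ∷ []
    ; petals      = subst (0 ℕ.<_) (sym (∣⊤∣≡n (b ∸ a))) (ℕ.m<n⇒0<n∸m a<b) ∷ []
    ; sizes       = ℕ.≤-reflexive total ∷ []
    }
    where
    total : size (⊤ {a}) ℕ.+ size (⊤ {b ∸ a}) ≡ b
    total = trans (cong₂ ℕ._+_ (∣⊤∣≡n a) (∣⊤∣≡n (b ∸ a))) (ℕ.m+[n∸m]≡n (ℕ.<⇒≤ a<b))

  sharpness : ∀ a b (1≤a : 1 ℕ.≤ a) (a<b : a ℕ.< b) → gcd a b ≡ 1 →
              ratio a b 1≤a a<b ≡ ℤ.+ 1 / 3 ⊎ (½ ≤ ratio a b 1≤a a<b × ratio a b 1≤a a<b < 1ℚ) →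
              Sharp a b 1≤a a<b
  sharpness a b 1≤a a<b gcd≡1 = Sum.[ θ≡1/3 , (λ { (½≤θ , _) → Sum.[ θ>½ , θ≡½ ]′ (ℕ.m≤n⇒m<n∨m≡n (b≤2a ½≤θ)) }) ]′
    where
    θ = ratio a b 1≤a a<b
    instance
      a≢0 : ℕ.NonZero a
      a≢0 = ℕ.>-nonZero 1≤a
      b-a≢0 : ℕ.NonZero (b ∸ a)
      b-a≢0 = ℕ.>-nonZero (ℕ.m<n⇒0<n∸m a<b)
    -- For θ = 1/3 and θ = 1/2, lowest terms pin down a and b, so that the explicit templates apply.
    a∣b⇒a≡1 : a ∣ b → a ≡ 1
    a∣b⇒a≡1 a∣b = ∣1⇒≡1 (subst (a ∣_) gcd≡1 (gcd-greatest ∣-refl a∣b))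

    θ≡1/3 : θ ≡ ℤ.+ 1 / 3 → Sharp a b 1≤a a<b
    θ≡1/3 eq = sharp (a∣b⇒a≡1 (divides 3 (trans b≡a*3 (ℕ.*-comm a 3)))) b≡a*3
      where
      b≡a*3 : b ≡ a ℕ.* 3
      b≡a*3 = trans (sym (ℕ.*-identityʳ b)) (θ-multiple⇒ a b 1≤a a<b {1} {3} (cong (_* fromℕ 3) (sym eq)))
      sharp : a ≡ 1 → b ≡ a ℕ.* 3 → Sharp a b 1≤a a<b
      -- The density is closed arithmetic, 11/12 times 24 equals 22, and holds by evaluation.
      sharp refl refl = template⇒sharp 1 3 1≤a a<b third z<s refl

    b≤2a : ½ ≤ θ → b ℕ.≤ a ℕ.* 2
    b≤2a ½≤θ = fromℕ-cancel-≤ (begin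
      fromℕ b                     ≡⟨ sym (*-identityʳ (fromℕ b)) ⟩
      fromℕ b * (½ * fromℕ 2)     ≤⟨ *-monoˡ-≤-0≤ (0≤fromℕ b) (*-monoʳ-≤-nonNeg (fromℕ 2) {{fromℕ-nonNeg {2}}} ½≤θ) ⟩
      fromℕ b * (θ * fromℕ 2)     ≡⟨ b*θ a b 1≤a a<b 2 ⟩
      fromℕ (a ℕ.* 2)             ∎)
      where open ≤-Reasoning

    θ≡½ : b ≡ a ℕ.* 2 → Sharp a b 1≤a a<b
    θ≡½ b≡a*2 = sharp (a∣b⇒a≡1 (divides 2 (trans b≡a*2 (ℕ.*-comm a 2)))) b≡a*2
      where
      sharp : a ≡ 1 → b ≡ a ℕ.* 2 → Sharp a b 1≤a a<b
      sharp refl refl = template⇒sharp 1 2 1≤a a<b half z<s refl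

    θ>½ : b ℕ.< a ℕ.* 2 → Sharp a b 1≤a a<b
    θ>½ b<a*2 = template⇒sharp a b 1≤a a<b
      (subst (Template a b a (b ∸ a) _) (sym (ℕ.suc-pred b {{ℕ.>-nonZero (ℕ.<-trans 1≤a a<b)}})) (single a<b))
      (ℕ.m<n⇒0<n∸m a<b)
      (begin
        c * harmonic (b ℕ./ a) * fromℕ (b ∸ a)      ≡⟨ cong (λ q → c * harmonic q * fromℕ (b ∸ a)) b/a≡1 ⟩
        c * harmonic 1 * fromℕ (b ∸ a)              ≡⟨ cong (_* fromℕ (b ∸ a)) (*-identityʳ c) ⟩
        c * fromℕ (b ∸ a)                           ≡⟨ /-*-cancel (ℤ.+ 1) (b ∸ a) ⟩
        1ℚ                                          ∎)
      where
      open ≡-Reasoning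
      c : ℚ
      c = ℤ.+ 1 / (b ∸ a)
      b/a≡1 : b ℕ./ a ≡ 1
      b/a≡1 = ℕ.≤-antisym (ℕ.≤-pred (ℕ.m<n*o⇒m/o<n (subst (b ℕ.<_) (ℕ.*-comm a 2) b<a*2))) (ℕ.m≥n⇒m/n>0 (ℕ.<⇒≤ a<b))

open import Defs
open import Data.Nat.Base as ℕ using (ℕ)
open import Data.Nat.GCD using (gcd)
open import Data.Integer.Base using (+_)
open import Data.Rational.Base using (ℚ; 0ℚ; 1ℚ; ½; _+_; _-_; _*_; _/_; _≤_; _<_)
open import Data.Fin.Base using (Fin)
open import Data.Fin.Subset using (Subset; _∈_; _∉_) renaming (∣_∣ to size)
open import Data.Product.Base using (Σ-syntax; ∃-syntax; _×_; _,_)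
open import Data.Sum.Base using (_⊎_)
open import Relation.Binary.PropositionalEquality using (_≡_)

open Asymptotics using (upper-bound; stability)
open Constructions using (sharpness)

theorem1p7 :
  ∀ (a b : ℕ) (1≤a : 1 ℕ.≤ a) (a<b : a ℕ.< b) → gcd a b ≡ 1 →
  let θ  = ratio a b 1≤a a<b
      Cθ = C a b 1≤a a<b
      m  = ⌊b/a⌋ a b 1≤a a<b
  in
  -- (1)
  (∀ (w : ℕ → ℝ) → (∀ n → fromℚ 0ℚ <ᵣ w n) → IsO[∛n] w →
   ∀ (F : ∀ n → Family n) → (∀ n → IsBounded (w n) (F n)) → (∀ n → IsIntersecting θ (F n)) →
   ∃[ δ ] IsO[1] δ × (∀ n → fromℕ (card (F n)) ≤ (Cθ + δ n) * fromℕ n))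
  ×
  -- (2)
  (θ ≡ + 1 / 3 ⊎ (½ ≤ θ × θ < 1ℚ) →
   Σ[ w ∈ (ℕ → ℝ) ] (∀ n → fromℚ 0ℚ <ᵣ w n) × IsO[∛n] w ×
   (Σ[ F ∈ (∀ n → Family n) ] (∀ n → IsBounded (w n) (F n)) × (∀ n → IsIntersecting θ (F n)) ×
    (∃[ δ ] IsO[1] δ × (∀ n → (Cθ - δ n) * fromℕ n ≤ fromℕ (card (F n))))))
  ×
  -- (3)
  (∀ (w : ℕ → ℝ) → (∀ n → fromℚ 0ℚ <ᵣ w n) → IsO[∛n] w →
   ∀ (F : ∀ n → Family n) → (∀ n → IsBounded (w n) (F n)) → (∀ n → IsIntersecting θ (F n)) →
   (∃[ δ ] IsO[1] δ × (∀ n → fromℕ (card (F n)) ≡ (Cθ + δ n) * fromℕ n)) →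
   Σ[ F* ∈ (∀ n → Family n) ]
     (∀ n → IsBouquet (F* n) × F* n ⊆ᶠ F n) ×
     IsO[n] (λ n → card (F n ∖ F* n)) ×
     (Σ[ E ∈ (∀ n → Subset n) ] IsO[n] (λ n → size (E n)) ×
      (∀ n (x : Fin n) → x ∉ E n → ∀ i → 1 ℕ.≤ i → i ℕ.≤ m →
       ∃[ A ] A ∈ᶠ F* n × size A ≡ i ℕ.* b × x ∈ A)))
theorem1p7 a b 1≤a a<b gcd≡1 =
  (λ w _ w-small F bounded intersecting → upper-bound a b 1≤a a<b gcd≡1 {w} w-small bounded intersecting) ,
  sharpness a b 1≤a a<b gcd≡1 ,
  (λ w _ w-small F bounded intersecting (δ , δ-small , tight) →
    stability a b 1≤a a<b gcd≡1 {w} w-small bounded intersecting {δ} δ-small tight)
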